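{- Let $n$ be a positive odd integer and $d\geq3$ an integer with $n\equiv 1\pmod d$. For integers $k\geq0$ define $$c_q(k)=(-1)^k\frac{(1+q^{2dk+1})(q^2;q^{2d})^2_k}{(1+q)(q^{2d};q^{2d})^2_k}q^{dk^2+(d-1)k}.$$ Then, modulo $\Phi_n(-q)^2\Phi_n(q)^2$, $$\sum_{\substack{i,j,s\geq0\\ i+j+s\leq n-1}}c_q(i)c_q(j)c_q(s)\equiv(-1)^{\frac{3(n-1)}{d}}[n]^3_{q^2}q^{\frac{3(n-1)(n+1-d)}{d}}\bigg(\sum_{k=0}^{\frac{n-1}{d}}\frac{(q^2,q;q^{2d})_k\, q^{2(d-1)k}}{(q^{2d},q^{2d+1};q^{2d})_k}\bigg)^3.$$
   Context: Here $q$ is an indeterminate. The $q$-shifted factorial is $(a;q)_0=1$, $(a;q)_m=(1-a)(1-aq)\cdots(1-aq^{m-1})$ for $m\geq1$, and $(a_1,\dots,a_s;q)_m=(a_1;q)_m\cdots(a_s;q)_m$. $[m]_{q^2}=1+q^2+\cdots+q^{2(m-1)}$. $\Phi_n(q)$ denotes the $n$-th cyclotomic polynomial in $q$. A congruence between rational functions in $q$ modulo a polynomial $P(q)$ means that the numerator of the difference (in reduced form) is divisible by $P(q)$ while its denominator is coprime to $P(q)$. -}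

module Defs where

open import Data.Nat using (ℕ; zero; suc; _∸_; _<ᵇ_) renaming (_+_ to _+ℕ_; _*_ to _*ℕ_)
open import Data.Nat.Divisibility using (_∣?_)
open import Data.Integer as Z using (ℤ; 0ℤ; 1ℤ; -1ℤ)
open import Data.List using (List; []; _∷_; _++_; map; length; replicate; reverse)
open import Data.List.Relation.Unary.All using (All)
open import Data.Product using (_×_; _,_; ∃-syntax)
open import Data.Bool using (if_then_else_)
open import Relation.Nullary using (does)
open import Relation.Binary.PropositionalEquality using (_≡_; _≢_)

-- Polynomials in q with integer coefficients, as little-endian
-- coefficient lists: a₀ ∷ a₁ ∷ … represents a₀ + a₁ q + ….

Poly : Set
Poly = List ℤ

infixl 6 _⊕_ _⊖_
infixl 7 _⊗_

_⊕_ : Poly → Poly → Poly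
[] ⊕ g = g
(a ∷ f) ⊕ [] = a ∷ f
(a ∷ f) ⊕ (b ∷ g) = (a Z.+ b) ∷ (f ⊕ g)

scale : ℤ → Poly → Poly
scale c = map (c Z.*_)

_⊗_ : Poly → Poly → Poly
[] ⊗ g = []
(a ∷ f) ⊗ g = scale a g ⊕ (0ℤ ∷ (f ⊗ g))

neg : Poly → Poly
neg = scale -1ℤ

_⊖_ : Poly → Poly → Poly
f ⊖ g = f ⊕ neg g

cst : ℤ → Poly
cst c = c ∷ []

one : Poly
one = cst 1ℤ

qpow : ℕ → Poly
qpow k = replicate k 0ℤ ++ (1ℤ ∷ [])

pow : Poly → ℕ → Poly
pow f zero = one
pow f (suc k) = f ⊗ pow f k

sgn : ℕ → Poly
sgn k = pow (cst -1ℤ) k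

_≈P_ : Poly → Poly → Set
f ≈P g = All (λ c → c ≡ 0ℤ) (f ⊖ g)

negVar : Poly → Poly
negVar [] = []
negVar (a ∷ f) = a ∷ neg (negVar f)

sumP : ℕ → (ℕ → Poly) → Poly
sumP zero f = []
sumP (suc m) f = sumP m f ⊕ f m

prodP : ℕ → (ℕ → Poly) → Poly
prodP zero f = one
prodP (suc m) f = prodP m f ⊗ f m

dropZeros : List ℤ → List ℤ   -- on big-endian lists
dropZeros [] = []
dropZeros (a ∷ f) = if does (a Z.≟ 0ℤ) then dropZeros f else (a ∷ f)

trim : Poly → Poly
trim f = reverse (dropZeros (reverse f))

lastZ : List ℤ → ℤ
lastZ [] = 0ℤ
lastZ (a ∷ []) = a
lastZ (a ∷ b ∷ f) = lastZ (b ∷ f)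

divMonicFuel : ℕ → Poly → Poly → Poly
divMonicFuel zero f g = []
divMonicFuel (suc fuel) f g =
  if length (trim f) <ᵇ length (trim g) then []
  else (t ⊕ divMonicFuel fuel (trim f ⊖ t ⊗ g) g)
  where
  t : Poly
  t = scale (lastZ (trim f)) (qpow (length (trim f) ∸ length (trim g)))

divMonic : Poly → Poly → Poly
divMonic f g = divMonicFuel (suc (length f)) f g

-- Cyclotomic polynomials, via  q^m - 1 = Π_{e ∣ m} Φ_e(q),
-- i.e.  Φ_m = (q^m - 1) / Π_{e ∣ m, e < m} Φ_e  (exact division by a
-- monic polynomial).

divisorProd : ℕ → ℕ → List Poly → Poly
divisorProd m i [] = one
divisorProd m i (φ ∷ φs) =
  (if does (i ∣? m) then φ else one) ⊗ divisorProd m (suc i) φs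

cycloStep : ℕ → List Poly → List Poly
cycloStep m prev = prev ++ (divMonic (qpow m ⊖ one) (divisorProd m 1 prev) ∷ [])

cycloList : ℕ → List Poly
cycloList zero = []
cycloList (suc N) = cycloStep (suc N) (cycloList N)

nth : ℕ → List Poly → Poly
nth i [] = one
nth zero (φ ∷ φs) = φ
nth (suc i) (φ ∷ φs) = nth i φs

Φ : ℕ → Poly
Φ n = nth (n ∸ 1) (cycloList n)

Frac : Set
Frac = Poly × Poly

infixl 6 _+F_
infixl 7 _*F_

_+F_ : Frac → Frac → Frac
(a , b) +F (c , e) = (a ⊗ e ⊕ c ⊗ b , b ⊗ e)

_*F_ : Frac → Frac → Frac
(a , b) *F (c , e) = (a ⊗ c , b ⊗ e)

zeroF : Frac
zeroF = ([] , one)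

sumF : ℕ → (ℕ → Frac) → Frac
sumF zero f = zeroF
sumF (suc m) f = sumF m f +F f m

-- Congruence of rational functions modulo P:  a/b - c/e = N/D with
-- P ∣ N in ℤ[q] and D coprime to P (u D + v P = nonzero constant).
-- This is equivalent to: the reduced numerator of the difference is
-- divisible by P and its reduced denominator is coprime to P.
CongMod : Poly → Frac → Frac → Set
CongMod P (a , b) (c , e) =
  ∃[ N ] ∃[ D ] ∃[ w ] ∃[ u ] ∃[ v ] ∃[ z ]
    ( (z ≢ 0ℤ)
    × (D ⊗ (a ⊗ e ⊖ c ⊗ b)) ≈P (N ⊗ (b ⊗ e))
    × N ≈P (P ⊗ w)
    × (u ⊗ D ⊕ v ⊗ P) ≈P cst z )

poch : Poly → Poly → ℕ → Poly
poch a p m = prodP m (λ i → one ⊖ a ⊗ pow p i)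

qint2 : ℕ → Poly
qint2 m = sumP m (λ i → qpow (2 *ℕ i))

cq : ℕ → ℕ → Frac
cq d k =
  ( sgn k ⊗ (one ⊕ qpow (2 *ℕ d *ℕ k +ℕ 1))
      ⊗ pow (poch (qpow 2) (qpow (2 *ℕ d)) k) 2
      ⊗ qpow (d *ℕ k *ℕ k +ℕ (d ∸ 1) *ℕ k)
  , (one ⊕ qpow 1) ⊗ pow (poch (qpow (2 *ℕ d)) (qpow (2 *ℕ d)) k) 2 )

lhs : ℕ → ℕ → Frac
lhs n d =
  sumF n (λ i → sumF (n ∸ i) (λ j → sumF (n ∸ i ∸ j) (λ s →
    cq d i *F cq d j *F cq d s)))

innerSum : ℕ → ℕ → Frac
innerSum d m = sumF (suc m) (λ k →
  ( poch (qpow 2) (qpow (2 *ℕ d)) k ⊗ poch (qpow 1) (qpow (2 *ℕ d)) k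
      ⊗ qpow (2 *ℕ (d ∸ 1) *ℕ k)
  , poch (qpow (2 *ℕ d)) (qpow (2 *ℕ d)) k
      ⊗ poch (qpow (2 *ℕ d +ℕ 1)) (qpow (2 *ℕ d)) k ))

-- right-hand side, with m = (n-1)/d; the exponent 3(n-1)(n+1-d)/d is
-- written 3 m (n+1-d) (truncated subtraction is harmless: n+1 < d only
-- when n = 1, i.e. m = 0)
rhs : ℕ → ℕ → ℕ → Frac
rhs n d m =
  ( sgn (3 *ℕ m) ⊗ pow (qint2 n) 3 ⊗ qpow (3 *ℕ m *ℕ (n +ℕ 1 ∸ d)) , one )
  *F (innerSum d m *F innerSum d m *F innerSum d m)

modulus : ℕ → Poly
modulus n = pow (negVar (Φ n)) 2 ⊗ pow (Φ n) 2

{-# OPTIONS --safe #-}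

-- Write a = q², p = q²ᵈ and x = a pᵐ = q²ⁿ.  Both Φ_n(q) and Φ_n(-q) divide 1 - x, so it suffices to
-- work modulo (1 - x)² over fractions whose denominators are coprime to Φ_n(q) Φ_n(-q).  For m < k < n
-- the numerator of c_q(k) contains (1 - x)²; as 3m < n, the triple sum collapses to the cube of
-- S = Σ_{k ≤ m} c_q(k).  Modulo (1 - x)² the factors (1 - a pⁱ)² and (1 - pⁱ)² may be replaced by
-- (1 - a pⁱ x)(1 - a pⁱ / x) and (1 - pⁱ x)(1 - pⁱ / x), which turns S into a terminating
-- very-well-poised series.  A limiting case of Watson's transformation then evaluates S: expand
-- bᵏ / (1 - b pᵏ), b = q, in partial fractions, interchange the two summations, and evaluate the
-- inner ₆φ₅ sum; both steps rest on Wilf–Zeilberger certificates.  Undoing the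
-- perturbation in the transformed series gives the right-hand side.  The one pole there,
-- 1 / (1 - qⁿ), is cancelled by the factor 1 - x of [n]_{q²}.  The case n = 1 is an identity, treated
-- separately because 1 + q is then not coprime to Φ_1(-q).
--
-- The facts used about Φ_n are q^n - 1 = Φ_n Π_{e ∣ n, e < n} Φ_e and the coprimality of Φ_n with
-- q^j - 1 for n ∤ j.  They are proved by simultaneous induction on n: coprimality of the smaller Φ_e
-- shows that their product divides q^n - 1 over ℚ, hence over ℤ since it is monic.

module Submission where

open import Algebra.Bundles using (CommutativeRing)
import Algebra.Properties.AbelianGroup as AbelianGroupProperties
import Algebra.Properties.Ring as RingProperties
import Algebra.Properties.Semiring.Exp as Exp
import Algebra.Solver.Ring as RingSolver
open import Algebra.Solver.Ring.AlmostCommutativeRing using (fromCommutativeRing; _-Raw-AlmostCommutative⟶_)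
open import Data.Bool.Base using (true; false; if_then_else_; T)
open import Data.Integer.Base as ℤ using (ℤ; +_; -[1+_])
import Data.Integer.Properties as ℤₚ
open import Data.List.Base as List using ([]; _∷_; _++_; length; reverse)
import Data.List.Properties as Listₚ
open import Data.List.Relation.Unary.All using (All; []; _∷_)
open import Data.Maybe.Base using (Maybe; just; nothing)
open import Data.Nat.Base as ℕ using (ℕ; zero; suc; pred; _∸_; z≤n; s≤s)
import Data.Nat.Coprimality as Coprimality
import Data.Nat.Divisibility as ℕ∣
import Data.Nat.DivMod as DivMod
import Data.Nat.GCD as GCD
open import Data.Nat.Induction using (<-rec)
import Data.Nat.Properties as ℕₚ
open import Data.Nat.Tactic.RingSolver using (solve-∀)
open import Data.Product using (_×_; _,_; ∃; proj₁; proj₂)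
import Data.Sign.Base as Sign
open import Data.Sum using (_⊎_; inj₁; inj₂)
open import Data.Unit.Base using (tt)
open import Level using (Level; _⊔_; 0ℓ) renaming (suc to lsuc)
open import Relation.Binary.PropositionalEquality as ≡ using (_≡_; _≢_)
open import Relation.Binary.Structures using (IsEquivalence)
open import Relation.Nullary using (yes; no; ¬_; contradiction; does; Dec)
open import Defs

-- The replacement of squares rests on (1 - ux)(1 - u/x) = (1 - u)² - u(1 - x)²/x. Division by x is
-- avoided throughout: with l = m - k the factors in 1/x become, up to powers of p, factors such as
-- 1 - pˡ, so every series is a sum over k + l = m and no negative exponent occurs. The series is
-- very-well-poised because a = b²: then 1 + bpᵏ = (1 - ap²ᵏ)/(1 - bpᵏ), and this is where the
-- fraction 1/(1 - bpᵏ) comes from. The main obstacle is that the exact identities contain poles at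
-- Φ_n, namely 1/(1 - x) and possibly 1/(1 - qⁿ), which must not occur in a congruence. Hence there
-- are two levels. Identities are proved in an arbitrary commutative ring with explicitly given
-- inverses; congruences require only that their quotient lies in a subring of integral elements. A
-- factor 1 - x is carried along to cancel the poles before passing from the first level to the
-- second. Bézout identities over ℤ hold only up to a nonzero integer, so coprimality and
-- divisibility are handled up to such constants.

-- The canonical map from the integers to a ring, and the ring solver.

module IntegerCoefficients {c ℓ} (R : CommutativeRing c ℓ) where
  open CommutativeRing R
  open import Relation.Binary.Reasoning.Setoid setoid
  open RingProperties ring using (-‿distribˡ-*; -‿distribʳ-*; -0#≈0#; -‿involutive)
  open AbelianGroupProperties +-abelianGroup using () renaming (⁻¹-∙-comm to -‿+-comm)

  -- The separate clause for 1 makes the integer 1 denote `1#` itself rather than `1# + 0#`, so that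
  -- the constant `:1` of the solver agrees with `1#` in a goal by computation.
  fromℕ : ℕ → Carrier
  fromℕ 0             = 0#
  fromℕ 1             = 1#
  fromℕ (suc (suc n)) = 1# + fromℕ (suc n)

  fromℕ-suc : ∀ n → fromℕ (suc n) ≈ 1# + fromℕ n
  fromℕ-suc zero    = sym (+-identityʳ 1#)
  fromℕ-suc (suc n) = refl

  fromℕ-+ : ∀ m n → fromℕ (m ℕ.+ n) ≈ fromℕ m + fromℕ n
  fromℕ-+ zero    n = sym (+-identityˡ _)
  fromℕ-+ (suc m) n = begin
    fromℕ (suc (m ℕ.+ n))       ≈⟨ fromℕ-suc (m ℕ.+ n) ⟩
    1# + fromℕ (m ℕ.+ n)        ≈⟨ +-congˡ (fromℕ-+ m n) ⟩
    1# + (fromℕ m + fromℕ n)    ≈⟨ +-assoc _ _ _ ⟨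
    1# + fromℕ m + fromℕ n      ≈⟨ +-congʳ (fromℕ-suc m) ⟨
    fromℕ (suc m) + fromℕ n     ∎

  fromℕ-* : ∀ m n → fromℕ (m ℕ.* n) ≈ fromℕ m * fromℕ n
  fromℕ-* zero    n = sym (zeroˡ _)
  fromℕ-* (suc m) n = begin
    fromℕ (n ℕ.+ m ℕ.* n)              ≈⟨ fromℕ-+ n (m ℕ.* n) ⟩
    fromℕ n + fromℕ (m ℕ.* n)          ≈⟨ +-cong (sym (*-identityˡ _)) (fromℕ-* m n) ⟩
    1# * fromℕ n + fromℕ m * fromℕ n   ≈⟨ distribʳ _ _ _ ⟨
    (1# + fromℕ m) * fromℕ n           ≈⟨ *-congʳ (fromℕ-suc m) ⟨
    fromℕ (suc m) * fromℕ n            ∎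

  fromℤ : ℤ → Carrier
  fromℤ (+ n)    = fromℕ n
  fromℤ -[1+ n ] = - fromℕ (suc n)

  fromℤ-neg : ∀ i → fromℤ (ℤ.- i) ≈ - fromℤ i
  fromℤ-neg (+ zero)    = sym -0#≈0#
  fromℤ-neg (+ (suc n)) = refl
  fromℤ-neg -[1+ n ]    = sym (-‿involutive _)

  private
    cancel-1 : ∀ x y → (1# + x) - (1# + y) ≈ x - y
    cancel-1 x y = begin
      (1# + x) - (1# + y)          ≈⟨ +-cong (+-comm 1# x) (sym (-‿+-comm 1# y)) ⟩
      (x + 1#) + (- 1# + - y)      ≈⟨ +-assoc _ _ _ ⟩
      x + (1# + (- 1# + - y))      ≈⟨ +-congˡ (sym (+-assoc _ _ _)) ⟩
      x + ((1# + - 1#) + - y)      ≈⟨ +-congˡ (+-congʳ (-‿inverseʳ 1#)) ⟩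
      x + (0# + - y)               ≈⟨ +-congˡ (+-identityˡ _) ⟩
      x - y                        ∎

  fromℤ-⊖ : ∀ m n → fromℤ (m ℤ.⊖ n) ≈ fromℕ m - fromℕ n
  fromℤ-⊖ m zero = sym (trans (+-congˡ -0#≈0#) (+-identityʳ _))
  fromℤ-⊖ zero (suc n) = sym (+-identityˡ _)
  fromℤ-⊖ (suc m) (suc n) = begin
    fromℤ (suc m ℤ.⊖ suc n)       ≡⟨ ≡.cong fromℤ (ℤₚ.[1+m]⊖[1+n]≡m⊖n m n) ⟩
    fromℤ (m ℤ.⊖ n)               ≈⟨ fromℤ-⊖ m n ⟩
    fromℕ m - fromℕ n             ≈⟨ cancel-1 _ _ ⟨
    (1# + fromℕ m) - (1# + fromℕ n)
      ≈⟨ +-cong (fromℕ-suc m) (-‿cong (fromℕ-suc n)) ⟨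
    fromℕ (suc m) - fromℕ (suc n) ∎

  fromℤ-+ : ∀ i j → fromℤ (i ℤ.+ j) ≈ fromℤ i + fromℤ j
  fromℤ-+ (+ m)    (+ n)    = fromℕ-+ m n
  fromℤ-+ (+ m)    -[1+ n ] = fromℤ-⊖ m (suc n)
  fromℤ-+ -[1+ m ] (+ n)    = trans (fromℤ-⊖ n (suc m)) (+-comm _ _)
  fromℤ-+ -[1+ m ] -[1+ n ] = begin
    - fromℕ (suc (suc (m ℕ.+ n)))          ≈⟨ -‿cong (+-congˡ (fromℕ-+ (suc m) n)) ⟩
    - (1# + (fromℕ (suc m) + fromℕ n))     ≈⟨ -‿cong (trans (+-comm _ _) (+-assoc _ _ _)) ⟩
    - (fromℕ (suc m) + (fromℕ n + 1#))     ≈⟨ -‿cong (+-congˡ (trans (+-comm _ _) (sym (fromℕ-suc n)))) ⟩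
    - (fromℕ (suc m) + fromℕ (suc n))      ≈⟨ -‿+-comm _ _ ⟨
    - fromℕ (suc m) + - fromℕ (suc n)      ∎

  private
    +◃ : ∀ n → fromℤ (Sign.+ ℤ.◃ n) ≈ fromℕ n
    +◃ zero    = refl
    +◃ (suc n) = refl

    -◃ : ∀ n → fromℤ (Sign.- ℤ.◃ n) ≈ - fromℕ n
    -◃ zero    = sym -0#≈0#
    -◃ (suc n) = refl

  fromℤ-* : ∀ i j → fromℤ (i ℤ.* j) ≈ fromℤ i * fromℤ j
  fromℤ-* (+ m)    (+ n)    = trans (+◃ (m ℕ.* n)) (fromℕ-* m n)
  fromℤ-* (+ m)    -[1+ n ] = begin
    fromℤ (Sign.- ℤ.◃ (m ℕ.* suc n)) ≈⟨ -◃ (m ℕ.* suc n) ⟩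
    - fromℕ (m ℕ.* suc n)            ≈⟨ -‿cong (fromℕ-* m (suc n)) ⟩
    - (fromℕ m * fromℕ (suc n))      ≈⟨ -‿distribʳ-* _ _ ⟩
    fromℕ m * - fromℕ (suc n)        ∎
  fromℤ-* -[1+ m ] (+ n)    = begin
    fromℤ (Sign.- ℤ.◃ (suc m ℕ.* n)) ≈⟨ -◃ (suc m ℕ.* n) ⟩
    - fromℕ (suc m ℕ.* n)            ≈⟨ -‿cong (fromℕ-* (suc m) n) ⟩
    - (fromℕ (suc m) * fromℕ n)      ≈⟨ -‿distribˡ-* _ _ ⟩
    - fromℕ (suc m) * fromℕ n        ∎
  fromℤ-* -[1+ m ] -[1+ n ] = begin
    fromℕ (suc m ℕ.* suc n)              ≈⟨ fromℕ-* (suc m) (suc n) ⟩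
    fromℕ (suc m) * fromℕ (suc n)        ≈⟨ -‿involutive _ ⟨
    - - (fromℕ (suc m) * fromℕ (suc n))  ≈⟨ -‿cong (-‿distribˡ-* _ _) ⟩
    - (- fromℕ (suc m) * fromℕ (suc n))  ≈⟨ -‿distribʳ-* _ _ ⟩
    - fromℕ (suc m) * - fromℕ (suc n)    ∎

  fromℤ-morphism : ℤ.+-*-rawRing -Raw-AlmostCommutative⟶ fromCommutativeRing R
  fromℤ-morphism = record
    { ⟦_⟧    = fromℤ
    ; +-homo = fromℤ-+
    ; *-homo = fromℤ-*
    ; -‿homo = fromℤ-neg
    ; 0-homo = refl
    ; 1-homo = refl
    }

  private
    coeff≟ : ∀ i j → Maybe (fromℤ i ≈ fromℤ j)
    coeff≟ i j with i ℤₚ.≟ j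
    ... | yes ≡.refl = just refl
    ... | no _       = nothing

  module Solver = RingSolver ℤ.+-*-rawRing (fromCommutativeRing R) fromℤ-morphism coeff≟
  open Solver using (Polynomial; con)

  :0 :1 : ∀ {n} → Polynomial n
  :0 = con (+ 0)
  :1 = con (+ 1)

-- Finite sums, finite products and sums over antidiagonals.

module Sums {c ℓ} (R : CommutativeRing c ℓ) where
  open CommutativeRing R
  open import Relation.Binary.Reasoning.Setoid setoid
  open IntegerCoefficients R
  open Solver

  sum : ℕ → (ℕ → Carrier) → Carrier
  sum zero    f = 0#
  sum (suc n) f = sum n f + f n

  prod : ℕ → (ℕ → Carrier) → Carrier
  prod zero    f = 1#
  prod (suc n) f = prod n f * f n

  -- Passing the complementary index n - i as a second argument keeps truncated subtraction out of
  -- all summands.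
  conv : ℕ → (ℕ → ℕ → Carrier) → Carrier
  conv zero    f = f 0 0
  conv (suc n) f = f 0 (suc n) + conv n (λ i j → f (suc i) j)

  tripleSum : ℕ → (ℕ → Carrier) → Carrier
  tripleSum n f = sum n λ i → sum (n ℕ.∸ i) λ j → sum (n ℕ.∸ i ℕ.∸ j) λ k → f i * f j * f k

  prod-cong : ∀ n {f g} → (∀ i → f i ≈ g i) → prod n f ≈ prod n g
  prod-cong zero    f≈g = refl
  prod-cong (suc n) f≈g = *-cong (prod-cong n f≈g) (f≈g n)

  prod-+ : ∀ m n f → prod (m ℕ.+ n) f ≈ prod m f * prod n (λ i → f (m ℕ.+ i))
  prod-+ m zero f = begin
    prod (m ℕ.+ 0) f  ≡⟨ ≡.cong (λ k → prod k f) (ℕₚ.+-identityʳ m) ⟩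
    prod m f          ≈⟨ *-identityʳ _ ⟨
    prod m f * 1#     ∎
  prod-+ m (suc n) f = begin
    prod (m ℕ.+ suc n) f                      ≡⟨ ≡.cong (λ k → prod k f) (ℕₚ.+-suc m n) ⟩
    prod (m ℕ.+ n) f * f (m ℕ.+ n)            ≈⟨ *-congʳ (prod-+ m n f) ⟩
    (prod m f * prod n _) * f (m ℕ.+ n)       ≈⟨ *-assoc _ _ _ ⟩
    prod m f * (prod n _ * f (m ℕ.+ n))       ∎

  prod-inverse : ∀ n {f g} → (∀ i → f i * g i ≈ 1#) → prod n f * prod n g ≈ 1#
  prod-inverse zero    fg≈1 = *-identityˡ 1#
  prod-inverse (suc n) {f} {g} fg≈1 = begin
    (prod n f * f n) * (prod n g * g n)
      ≈⟨ solve 4 (λ x y z w → (x :* y) :* (z :* w) := (x :* z) :* (y :* w)) refl _ _ _ _ ⟩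
    (prod n f * prod n g) * (f n * g n)  ≈⟨ *-cong (prod-inverse n fg≈1) (fg≈1 n) ⟩
    1# * 1#                              ≈⟨ *-identityˡ 1# ⟩
    1#                                   ∎

  conv-cong : ∀ n {f g} → (∀ i j → i ℕ.+ j ≡ n → f i j ≈ g i j) → conv n f ≈ conv n g
  conv-cong zero    f≈g = f≈g 0 0 ≡.refl
  conv-cong (suc n) f≈g =
    +-cong (f≈g 0 (suc n) ≡.refl) (conv-cong n (λ i j i+j≡n → f≈g (suc i) j (≡.cong suc i+j≡n)))

  conv-snoc : ∀ n f → conv (suc n) f ≈ conv n (λ i j → f i (suc j)) + f (suc n) 0
  conv-snoc zero    f = refl
  conv-snoc (suc n) f = begin
    f 0 (suc (suc n)) + conv (suc n) (λ i j → f (suc i) j)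
      ≈⟨ +-congˡ (conv-snoc n (λ i j → f (suc i) j)) ⟩
    f 0 (suc (suc n)) + (conv n (λ i j → f (suc i) (suc j)) + f (suc (suc n)) 0)
      ≈⟨ +-assoc _ _ _ ⟨
    f 0 (suc (suc n)) + conv n (λ i j → f (suc i) (suc j)) + f (suc (suc n)) 0  ∎

  conv-+ : ∀ n f g → conv n (λ i j → f i j + g i j) ≈ conv n f + conv n g
  conv-+ zero    f g = refl
  conv-+ (suc n) f g = begin
    (f 0 (suc n) + g 0 (suc n)) + conv n (λ i j → f (suc i) j + g (suc i) j)
      ≈⟨ +-congˡ (conv-+ n _ _) ⟩
    (f 0 (suc n) + g 0 (suc n)) + (conv n (λ i j → f (suc i) j) + conv n (λ i j → g (suc i) j))
      ≈⟨ solve 4 (λ x y z w → (x :+ y) :+ (z :+ w) := (x :+ z) :+ (y :+ w)) refl _ _ _ _ ⟩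
    (f 0 (suc n) + conv n (λ i j → f (suc i) j)) + (g 0 (suc n) + conv n (λ i j → g (suc i) j)) ∎

  conv-*ˡ : ∀ n c f → c * conv n f ≈ conv n (λ i j → c * f i j)
  conv-*ˡ zero    c f = refl
  conv-*ˡ (suc n) c f = trans (distribˡ c _ _) (+-congˡ (conv-*ˡ n c _))

  -- Both sides run over the triples with j + r + l = n. This is the interchange of summations in
  -- `transformation`, and also the associativity of the Cauchy product of polynomials.
  conv-assoc : ∀ n (f : ℕ → ℕ → ℕ → Carrier) →
    conv n (λ k l → conv k (λ j r → f j r l)) ≈ conv n (λ j k → conv k (λ r l → f j r l))
  conv-assoc zero    f = refl
  conv-assoc (suc n) f = begin
    f 0 0 (suc n) + conv n (λ k l → f 0 (suc k) l + conv k (λ j r → f (suc j) r l))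
      ≈⟨ +-congˡ (conv-+ n _ _) ⟩
    f 0 0 (suc n) + (conv n (λ k l → f 0 (suc k) l) + conv n (λ k l → conv k (λ j r → f (suc j) r l)))
      ≈⟨ +-assoc _ _ _ ⟨
    f 0 0 (suc n) + conv n (λ k l → f 0 (suc k) l) + conv n (λ k l → conv k (λ j r → f (suc j) r l))
      ≈⟨ +-congˡ (conv-assoc n (λ j → f (suc j))) ⟩
    f 0 0 (suc n) + conv n (λ r l → f 0 (suc r) l) + conv n (λ j k → conv k (λ r l → f (suc j) r l)) ∎

  -- g lives on the antidiagonal of n + 1, where (i + 1, j) and (i, j + 1) are neighbours. In this
  -- form a Wilf-Zeilberger certificate is summed.
  conv-telescope : ∀ n {f} (g : ℕ → ℕ → Carrier) →
    (∀ i j → i ℕ.+ j ≡ n → f i j ≈ g (suc i) j - g i (suc j)) →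
    conv n f ≈ g (suc n) 0 - g 0 (suc n)
  conv-telescope zero    g f≈Δg = f≈Δg 0 0 ≡.refl
  conv-telescope (suc n) {f} g f≈Δg = begin
    f 0 (suc n) + conv n (λ i j → f (suc i) j)
      ≈⟨ +-cong (f≈Δg 0 (suc n) ≡.refl)
                (conv-telescope n (λ i → g (suc i)) (λ i j e → f≈Δg (suc i) j (≡.cong suc e))) ⟩
    (g 1 (suc n) - g 0 (suc (suc n))) + (g (suc (suc n)) 0 - g 1 (suc n))
      ≈⟨ solve 3 (λ x y z → (x :- y) :+ (z :- x) := z :- y) refl _ _ _ ⟩
    g (suc (suc n)) 0 - g 0 (suc (suc n)) ∎

  conv≈sum : ∀ n f → conv n (λ i _ → f i) ≈ sum (suc n) f
  conv≈sum zero    f = sym (+-identityˡ _)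
  conv≈sum (suc n) f = trans (conv-snoc n (λ i _ → f i)) (+-congʳ (conv≈sum n f))

  unit-cancel : ∀ {u v x} → u * v ≈ 1# → u * x ≈ 0# → x ≈ 0#
  unit-cancel {u} {v} {x} uv≈1 ux≈0 = begin
    x            ≈⟨ *-identityˡ x ⟨
    1# * x       ≈⟨ *-congʳ uv≈1 ⟨
    (u * v) * x  ≈⟨ solve 3 (λ u v x → (u :* v) :* x := v :* (u :* x)) refl u v x ⟩
    v * (u * x)  ≈⟨ *-congˡ ux≈0 ⟩
    v * 0#       ≈⟨ zeroʳ v ⟩
    0#           ∎

-- 2j + l, arranged so that the successor of j can be pulled out twice definitionally.
ix : ℕ → ℕ → ℕ
ix zero    l = l
ix (suc j) l = suc (suc (ix j l))

ix-suc : ∀ j l → ix j (suc l) ≡ suc (ix j l)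
ix-suc zero    l = ≡.refl
ix-suc (suc j) l = ≡.cong (λ k → suc (suc k)) (ix-suc j l)

ix-+ : ∀ j r l → ix (j ℕ.+ r) l ≡ ix j 0 ℕ.+ ix r l
ix-+ zero    r l = ≡.refl
ix-+ (suc j) r l = ≡.cong (λ k → suc (suc k)) (ix-+ j r l)

ix-0 : ∀ j l → ix j l ≡ ix j 0 ℕ.+ l
ix-0 zero    l = ≡.refl
ix-0 (suc j) l = ≡.cong (λ k → suc (suc k)) (ix-0 j l)

-- Shifted factorials in base p and the terminating ₆φ₅ sum.

module Pochhammer {c ℓ} (R : CommutativeRing c ℓ) (p : CommutativeRing.Carrier R) where
  open CommutativeRing R
  open import Relation.Binary.Reasoning.Setoid setoid
  open IntegerCoefficients R
  open Solver
  open Sums R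
  open Exp semiring using (_^_; ^-homo-*; ^-congʳ) public

  factor : Carrier → ℕ → Carrier
  factor a i = 1# - a * p ^ i

  -- Inverses are given data, so a quotient by (a;p)_k is a product with `prod k ia` and the ring
  -- need not be a field.
  FactorsInvertedBy : Carrier → (ℕ → Carrier) → Set ℓ
  FactorsInvertedBy a ia = ∀ i → factor a i * ia i ≈ 1#

  pochhammer : Carrier → ℕ → Carrier
  pochhammer a k = prod k (factor a)

  sign : ℕ → Carrier
  sign k = (- 1#) ^ k

  -- The power with exponent k(k-1)/2, built up recursively to avoid the division by two.
  p^tri : ℕ → Carrier
  p^tri zero    = 1#
  p^tri (suc k) = p^tri k * p ^ k

  p^ix : ∀ j l → p ^ ix j l ≈ p ^ j * p ^ j * p ^ l
  p^ix zero    l = solve 1 (λ x → x := :1 :* :1 :* x) refl _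
  p^ix (suc j) l = begin
    p * (p * p ^ ix j l)                 ≈⟨ *-congˡ (*-congˡ (p^ix j l)) ⟩
    p * (p * (p ^ j * p ^ j * p ^ l))
      ≈⟨ solve 3 (λ p s w → p :* (p :* (s :* s :* w)) := (p :* s) :* (p :* s) :* w) refl _ _ _ ⟩
    (p * p ^ j) * (p * p ^ j) * p ^ l    ∎

  factor-ix : ∀ a j l → factor a (ix j l) ≈ 1# - a * (p ^ j * p ^ j * p ^ l)
  factor-ix a j l = +-congˡ (-‿cong (*-congˡ (p^ix j l)))

  factor-shift : ∀ a m i → factor a (m ℕ.+ i) ≈ factor (a * p ^ m) i
  factor-shift a m i = +-congˡ (-‿cong (trans (*-congˡ (^-homo-* p m i)) (sym (*-assoc _ _ _))))

  pochhammer-+ : ∀ a m n → pochhammer a (m ℕ.+ n) ≈ pochhammer a m * pochhammer (a * p ^ m) n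
  pochhammer-+ a m n = trans (prod-+ m n (factor a)) (*-congˡ (prod-cong n (factor-shift a m)))

  sign-+ : ∀ j r → sign (j ℕ.+ r) ≈ sign j * sign r
  sign-+ = ^-homo-* (- 1#)

  sign-² : ∀ j → sign j * sign j ≈ 1#
  sign-² zero    = *-identityˡ 1#
  sign-² (suc j) = trans (solve 1 (λ s → (:- :1 :* s) :* (:- :1 :* s) := s :* s) refl _) (sign-² j)

  -- The terminating ₆φ₅ sum with one parameter sent to infinity, multiplied by (αa;p)_n.
  module SixPhiFive
    (α a : Carrier) (ip iα : ℕ → Carrier)
    (ip-inv : FactorsInvertedBy p ip)
    (iα-inv : FactorsInvertedBy α iα)
    where

    -- With l = n - r, the quotients (αa;p)_(2r+l) / (α;p)_(2r+l+1) and (a;p)_l / (p;p)_l are the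
    -- well-poised pairs belonging to the parameters αapⁿ and p⁻ⁿ, up to powers and factors free of
    -- r. Writing them through l means that p need not be invertible.
    term : ℕ → ℕ → Carrier
    term r l = sign r * (1# - α * p ^ r * p ^ r) * p^tri r * pochhammer α r * pochhammer a l
             * pochhammer (α * a) (ix r l) * (prod r ip * prod l ip * prod (suc (ix r l)) iα)

    value : ℕ → Carrier
    value n = (- a) ^ n * p^tri n * pochhammer (α * a) n * prod n ip

    private
      -- The Wilf–Zeilberger certificate.
      cert : ℕ → ℕ → Carrier
      cert r l = - (1# - p ^ r) * sign r * p^tri r * pochhammer α r * pochhammer a l
               * pochhammer (α * a) (pred (ix r l)) * (prod r ip * prod l ip * prod (ix r l) iα)

      κ : ℕ → Carrier
      κ n = 1# - α * a * p * p ^ n * p ^ n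

      -- What is left of the Wilf-Zeilberger equation after `common` has been divided out. With s =
      -- pʳ and w = pˡ as independent variables it is a polynomial identity.
      core : ∀ α a p s w →
        (1# - p * (s * w)) * ((1# - α * s * s) * (1# - a * w) * (1# - α * a * (s * s * w)))
        + a * (s * w) * (1# - α * a * (s * w)) * ((1# - α * s * s) * (1# - p * w) * (1# - α * (p * (s * s * w))))
        ≈ (1# - α * a * p * (s * w) * (s * w)) *
          (s * (1# - α * s) * (1# - α * a * (s * s * w)) * (1# - p * w)
           - (- (1# - s) * (1# - a * w) * (1# - α * (p * (s * s * w)))))
      core = solve 5 (λ α a p s w →
        (:1 :- p :* (s :* w)) :* ((:1 :- α :* s :* s) :* (:1 :- a :* w) :* (:1 :- α :* a :* (s :* s :* w)))
        :+ a :* (s :* w) :* (:1 :- α :* a :* (s :* w)) :* ((:1 :- α :* s :* s) :* (:1 :- p :* w) :* (:1 :- α :* (p :* (s :* s :* w))))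
        := (:1 :- α :* a :* p :* (s :* w) :* (s :* w)) :*
          (s :* (:1 :- α :* s) :* (:1 :- α :* a :* (s :* s :* w)) :* (:1 :- p :* w)
           :- (:- (:1 :- s) :* (:1 :- a :* w) :* (:1 :- α :* (p :* (s :* s :* w)))))) refl

      module _ (r l : ℕ) where
        s w common : Carrier
        s = p ^ r
        w = p ^ l
        common = sign r * p^tri r * pochhammer α r * pochhammer a l * pochhammer (α * a) (ix r l)
               * (prod r ip * prod (suc l) ip * prod (suc (suc (ix r l))) iα)

        αa-factor : factor (α * a) (ix r l) ≈ 1# - α * a * (s * s * w)
        αa-factor = factor-ix (α * a) r l

        α-factor : factor α (suc (ix r l)) ≈ 1# - α * (p * (s * s * w))
        α-factor = +-congˡ (-‿cong (*-congˡ (*-congˡ (p^ix r l))))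

        term-sucʳ : term r (suc l) ≈ common * ((1# - α * s * s) * (1# - a * w) * (1# - α * a * (s * s * w)))
        term-sucʳ rewrite ix-suc r l = begin
          sign r * (1# - α * s * s) * p^tri r * pochhammer α r * (pochhammer a l * (1# - a * w))
            * (pochhammer (α * a) (ix r l) * factor (α * a) (ix r l))
            * (prod r ip * prod (suc l) ip * prod (suc (suc (ix r l))) iα)
            ≈⟨ solve 9 (λ σ x t A B y C D z → σ :* x :* t :* A :* (B :* y) :* (C :* z) :* D :=
                 σ :* t :* A :* B :* C :* D :* (x :* y :* z)) refl _ _ _ _ _ _ _ _ _ ⟩
          common * ((1# - α * s * s) * (1# - a * w) * factor (α * a) (ix r l))
            ≈⟨ *-congˡ (*-congˡ αa-factor) ⟩
          _ ∎

        -- A term is brought to the denominators of `common` by inserting 1 as a missing factor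
        -- times its inverse.
        common-insert : ∀ x → x ≈ x * ((1# - p * w) * ip l)
        common-insert x = sym (trans (*-congˡ (ip-inv l)) (*-identityʳ x))

        α-insert : ∀ x → x ≈ x * ((1# - α * (p * (s * s * w))) * iα (suc (ix r l)))
        α-insert x = sym (trans (*-congˡ (trans (*-congʳ (sym α-factor)) (iα-inv _))) (*-identityʳ x))

        term-split : term r l ≈ common * ((1# - α * s * s) * (1# - p * w) * (1# - α * (p * (s * s * w))))
        term-split = begin
          term r l ≈⟨ trans (common-insert _) (α-insert _) ⟩
          term r l * ((1# - p * w) * ip l) * ((1# - α * (p * (s * s * w))) * iα (suc (ix r l)))
            ≈⟨ solve 13 (λ σ x t A B C I J K u v y z →
                 σ :* x :* t :* A :* B :* C :* (I :* J :* K) :* (y :* u) :* (z :* v) :=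
                 σ :* t :* A :* B :* C :* (I :* (J :* u) :* (K :* v)) :* (x :* y :* z))
                 refl _ _ _ _ _ _ _ _ _ _ _ _ _ ⟩
          _ ∎

        cert-sucˡ : cert (suc r) l ≈ common * (s * (1# - α * s) * (1# - α * a * (s * s * w)) * (1# - p * w))
        cert-sucˡ = begin
          cert (suc r) l ≈⟨ common-insert _ ⟩
          cert (suc r) l * ((1# - p * w) * ip l)
            ≈⟨ solve 15 (λ σ x t A B C I J K u v y z f s →
                 :- x :* (:- :1 :* σ) :* (t :* s) :* (A :* f) :* B :* (C :* z) :* (I :* v :* J :* K) :* (y :* u) :=
                 (x :* v) :* (σ :* t :* A :* B :* C :* (I :* (J :* u) :* K) :* (s :* f :* z :* y)))
                 refl _ _ _ _ _ _ _ _ _ _ _ _ _ _ _ ⟩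
          ((1# - p * s) * ip r) * (common * (s * (1# - α * s) * factor (α * a) (ix r l) * (1# - p * w)))
            ≈⟨ trans (*-congʳ (ip-inv r)) (*-identityˡ _) ⟩
          common * (s * (1# - α * s) * factor (α * a) (ix r l) * (1# - p * w))
            ≈⟨ *-congˡ (*-congʳ (*-congˡ αa-factor)) ⟩
          _ ∎

        cert-sucʳ : cert r (suc l) ≈ common * (- (1# - s) * (1# - a * w) * (1# - α * (p * (s * s * w))))
        cert-sucʳ rewrite ix-suc r l = begin
          - (1# - s) * sign r * p^tri r * pochhammer α r * (pochhammer a l * (1# - a * w))
            * pochhammer (α * a) (ix r l) * (prod r ip * prod (suc l) ip * prod (suc (ix r l)) iα)
            ≈⟨ α-insert _ ⟩
          _ ≈⟨ solve 12 (λ σ x t A B C I J K v y z →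
                 x :* σ :* t :* A :* (B :* y) :* C :* (I :* J :* K) :* (z :* v) :=
                 σ :* t :* A :* B :* C :* (I :* J :* (K :* v)) :* (x :* y :* z))
                 refl _ _ _ _ _ _ _ _ _ _ _ _ ⟩
          _ ∎

      coeff : ℕ → Carrier
      coeff n = a * p ^ n * (1# - α * a * p ^ n)

      -- The Wilf-Zeilberger equation: the left side is the recurrence in n that annihilates `value`
      -- (see `value-suc`), applied to one summand; the right side telescopes along the
      -- antidiagonal.
      step : ∀ n r l → r ℕ.+ l ≡ n →
        (1# - p * p ^ n) * term r (suc l) + coeff n * term r l ≈ κ n * cert (suc r) l - κ n * cert r (suc l)
      step n r l ≡.refl = begin
        (1# - p * y) * term r (suc l) + a * y * (1# - α * a * y) * term r l
          ≈⟨ +-cong (*-cong (+-congˡ (-‿cong (*-congˡ y≈sw))) (term-sucʳ r l))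
                    (*-cong (*-cong (*-congˡ y≈sw) (+-congˡ (-‿cong (*-congˡ y≈sw)))) (term-split r l)) ⟩
        (1# - p * (S * W)) * (C * X) + a * (S * W) * (1# - α * a * (S * W)) * (C * Y)
          ≈⟨ solve 5 (λ u C X v Y → u :* (C :* X) :+ v :* (C :* Y) := C :* (u :* X :+ v :* Y)) refl _ _ _ _ _ ⟩
        C * ((1# - p * (S * W)) * X + a * (S * W) * (1# - α * a * (S * W)) * Y)
          ≈⟨ *-congˡ (core α a p S W) ⟩
        C * ((1# - α * a * p * (S * W) * (S * W)) * (X′ - Y′))
          ≈⟨ solve 4 (λ C k X Y → C :* (k :* (X :- Y)) := k :* (C :* X) :- k :* (C :* Y)) refl _ _ _ _ ⟩
        (1# - α * a * p * (S * W) * (S * W)) * (C * X′) - (1# - α * a * p * (S * W) * (S * W)) * (C * Y′)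
          ≈⟨ +-cong (*-cong κ≈ (sym (cert-sucˡ r l))) (-‿cong (*-cong κ≈ (sym (cert-sucʳ r l)))) ⟩
        κ (r ℕ.+ l) * cert (suc r) l - κ (r ℕ.+ l) * cert r (suc l) ∎
        where
        y S W C X Y X′ Y′ : Carrier
        y = p ^ (r ℕ.+ l)
        S = p ^ r
        W = p ^ l
        C = common r l
        X = (1# - α * S * S) * (1# - a * W) * (1# - α * a * (S * S * W))
        Y = (1# - α * S * S) * (1# - p * W) * (1# - α * (p * (S * S * W)))
        X′ = S * (1# - α * S) * (1# - α * a * (S * S * W)) * (1# - p * W)
        Y′ = - (1# - S) * (1# - a * W) * (1# - α * (p * (S * S * W)))
        y≈sw : y ≈ S * W
        y≈sw = ^-homo-* p r l
        κ≈ : 1# - α * a * p * (S * W) * (S * W) ≈ κ (r ℕ.+ l)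
        κ≈ = +-congˡ (-‿cong (*-cong (*-congˡ (sym y≈sw)) (sym y≈sw)))

      -- The summand r = n + 1 has no counterpart at level n and is not covered by `step`; it
      -- cancels exactly the upper end of the telescope.
      last-term : ∀ n → (1# - p * p ^ n) * term (suc n) 0 ≈ - (κ n * cert (suc n) 0)
      last-term n = begin
        u * term (suc n) 0
          ≈⟨ solve 11 (λ u σ x t A o Q f I K v →
               u :* (σ :* x :* t :* A :* o :* (Q :* f) :* (I :* o :* (K :* v))) :=
               (x :* v) :* (:- (f :* (:- u :* σ :* t :* A :* o :* Q :* (I :* o :* K)))))
               refl _ _ _ _ _ _ _ _ _ _ _ ⟩
        ((1# - α * (p * y) * (p * y)) * iα (suc (suc (ix n 0))))
          * (- (factor (α * a) (suc (ix n 0)) * cert (suc n) 0))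
          ≈⟨ *-congʳ (trans (*-congʳ α-end) (iα-inv _)) ⟩
        1# * (- (factor (α * a) (suc (ix n 0)) * cert (suc n) 0))
          ≈⟨ trans (*-identityˡ _) (-‿cong (*-congʳ κ-end)) ⟩
        - (κ n * cert (suc n) 0) ∎
        where
        y u : Carrier
        y = p ^ n
        u = 1# - p * y
        α-end : 1# - α * (p * y) * (p * y) ≈ factor α (suc (suc (ix n 0)))
        α-end = begin
          1# - α * (p * y) * (p * y)
            ≈⟨ solve 3 (λ α p y → :1 :- α :* (p :* y) :* (p :* y) :=
                 :1 :- α :* (p :* (p :* (y :* y :* :1)))) refl α p y ⟩
          1# - α * (p * (p * (y * y * 1#))) ≈⟨ +-congˡ (-‿cong (*-congˡ (*-congˡ (*-congˡ (p^ix n 0))))) ⟨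
          factor α (suc (suc (ix n 0))) ∎
        κ-end : factor (α * a) (suc (ix n 0)) ≈ κ n
        κ-end = begin
          factor (α * a) (suc (ix n 0)) ≈⟨ +-congˡ (-‿cong (*-congˡ (*-congˡ (p^ix n 0)))) ⟩
          1# - α * a * (p * (y * y * 1#))
            ≈⟨ solve 4 (λ α a p y → :1 :- α :* a :* (p :* (y :* y :* :1)) :=
                 :1 :- α :* a :* p :* y :* y) refl α a p y ⟩
          κ n ∎

      -- The factor 1 - pʳ removes the lower end of the telescope. Certificates are evaluated only
      -- where r + l > 0, so the `pred` in them is true subtraction.
      cert-0 : ∀ l → cert 0 l ≈ 0#
      cert-0 l = solve 6 (λ a b c d e f → :- (:1 :- :1) :* a :* b :* c :* d :* e :* f := :0)
        refl _ _ _ _ _ _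

      value-suc : ∀ n → (1# - p * p ^ n) * value (suc n) ≈ - (coeff n * value n)
      value-suc n = begin
        (1# - p * p ^ n) * value (suc n)
          ≈⟨ solve 9 (λ u a A t y C f I v →
               u :* (:- a :* A :* (t :* y) :* (C :* f) :* (I :* v)) :=
               (u :* v) :* (:- (a :* y :* f :* (A :* t :* C :* I)))) refl _ _ _ _ _ _ _ _ _ ⟩
        ((1# - p * p ^ n) * ip n) * (- (coeff n * value n))  ≈⟨ *-congʳ (ip-inv n) ⟩
        1# * (- (coeff n * value n))                         ≈⟨ *-identityˡ _ ⟩
        - (coeff n * value n)                                ∎

    -- Induction on n: sum and value satisfy the same first-order recurrence, whose leading
    -- coefficient 1 - pⁿ⁺¹ is a unit.
    conv-term : ∀ n → conv n term ≈ value n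
    conv-term zero = begin
      term 0 0
        ≈⟨ solve 2 (λ α v → :1 :* (:1 :- α :* :1 :* :1) :* :1 :* :1 :* :1 :* :1 :* (:1 :* :1 :* (:1 :* v)) :=
             (:1 :- α :* :1) :* v) refl α (iα 0) ⟩
      (1# - α * 1#) * iα 0   ≈⟨ iα-inv 0 ⟩
      1#                     ≈⟨ solve 0 (:1 := :1 :* :1 :* :1 :* :1) refl ⟩
      value 0                ∎
    conv-term (suc n) = begin
      conv (suc n) term    ≈⟨ solve 2 (λ x y → x := (x :- y) :+ y) refl _ (value (suc n)) ⟩
      (conv (suc n) term - value (suc n)) + value (suc n)
        ≈⟨ +-congʳ (unit-cancel (ip-inv n) difference) ⟩
      0# + value (suc n)   ≈⟨ +-identityˡ _ ⟩
      value (suc n)        ∎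
      where
      u v : Carrier
      u = 1# - p * p ^ n
      v = coeff n
      telescoped : u * conv n (λ r l → term r (suc l)) + v * conv n term ≈ κ n * cert (suc n) 0 - κ n * cert 0 (suc n)
      telescoped = begin
        u * conv n (λ r l → term r (suc l)) + v * conv n term
          ≈⟨ +-cong (conv-*ˡ n u _) (conv-*ˡ n v _) ⟩
        conv n (λ r l → u * term r (suc l)) + conv n (λ r l → v * term r l)
          ≈⟨ conv-+ n _ _ ⟨
        conv n (λ r l → u * term r (suc l) + v * term r l)
          ≈⟨ conv-telescope n (λ r l → κ n * cert r l) (step n) ⟩
        κ n * cert (suc n) 0 - κ n * cert 0 (suc n) ∎
      difference : u * (conv (suc n) term - value (suc n)) ≈ 0#
      difference = begin
        u * (conv (suc n) term - value (suc n))
          ≈⟨ *-congˡ (+-congʳ (conv-snoc n term)) ⟩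
        u * ((conv n (λ r l → term r (suc l)) + term (suc n) 0) - value (suc n))
          ≈⟨ solve 6 (λ u v S T V W → u :* ((S :+ T) :- V) :=
               (u :* S :+ v :* W) :+ u :* T :- u :* V :- v :* W) refl u v _ _ _ (conv n term) ⟩
        (u * conv n (λ r l → term r (suc l)) + v * conv n term) + u * term (suc n) 0 - u * value (suc n)
          - v * conv n term
          ≈⟨ +-cong (+-cong (+-cong telescoped (last-term n)) (-‿cong (value-suc n)))
                    (-‿cong (*-congˡ (conv-term n))) ⟩
        (κ n * cert (suc n) 0 - κ n * cert 0 (suc n)) + - (κ n * cert (suc n) 0) - (- (v * value n)) - v * value n
          ≈⟨ solve 4 (λ k a b d → (k :* a :- k :* b) :+ :- (k :* a) :- (:- d) :- d := :- (k :* b))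
               refl _ _ _ _ ⟩
        - (κ n * cert 0 (suc n))   ≈⟨ -‿cong (trans (*-congˡ (cert-0 (suc n))) (zeroʳ _)) ⟩
        - 0#                       ≈⟨ solve 0 (:- :0 := :0) refl ⟩
        0#                         ∎

-- The limiting case of Watson's transformation.

module Transformation {c ℓ} (R : CommutativeRing c ℓ) (p b : CommutativeRing.Carrier R)
  (ip ia ib : ℕ → CommutativeRing.Carrier R)
  (ip-inv : Pochhammer.FactorsInvertedBy R p p ip)
  (ia-inv : Pochhammer.FactorsInvertedBy R p (CommutativeRing._*_ R b b) ia)
  (ib-inv : Pochhammer.FactorsInvertedBy R p b ib)
  where
  open CommutativeRing R
  open Pochhammer R p
  open import Relation.Binary.Reasoning.Setoid setoid
  open IntegerCoefficients R
  open Solver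
  open Sums R

  a : Carrier
  a = b * b

  private
    -- The summand of a vanishing q-Chu–Vandermonde sum and its Wilf–Zeilberger certificate.
    vterm vcert : ℕ → ℕ → Carrier
    vterm j r = sign j * p^tri r * pochhammer a (pred (ix j r)) * (prod j ia * prod r ip * prod j ip)
    vcert j r = - (sign j * p^tri (suc r) * pochhammer a (pred (ix j r)) * (1# - p ^ j)
                   * (prod (pred j) ia * prod r ip * prod j ip))

    -- For j > 0 the additional inverse on the right cancels 1 - apʲ⁻¹, and p times that factor is p
    -- - apʲ. At j = 0 the factor 1 - p⁰ makes both sides vanish, so the truncation of `pred` is
    -- harmless.
    pull-ia : ∀ j → p * ((1# - p ^ j) * prod (pred j) ia) ≈ (p - a * p ^ j) * ((1# - p ^ j) * prod j ia)
    pull-ia zero    = solve 2 (λ p a → p :* ((:1 :- :1) :* :1) :=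
      (p :- a :* :1) :* ((:1 :- :1) :* :1)) refl p a
    pull-ia (suc j) = begin
      p * ((1# - p * p ^ j) * prod j ia)
        ≈⟨ *-identityˡ _ ⟨
      1# * (p * ((1# - p * p ^ j) * prod j ia))
        ≈⟨ *-congʳ (ia-inv j) ⟨
      (factor a j * ia j) * (p * ((1# - p * p ^ j) * prod j ia))
        ≈⟨ solve 5 (λ a s i p A → ((:1 :- a :* s) :* i) :* (p :* ((:1 :- p :* s) :* A)) :=
             (p :- a :* (p :* s)) :* ((:1 :- p :* s) :* (A :* i))) refl a (p ^ j) (ia j) p (prod j ia) ⟩
      (p - a * (p * p ^ j)) * ((1# - p * p ^ j) * (prod j ia * ia j)) ∎

    module _ (j r : ℕ) where
      s w common : Carrier
      s = p ^ j
      w = p ^ r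
      common = sign j * p^tri r * pochhammer a (ix j r) * (prod j ia * prod (suc r) ip * prod j ip)

      ip-insert : ∀ x → x ≈ x * ((1# - p * w) * ip r)
      ip-insert x = sym (trans (*-congˡ (ip-inv r)) (*-identityʳ x))

      vterm-suc : vterm j (suc r) ≈ common * w
      vterm-suc rewrite ix-suc j r =
        solve 5 (λ σ t w A I → σ :* (t :* w) :* A :* I := σ :* t :* A :* I :* w) refl _ _ _ _ _

      vcert-sucˡ : vcert (suc j) r ≈ common * (w * (1# - a * (s * s * w)) * (1# - p * w))
      vcert-sucˡ = begin
        vcert (suc j) r ≈⟨ ip-insert _ ⟩
        vcert (suc j) r * ((1# - p * w) * ip r)
          ≈⟨ solve 12 (λ σ t w A f x I J K v u y →
               (:- (:- :1 :* σ :* (t :* w) :* (A :* f) :* x :* (I :* J :* (K :* v)))) :* (u :* y) :=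
               (x :* v) :* ((σ :* t :* A :* (I :* (J :* y) :* K)) :* (w :* f :* u)))
               refl _ _ _ _ _ _ _ _ _ _ _ _ ⟩
        ((1# - p * s) * ip j) * (common * (w * factor a (ix j r) * (1# - p * w)))
          ≈⟨ trans (*-congʳ (ip-inv j)) (*-identityˡ _) ⟩
        common * (w * factor a (ix j r) * (1# - p * w))
          ≈⟨ *-congˡ (*-congʳ (*-congˡ (factor-ix a j r))) ⟩
        _ ∎

      vcert-sucʳ : vcert j (suc r) ≈ common * (- (w * w * (p - a * s) * (1# - s)))
      vcert-sucʳ rewrite ix-suc j r = begin
        - (sign j * (p^tri r * w * (p * w)) * pochhammer a (ix j r) * (1# - s)
           * (prod (pred j) ia * prod (suc r) ip * prod j ip))
          ≈⟨ solve 9 (λ σ t w p A x I J K →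
               :- (σ :* (t :* w :* (p :* w)) :* A :* x :* (I :* J :* K)) :=
               (σ :* t :* A :* J :* K) :* (:- (w :* w :* (p :* (x :* I))))) refl _ _ _ _ _ _ _ _ _ ⟩
        (sign j * p^tri r * pochhammer a (ix j r) * prod (suc r) ip * prod j ip)
          * (- (w * w * (p * ((1# - s) * prod (pred j) ia))))
          ≈⟨ *-congˡ (-‿cong (*-congˡ (pull-ia j))) ⟩
        (sign j * p^tri r * pochhammer a (ix j r) * prod (suc r) ip * prod j ip)
          * (- (w * w * ((p - a * s) * ((1# - s) * prod j ia))))
          ≈⟨ solve 9 (λ σ t w y A x I J K →
               (σ :* t :* A :* J :* K) :* (:- (w :* w :* (y :* (x :* I)))) :=
               (σ :* t :* A :* (I :* J :* K)) :* (:- (w :* w :* y :* x))) refl _ _ _ _ _ _ _ _ _ ⟩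
        _ ∎

    -- No recurrence in k is involved: on the fixed level k + 1 the summand is already a difference,
    -- up to the unit (1 - pᵏ⁺¹)(1 - apᵏ).
    vstep : ∀ k j r → j ℕ.+ r ≡ k →
      (1# - p * p ^ k) * (1# - a * p ^ k) * vterm j (suc r) ≈ vcert (suc j) r - vcert j (suc r)
    vstep k j r ≡.refl = begin
      (1# - p * p ^ (j ℕ.+ r)) * (1# - a * p ^ (j ℕ.+ r)) * vterm j (suc r)
        ≈⟨ *-cong (*-cong (+-congˡ (-‿cong (*-congˡ y≈sw))) (+-congˡ (-‿cong (*-congˡ y≈sw)))) (vterm-suc j r) ⟩
      (1# - p * (S * W)) * (1# - a * (S * W)) * (C * W)
        ≈⟨ solve 5 (λ p S W a C → (:1 :- p :* (S :* W)) :* (:1 :- a :* (S :* W)) :* (C :* W) :=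
             C :* (W :* (:1 :- a :* (S :* S :* W)) :* (:1 :- p :* W))
             :- C :* (:- (W :* W :* (p :- a :* S) :* (:1 :- S)))) refl p S W a C ⟩
      C * (W * (1# - a * (S * S * W)) * (1# - p * W)) - C * (- (W * W * (p - a * S) * (1# - S)))
        ≈⟨ +-cong (vcert-sucˡ j r) (-‿cong (vcert-sucʳ j r)) ⟨
      vcert (suc j) r - vcert j (suc r) ∎
      where
      S W C : Carrier
      S = p ^ j
      W = p ^ r
      C = common j r
      y≈sw : p ^ (j ℕ.+ r) ≈ S * W
      y≈sw = ^-homo-* p j r

  -- Up to a factor this is ₂φ₁(p⁻ᵏ⁻¹, apᵏ; a; p, p), whose value contains (p⁻ᵏ;p)_(k+1) and hence
  -- the factor 1 - p⁰.
  vandermonde : ∀ k → conv (suc k) vterm ≈ 0#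
  vandermonde k = unit-cancel {u} {ip k * ia k} u-inv (begin
    u * conv (suc k) vterm
      ≈⟨ trans (*-congˡ (conv-snoc k vterm)) (distribˡ u _ _) ⟩
    u * conv k (λ j r → vterm j (suc r)) + u * vterm (suc k) 0
      ≈⟨ +-cong (trans (conv-*ˡ k u _) (conv-telescope k vcert (vstep k))) last-vterm ⟩
    (vcert (suc k) 0 - vcert 0 (suc k)) + - vcert (suc k) 0
      ≈⟨ solve 2 (λ x y → (x :- y) :+ :- x := :- y) refl _ _ ⟩
    - vcert 0 (suc k)
      ≈⟨ solve 4 (λ t A J K → :- (:- (:1 :* t :* A :* (:1 :- :1) :* (:1 :* J :* K))) := :0)
           refl _ _ _ _ ⟩
    0# ∎)
    where
    u : Carrier
    u = (1# - p * p ^ k) * (1# - a * p ^ k)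
    u-inv : u * (ip k * ia k) ≈ 1#
    u-inv = begin
      u * (ip k * ia k)
        ≈⟨ solve 4 (λ x y z w → (x :* y) :* (z :* w) := (x :* z) :* (y :* w)) refl _ _ _ _ ⟩
      (factor p k * ip k) * (factor a k * ia k)  ≈⟨ *-cong (ip-inv k) (ia-inv k) ⟩
      1# * 1#                                    ≈⟨ *-identityˡ 1# ⟩
      1#                                         ∎
    last-vterm : u * vterm (suc k) 0 ≈ - vcert (suc k) 0
    last-vterm = begin
      u * vterm (suc k) 0
        ≈⟨ solve 7 (λ x y σ A I i J → (x :* y) :* (σ :* :1 :* A :* ((I :* i) :* :1 :* J)) :=
             (y :* i) :* (:- :- (σ :* (:1 :* :1) :* A :* x :* (I :* :1 :* J)))) refl _ _ _ _ _ _ _ ⟩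
      (factor a k * ia k) * (- vcert (suc k) 0)   ≈⟨ *-congʳ (ia-inv k) ⟩
      1# * (- vcert (suc k) 0)                    ≈⟨ *-identityˡ _ ⟩
      - vcert (suc k) 0                           ∎

  pfterm : ℕ → ℕ → Carrier
  pfterm j r = sign j * p^tri r * pochhammer a (ix j r) * (prod j ia * prod r ip * prod j ip) * ib j

  private
    module _ (j r : ℕ) where
      ib-insert : ∀ x → x ≈ x * ((1# - b * p ^ j) * ib j)
      ib-insert x = sym (trans (*-congˡ (ib-inv j)) (*-identityʳ x))

      pfterm-suc : pfterm j (suc r) ≈ common j r * ib j * (p ^ r * (1# - a * (p ^ j * p ^ j * p ^ r)))
      pfterm-suc rewrite ix-suc j r = begin
        sign j * (p^tri r * p ^ r) * (pochhammer a (ix j r) * factor a (ix j r))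
          * (prod j ia * prod (suc r) ip * prod j ip) * ib j
          ≈⟨ solve 7 (λ σ t w A f I i → σ :* (t :* w) :* (A :* f) :* I :* i := σ :* t :* A :* I :* i :* (w :* f))
               refl _ _ _ _ _ _ _ ⟩
        common j r * ib j * (p ^ r * factor a (ix j r)) ≈⟨ *-congˡ (*-congˡ (factor-ix a j r)) ⟩
        _ ∎

      pfterm-split : pfterm j r ≈ common j r * ib j * (1# - p * p ^ r)
      pfterm-split = begin
        pfterm j r ≈⟨ ip-insert j r _ ⟩
        pfterm j r * ((1# - p * p ^ r) * ip r)
          ≈⟨ solve 9 (λ σ t A I J K i x y → σ :* t :* A :* (I :* J :* K) :* i :* (x :* y) :=
               σ :* t :* A :* (I :* (J :* y) :* K) :* i :* x) refl _ _ _ _ _ _ _ _ _ ⟩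
        _ ∎

      vterm-split : vterm j (suc r) ≈ common j r * ib j * (p ^ r * (1# - b * p ^ j))
      vterm-split = begin
        vterm j (suc r)  ≈⟨ trans (vterm-suc j r) (ib-insert _) ⟩
        (common j r * p ^ r) * ((1# - b * p ^ j) * ib j)
          ≈⟨ solve 4 (λ C w x i → C :* w :* (x :* i) := C :* i :* (w :* x)) refl _ _ _ _ ⟩
        _ ∎

    -- A recurrence in k with an inhomogeneous part. Since 1 - bpʲ removes `ib j`, that part is a
    -- multiple of `vterm`, and its sum vanishes by `vandermonde`.
    pfstep : ∀ k j r → j ℕ.+ r ≡ k →
      (1# - b * (p * p ^ k)) * pfterm j (suc r) ≈
      p ^ k * b * (1# - b * p ^ k) * pfterm j r + (1# - a * p * p ^ k * p ^ k) * vterm j (suc r)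
    pfstep k j r ≡.refl = begin
      (1# - b * (p * y)) * pfterm j (suc r)
        ≈⟨ *-cong (+-congˡ (-‿cong (*-congˡ (*-congˡ y≈sw)))) (pfterm-suc j r) ⟩
      (1# - b * (p * (S * W))) * (C * (W * (1# - a * (S * S * W))))
        ≈⟨ solve 5 (λ b p S W C → let a = b :* b in
             (:1 :- b :* (p :* (S :* W))) :* (C :* (W :* (:1 :- a :* (S :* S :* W)))) :=
             S :* W :* b :* (:1 :- b :* (S :* W)) :* (C :* (:1 :- p :* W)) :+
             (:1 :- a :* p :* (S :* W) :* (S :* W)) :* (C :* (W :* (:1 :- b :* S)))) refl b p S W C ⟩
      S * W * b * (1# - b * (S * W)) * (C * (1# - p * W))
        + (1# - a * p * (S * W) * (S * W)) * (C * (W * (1# - b * S)))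
        ≈⟨ +-cong
             (*-cong (*-cong (*-congʳ y≈sw) (+-congˡ (-‿cong (*-congˡ y≈sw)))) (pfterm-split j r))
             (*-cong (+-congˡ (-‿cong (*-cong (*-congˡ y≈sw) y≈sw))) (vterm-split j r)) ⟨
      y * b * (1# - b * y) * pfterm j r + (1# - a * p * y * y) * vterm j (suc r) ∎
      where
      y S W C : Carrier
      y = p ^ (j ℕ.+ r)
      S = p ^ j
      W = p ^ r
      C = common j r * ib j
      y≈sw : y ≈ S * W
      y≈sw = ^-homo-* p j r

    -- The summand r = 0 of level k + 1 has no partner on level k, so its recurrence consists of the
    -- inhomogeneous part alone.
    last-pfterm : ∀ k →
      (1# - b * (p * p ^ k)) * pfterm (suc k) 0 ≈ (1# - a * p * p ^ k * p ^ k) * vterm (suc k) 0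
    last-pfterm k = begin
      (1# - b * (p * p ^ k)) * pfterm (suc k) 0
        ≈⟨ solve 6 (λ u σ A f I i → u :* (σ :* :1 :* (A :* f) :* I :* i) :=
             (u :* i) :* (f :* (σ :* :1 :* A :* I))) refl _ _ _ _ _ _ ⟩
      (factor b (suc k) * ib (suc k)) * (factor a (suc (ix k 0)) * vterm (suc k) 0)
        ≈⟨ trans (*-congʳ (ib-inv (suc k))) (*-identityˡ _) ⟩
      factor a (suc (ix k 0)) * vterm (suc k) 0
        ≈⟨ *-congʳ (begin
             factor a (suc (ix k 0))            ≈⟨ +-congˡ (-‿cong (*-congˡ (*-congˡ (p^ix k 0)))) ⟩
             1# - a * (p * (p ^ k * p ^ k * 1#))
               ≈⟨ solve 3 (λ a p y → :1 :- a :* (p :* (y :* y :* :1)) := :1 :- a :* p :* y :* y)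
                    refl _ _ _ ⟩
             1# - a * p * p ^ k * p ^ k         ∎) ⟩
      (1# - a * p * p ^ k * p ^ k) * vterm (suc k) 0 ∎

  -- Up to normalisation the sum is the balanced ₃φ₂ with upper parameters p⁻ᵏ, apᵏ, b and lower
  -- parameters a, bp, which the q-Pfaff-Saalschütz formula evaluates. As a = b², the quotient
  -- (b;p)_k / (bp;p)_k appears and collapses to (1 - b)/(1 - bpᵏ).
  partial-fractions : ∀ k → conv k pfterm ≈ p^tri k * b ^ k * ib k
  partial-fractions zero = solve 1 (λ i → :1 :* :1 :* :1 :* (:1 :* :1 :* :1) :* i := :1 :* :1 :* i) refl (ib 0)
  partial-fractions (suc k) = begin
    conv (suc k) pfterm
      ≈⟨ solve 2 (λ x y → x := (x :- y) :+ y) refl _ V′ ⟩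
    (conv (suc k) pfterm - V′) + V′
      ≈⟨ +-congʳ (unit-cancel (ib-inv (suc k)) difference) ⟩
    0# + V′  ≈⟨ +-identityˡ V′ ⟩
    V′       ∎
    where
    V V′ u v t : Carrier
    V  = p^tri k * b ^ k * ib k
    V′ = p^tri (suc k) * b ^ suc k * ib (suc k)
    u  = 1# - b * (p * p ^ k)
    v  = p ^ k * b * (1# - b * p ^ k)
    t  = 1# - a * p * p ^ k * p ^ k
    recurrence : u * conv (suc k) pfterm ≈ v * conv k pfterm + t * conv (suc k) vterm
    recurrence = begin
      u * conv (suc k) pfterm
        ≈⟨ trans (*-congˡ (conv-snoc k pfterm)) (distribˡ u _ _) ⟩
      u * conv k (λ j r → pfterm j (suc r)) + u * pfterm (suc k) 0
        ≈⟨ +-cong (trans (conv-*ˡ k u _) (conv-cong k (pfstep k))) (last-pfterm k) ⟩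
      conv k (λ j r → v * pfterm j r + t * vterm j (suc r)) + t * vterm (suc k) 0
        ≈⟨ +-congʳ (trans (conv-+ k _ _) (+-cong (sym (conv-*ˡ k v _)) (sym (conv-*ˡ k t _)))) ⟩
      (v * conv k pfterm + t * conv k (λ j r → vterm j (suc r))) + t * vterm (suc k) 0
        ≈⟨ solve 4 (λ x t S T → (x :+ t :* S) :+ t :* T := x :+ t :* (S :+ T)) refl _ _ _ _ ⟩
      v * conv k pfterm + t * (conv k (λ j r → vterm j (suc r)) + vterm (suc k) 0)
        ≈⟨ +-congˡ (*-congˡ (conv-snoc k vterm)) ⟨
      v * conv k pfterm + t * conv (suc k) vterm ∎
    uV′≈vV : u * V′ ≈ v * V
    uV′≈vV = begin
      u * V′
        ≈⟨ solve 6 (λ u T y b B i → u :* (T :* y :* (b :* B) :* i) := (u :* i) :* (y :* b :* (T :* B)))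
             refl _ _ _ _ _ _ ⟩
      (u * ib (suc k)) * (p ^ k * b * (p^tri k * b ^ k))  ≈⟨ *-congʳ (ib-inv (suc k)) ⟩
      1# * (p ^ k * b * (p^tri k * b ^ k))                ≈⟨ *-congʳ (ib-inv k) ⟨
      (factor b k * ib k) * (p ^ k * b * (p^tri k * b ^ k))
        ≈⟨ solve 5 (λ f i y T B → (f :* i) :* (y :* T :* B) := y :* T :* f :* (B :* i)) refl _ _ _ _ _ ⟩
      p ^ k * b * factor b k * ((p^tri k * b ^ k) * ib k) ∎
    difference : u * (conv (suc k) pfterm - V′) ≈ 0#
    difference = begin
      u * (conv (suc k) pfterm - V′)
        ≈⟨ solve 3 (λ u x y → u :* (x :- y) := u :* x :- u :* y) refl _ _ _ ⟩
      u * conv (suc k) pfterm - u * V′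
        ≈⟨ +-cong recurrence (-‿cong uV′≈vV) ⟩
      (v * conv k pfterm + t * conv (suc k) vterm) - v * V
        ≈⟨ +-congʳ (+-cong (*-congˡ (partial-fractions k)) (trans (*-congˡ (vandermonde k)) (zeroʳ t))) ⟩
      (v * V + 0#) - v * V
        ≈⟨ solve 1 (λ x → (x :+ :0) :- x := :0) refl _ ⟩
      0# ∎

  -- The summand c_q(k) of the very-well-poised series, perturbed so that it terminates at k + l = m;
  -- the factor 1 + b pᵏ is kept apart because it need not be a unit modulo Φ.
  well-poised : ℕ → ℕ → Carrier
  well-poised k l = sign k * p^tri k * b ^ k * pochhammer a l * pochhammer (a * a) (ix k l)
                  * (prod l ip * prod (suc (ix k l)) ia)

  transformed : ℕ → ℕ → Carrier
  transformed j n = (- a) ^ n * p^tri n * pochhammer (a * a) (ix j n) * (prod n ip * prod j ip * prod j ia) * ib j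

  private
    -- After the interchange, the sum over r = k - j for fixed j is a ₆φ₅ with αⱼ = ap²ʲ. The
    -- inverses it needs form a tail of the sequence `ia`.
    α : ℕ → Carrier
    α j = a * p ^ ix j 0

    iα : ℕ → ℕ → Carrier
    iα j i = ia (ix j 0 ℕ.+ i)

    iα-inv : ∀ j i → factor (α j) i * iα j i ≈ 1#
    iα-inv j i = trans (*-congʳ (sym (factor-shift a (ix j 0) i))) (ia-inv (ix j 0 ℕ.+ i))

    module Inner (j : ℕ) = SixPhiFive (α j) a ip (iα j) ip-inv (iα-inv j)

    weight : ℕ → Carrier
    weight j = pochhammer (a * a) (ix j 0) * (prod j ip * prod j ia) * ib j

    outer : ℕ → ℕ → Carrier
    outer k l = sign k * (1# - a * p ^ k * p ^ k) * pochhammer a l * pochhammer (a * a) (ix k l)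
              * (prod l ip * prod (suc (ix k l)) ia)

    -- From a = b² one has 1 + bpᵏ = (1 - ap²ᵏ)/(1 - bpᵏ). The numerator is the very-well-poised
    -- factor of the ₆φ₅, the denominator is what `partial-fractions` expands.
    well-poised-outer : ∀ k l → (1# + b * p ^ k) * well-poised k l ≈ outer k l * (p^tri k * b ^ k * ib k)
    well-poised-outer k l = begin
      (1# + b * p ^ k) * well-poised k l
        ≈⟨ *-identityˡ _ ⟨
      1# * ((1# + b * p ^ k) * well-poised k l)
        ≈⟨ *-congʳ (ib-inv k) ⟨
      (factor b k * ib k) * ((1# + b * p ^ k) * well-poised k l)
        ≈⟨ solve 9 (λ b y i σ t B A A₂ I →
             ((:1 :- b :* y) :* i) :* ((:1 :+ b :* y) :* (σ :* t :* B :* A :* A₂ :* I)) :=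
             σ :* (:1 :- b :* b :* y :* y) :* A :* A₂ :* I :* (t :* B :* i)) refl b (p ^ k) _ _ _ _ _ _ _ ⟩
      outer k l * (p^tri k * b ^ k * ib k) ∎

    pochhammer²-+ : ∀ j r l →
      pochhammer (a * a) (ix (j ℕ.+ r) l) ≈ pochhammer (a * a) (ix j 0) * pochhammer (α j * a) (ix r l)
    pochhammer²-+ j r l rewrite ix-+ j r l = trans (pochhammer-+ (a * a) (ix j 0) (ix r l))
      (*-congˡ (prod-cong (ix r l) (λ i → +-congˡ (-‿cong (*-congʳ
        (solve 2 (λ a y → a :* a :* y := a :* y :* a) refl a (p ^ ix j 0)))))))

    module _ (j r l : ℕ) where
      N : ℕ
      N = ix j 0

      sign-jr : sign (j ℕ.+ r) * sign j ≈ sign r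
      sign-jr = begin
        sign (j ℕ.+ r) * sign j     ≈⟨ *-congʳ (sign-+ j r) ⟩
        sign j * sign r * sign j
          ≈⟨ solve 2 (λ x y → x :* y :* x := (x :* x) :* y) refl _ _ ⟩
        (sign j * sign j) * sign r  ≈⟨ trans (*-congʳ (sign-² j)) (*-identityˡ _) ⟩
        sign r                      ∎

      square-jr : 1# - a * p ^ (j ℕ.+ r) * p ^ (j ℕ.+ r) ≈ 1# - α j * p ^ r * p ^ r
      square-jr = +-congˡ (-‿cong (begin
        a * p ^ (j ℕ.+ r) * p ^ (j ℕ.+ r)
          ≈⟨ *-cong (*-congˡ (^-homo-* p j r)) (^-homo-* p j r) ⟩
        a * (p ^ j * p ^ r) * (p ^ j * p ^ r)
          ≈⟨ solve 3 (λ a s w → a :* (s :* w) :* (s :* w) := a :* (s :* s :* :1) :* w :* w) refl _ _ _ ⟩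
        a * (p ^ j * p ^ j * 1#) * p ^ r * p ^ r
          ≈⟨ *-congʳ (*-congʳ (*-congˡ (p^ix j 0))) ⟨
        α j * p ^ r * p ^ r ∎))

      pochhammer-jr : pochhammer a (ix j r) ≈ pochhammer a N * pochhammer (α j) r
      pochhammer-jr rewrite ix-0 j r = pochhammer-+ a N r

      ia-jr : prod (suc (ix (j ℕ.+ r) l)) ia ≈ prod N ia * prod (suc (ix r l)) (iα j)
      ia-jr = trans
        (reflexive (≡.cong (λ i → prod i ia) (≡.trans (≡.cong suc (ix-+ j r l)) (≡.sym (ℕₚ.+-suc N (ix r l))))))
        (prod-+ N (suc (ix r l)) ia)

      -- Each shifted factorial is split at index 2j into a part depending on j alone and one based
      -- on αⱼ; the factor (a;p)_(2j) of `pfterm` cancels the first 2j inverses of `outer`.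
      exchange : outer (j ℕ.+ r) l * pfterm j r ≈ weight j * Inner.term j r l
      exchange = begin
        outer (j ℕ.+ r) l * pfterm j r
          ≈⟨ *-cong
               (*-cong (*-cong (*-congʳ (*-congˡ square-jr)) (pochhammer²-+ j r l)) (*-congˡ ia-jr))
               (*-congʳ (*-congʳ (*-congˡ pochhammer-jr))) ⟩
        (sign (j ℕ.+ r) * x * A * (D * E) * (I * (J * K))) * (sign j * t * (F * G) * (L * M * P) * ib j)
          ≈⟨ solve 16 (λ σ x A D E I J K τ t F G L M P i →
               (σ :* x :* A :* (D :* E) :* (I :* (J :* K))) :* (τ :* t :* (F :* G) :* (L :* M :* P) :* i) :=
               ((F :* J) :* (D :* (P :* L) :* i)) :* ((σ :* τ) :* x :* t :* G :* A :* E :* (M :* I :* K)))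
               refl _ _ _ _ _ _ _ _ _ _ _ _ _ _ _ _ ⟩
        ((F * J) * weight j) * ((sign (j ℕ.+ r) * sign j) * x * t * G * A * E * (M * I * K))
          ≈⟨ *-cong (trans (*-congʳ (prod-inverse N ia-inv)) (*-identityˡ _))
                    (*-congʳ (*-congʳ (*-congʳ (*-congʳ (*-congʳ (*-congʳ sign-jr)))))) ⟩
        weight j * Inner.term j r l ∎
        where
        x A D E I J K t F G L M P : Carrier
        x = 1# - α j * p ^ r * p ^ r
        A = pochhammer a l
        D = pochhammer (a * a) N
        E = pochhammer (α j * a) (ix r l)
        I = prod l ip
        J = prod N ia
        K = prod (suc (ix r l)) (iα j)
        t = p^tri r
        F = pochhammer a N
        G = pochhammer (α j) r
        L = prod j ia
        M = prod r ip
        P = prod j ip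

    weight-value : ∀ j n → weight j * Inner.value j n ≈ transformed j n
    weight-value j n = begin
      weight j * Inner.value j n
        ≈⟨ solve 8 (λ D P L i A t E I → (D :* (P :* L) :* i) :* (A :* t :* E :* I) :=
             A :* t :* (D :* E) :* (I :* P :* L) :* i) refl _ _ _ _ _ _ _ _ ⟩
      (- a) ^ n * p^tri n * (pochhammer (a * a) (ix j 0) * pochhammer (α j * a) n)
        * (prod n ip * prod j ip * prod j ia) * ib j
        ≈⟨ *-congʳ (*-congʳ (*-congˡ merge)) ⟩
      transformed j n ∎
      where
      merge : pochhammer (a * a) (ix j 0) * pochhammer (α j * a) n ≈ pochhammer (a * a) (ix j n)
      merge = trans (sym (pochhammer²-+ j 0 n))
        (reflexive (≡.cong (λ i → pochhammer (a * a) (ix i n)) (ℕₚ.+-identityʳ j)))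

  transformation : ∀ m → conv m (λ k l → (1# + b * p ^ k) * well-poised k l) ≈ conv m transformed
  transformation m = begin
    conv m (λ k l → (1# + b * p ^ k) * well-poised k l)
      ≈⟨ conv-cong m (λ k l _ → expand k l) ⟩
    conv m (λ k l → conv k (λ j r → weight j * Inner.term j r l))
      ≈⟨ conv-assoc m (λ j r l → weight j * Inner.term j r l) ⟩
    conv m (λ j n → conv n (λ r l → weight j * Inner.term j r l))
      ≈⟨ conv-cong m (λ j n _ → trans (sym (conv-*ˡ n (weight j) _))
                                      (trans (*-congˡ (Inner.conv-term j n)) (weight-value j n))) ⟩
    conv m transformed ∎
    where
    expand : ∀ k l → (1# + b * p ^ k) * well-poised k l ≈ conv k (λ j r → weight j * Inner.term j r l)
    expand k l = begin
      (1# + b * p ^ k) * well-poised k l            ≈⟨ well-poised-outer k l ⟩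
      outer k l * (p^tri k * b ^ k * ib k)          ≈⟨ *-congˡ (partial-fractions k) ⟨
      outer k l * conv k pfterm                     ≈⟨ conv-*ˡ k _ _ ⟩
      conv k (λ j r → outer k l * pfterm j r)       ≈⟨ conv-cong k (λ { j r ≡.refl → exchange j r l }) ⟩
      conv k (λ j r → weight j * Inner.term j r l)  ∎

-- Congruences with quotients in a subring, and the collapse of the triple sum.

record Subring {c ℓ} (R : CommutativeRing c ℓ) (s : Level) : Set (c ⊔ ℓ ⊔ lsuc s) where
  open CommutativeRing R
  field
    Loc      : Carrier → Set s
    Loc-resp : ∀ {x y} → x ≈ y → Loc x → Loc y
    Loc-1#   : Loc 1#
    Loc-+    : ∀ {x y} → Loc x → Loc y → Loc (x + y)
    Loc-*    : ∀ {x y} → Loc x → Loc y → Loc (x * y)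
    Loc-neg  : ∀ {x} → Loc x → Loc (- x)

module Congruence {c ℓ s} (R : CommutativeRing c ℓ) (S : Subring R s) (μ : CommutativeRing.Carrier R)
  (Loc-μ : Subring.Loc S μ) where
  open CommutativeRing R
  open Subring S public
  open import Relation.Binary.Reasoning.Setoid setoid
  open IntegerCoefficients R
  open Solver
  open Sums R

  infix 4 _∼_

  -- Only the quotient has to be integral. The subring is a predicate on the ambient ring, so x and
  -- y may be rewritten by identities with nonintegral intermediate terms; integrality is asked for
  -- again when congruences are multiplied.
  _∼_ : Carrier → Carrier → Set (c ⊔ ℓ ⊔ s)
  x ∼ y = ∃ λ z → Loc z × x - y ≈ μ * z

  Loc-0# : Loc 0#
  Loc-0# = Loc-resp (-‿inverseʳ 1#) (Loc-+ Loc-1# (Loc-neg Loc-1#))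

  Loc-sub : ∀ {x y} → Loc x → Loc y → Loc (x - y)
  Loc-sub lx ly = Loc-+ lx (Loc-neg ly)

  ≈⇒∼ : ∀ {x y} → x ≈ y → x ∼ y
  ≈⇒∼ {x} {y} x≈y = 0# , Loc-0# , trans (+-congʳ x≈y) (trans (-‿inverseʳ y) (sym (zeroʳ μ)))

  ∼-sym : ∀ {x y} → x ∼ y → y ∼ x
  ∼-sym {x} {y} (z , lz , e) = - z , Loc-neg lz , (begin
    y - x      ≈⟨ solve 2 (λ x y → y :- x := :- (x :- y)) refl x y ⟩
    - (x - y)  ≈⟨ -‿cong e ⟩
    - (μ * z)  ≈⟨ solve 2 (λ m z → :- (m :* z) := m :* (:- z)) refl μ z ⟩
    μ * - z    ∎)

  ∼-trans : ∀ {x y z} → x ∼ y → y ∼ z → x ∼ z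
  ∼-trans {x} {y} {z} (u , lu , e) (v , lv , e′) = u + v , Loc-+ lu lv , (begin
    x - z              ≈⟨ solve 3 (λ x y z → x :- z := (x :- y) :+ (y :- z)) refl x y z ⟩
    (x - y) + (y - z)  ≈⟨ +-cong e e′ ⟩
    μ * u + μ * v      ≈⟨ distribˡ μ u v ⟨
    μ * (u + v)        ∎)

  ∼-+ : ∀ {x y u v} → x ∼ y → u ∼ v → x + u ∼ y + v
  ∼-+ {x} {y} {u} {v} (z , lz , e) (w , lw , e′) = z + w , Loc-+ lz lw , (begin
    (x + u) - (y + v)  ≈⟨ solve 4 (λ x y u v → (x :+ u) :- (y :+ v) := (x :- y) :+ (u :- v)) refl x y u v ⟩
    (x - y) + (u - v)  ≈⟨ +-cong e e′ ⟩
    μ * z + μ * w      ≈⟨ distribˡ μ z w ⟨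
    μ * (z + w)        ∎)

  ∼-*ˡ : ∀ {x y u} → Loc u → x ∼ y → u * x ∼ u * y
  ∼-*ˡ {x} {y} {u} lu (z , lz , e) = u * z , Loc-* lu lz , (begin
    u * x - u * y  ≈⟨ solve 3 (λ x y u → u :* x :- u :* y := u :* (x :- y)) refl x y u ⟩
    u * (x - y)    ≈⟨ *-congˡ e ⟩
    u * (μ * z)    ≈⟨ solve 3 (λ u m z → u :* (m :* z) := m :* (u :* z)) refl u μ z ⟩
    μ * (u * z)    ∎)

  ∼-*ʳ : ∀ {x y u} → Loc u → x ∼ y → x * u ∼ y * u
  ∼-*ʳ lu x∼y = ∼-trans (≈⇒∼ (*-comm _ _)) (∼-trans (∼-*ˡ lu x∼y) (≈⇒∼ (*-comm _ _)))

  Loc-∼ : ∀ {x y} → x ∼ y → Loc y → Loc x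
  Loc-∼ {x} {y} (z , lz , e) ly = Loc-resp (begin
    μ * z + y    ≈⟨ +-congʳ e ⟨
    (x - y) + y  ≈⟨ solve 2 (λ x y → (x :- y) :+ y := x) refl x y ⟩
    x            ∎) (Loc-+ (Loc-* Loc-μ lz) ly)

  ∼-* : ∀ {x y u v} → Loc y → Loc v → x ∼ y → u ∼ v → x * u ∼ y * v
  ∼-* ly lv x∼y u∼v = ∼-trans (∼-*ʳ (Loc-∼ u∼v lv) x∼y) (∼-*ˡ ly u∼v)

  ∼0-*ˡ : ∀ {x u} → Loc u → x ∼ 0# → u * x ∼ 0#
  ∼0-*ˡ lu x∼0 = ∼-trans (∼-*ˡ lu x∼0) (≈⇒∼ (zeroʳ _))

  μ-multiple : ∀ {z} → Loc z → μ * z ∼ 0#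
  μ-multiple {z} lz = z , lz , solve 1 (λ x → x :- :0 := x) refl _

  Loc-prod : ∀ n {f} → (∀ i → i ℕ.< n → Loc (f i)) → Loc (prod n f)
  Loc-prod zero    lf = Loc-1#
  Loc-prod (suc n) lf = Loc-* (Loc-prod n (λ i i<n → lf i (ℕₚ.m<n⇒m<1+n i<n))) (lf n ℕₚ.≤-refl)

  Loc-sum : ∀ n {f} → (∀ i → i ℕ.< n → Loc (f i)) → Loc (sum n f)
  Loc-sum zero    lf = Loc-0#
  Loc-sum (suc n) lf = Loc-+ (Loc-sum n (λ i i<n → lf i (ℕₚ.m<n⇒m<1+n i<n))) (lf n ℕₚ.≤-refl)

  ∼-sum : ∀ n {f g} → (∀ i → i ℕ.< n → f i ∼ g i) → sum n f ∼ sum n g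
  ∼-sum zero    f∼g = ≈⇒∼ refl
  ∼-sum (suc n) f∼g = ∼-+ (∼-sum n (λ i i<n → f∼g i (ℕₚ.m<n⇒m<1+n i<n))) (f∼g n ℕₚ.≤-refl)

  ∼0-sum : ∀ n {f} → (∀ i → i ℕ.< n → f i ∼ 0#) → sum n f ∼ 0#
  ∼0-sum zero    f∼0 = ≈⇒∼ refl
  ∼0-sum (suc n) f∼0 =
    ∼-trans (∼-+ (∼0-sum n (λ i i<n → f∼0 i (ℕₚ.m<n⇒m<1+n i<n))) (f∼0 n ℕₚ.≤-refl)) (≈⇒∼ (+-identityˡ 0#))

  sum-truncate : ∀ m n {f} → m ℕ.≤ n → (∀ i → m ℕ.≤ i → i ℕ.< n → f i ∼ 0#) → sum n f ∼ sum m f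
  sum-truncate m zero    z≤n   f∼0 = ≈⇒∼ refl
  sum-truncate m (suc n) m≤1+n f∼0 with ℕₚ.m≤n⇒m<n∨m≡n m≤1+n
  ... | inj₂ ≡.refl = ≈⇒∼ refl
  ... | inj₁ m<1+n = ∼-trans
    (∼-+ (sum-truncate m n (ℕₚ.≤-pred m<1+n) (λ i m≤i i<n → f∼0 i m≤i (ℕₚ.m<n⇒m<1+n i<n)))
         (f∼0 n (ℕₚ.≤-pred m<1+n) ℕₚ.≤-refl))
    (≈⇒∼ (+-identityʳ _))

  ∼-conv : ∀ n {f g} → (∀ i j → i ℕ.+ j ≡ n → f i j ∼ g i j) → conv n f ∼ conv n g
  ∼-conv zero    f∼g = f∼g 0 0 ≡.refl
  ∼-conv (suc n) f∼g = ∼-+ (f∼g 0 (suc n) ≡.refl) (∼-conv n (λ i j e → f∼g (suc i) j (≡.cong suc e)))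

  module TripleSum (f : ℕ → Carrier) (n m : ℕ) (3m<n : m ℕ.+ m ℕ.+ m ℕ.< n)
    (Loc-f : ∀ k → k ℕ.< n → Loc (f k)) (f∼0 : ∀ k → m ℕ.< k → k ℕ.< n → f k ∼ 0#) where

    private
      Σf : Carrier
      Σf = sum (suc m) f

      sum-*ˡ : ∀ k u (g : ℕ → Carrier) → u * sum k g ≈ sum k (λ i → u * g i)
      sum-*ˡ zero    u g = zeroʳ u
      sum-*ˡ (suc k) u g = trans (distribˡ u _ _) (+-congʳ (sum-*ˡ k u g))

      sum-*ʳ : ∀ k (g : ℕ → Carrier) u → sum k g * u ≈ sum k (λ i → g i * u)
      sum-*ʳ zero    g u = zeroˡ u
      sum-*ʳ (suc k) g u = trans (distribʳ u _ _) (+-congʳ (sum-*ʳ k g u))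

      below : ∀ i j {k} → k ℕ.< n ∸ i ∸ j → k ℕ.< n
      below i j k< = ℕₚ.<-≤-trans k< (ℕₚ.≤-trans (ℕₚ.m∸n≤m (n ∸ i) j) (ℕₚ.m∸n≤m n i))

      -- This is where 3m < n enters: for i, j ≤ m the innermost range still contains 0, ..., m, so
      -- the simplex contains the whole cube of indices that matter.
      m<n∸i∸j : ∀ {i j} → i ℕ.≤ m → j ℕ.≤ m → m ℕ.< n ∸ i ∸ j
      m<n∸i∸j {i} {j} i≤m j≤m rewrite ℕₚ.∸-+-assoc n i j = ℕₚ.m+n≤o⇒m≤o∸n (suc m)
        (ℕₚ.≤-trans (s≤s (ℕₚ.+-monoʳ-≤ m (ℕₚ.+-mono-≤ i≤m j≤m)))
          (ℕₚ.≤-trans (ℕₚ.≤-reflexive (≡.cong suc (≡.sym (ℕₚ.+-assoc m m m)))) 3m<n))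

      m<n∸i : ∀ {i} → i ℕ.≤ m → m ℕ.< n ∸ i
      m<n∸i {i} i≤m = ℕₚ.<-≤-trans (m<n∸i∸j {i} {0} i≤m z≤n) ℕₚ.≤-refl

      m<n : m ℕ.< n
      m<n = m<n∸i {0} z≤n

      innermost : ∀ i j → i ℕ.≤ m → j ℕ.≤ m → sum (n ∸ i ∸ j) (λ k → f i * f j * f k) ∼ f i * f j * Σf
      innermost i j i≤m j≤m = ∼-trans
        (sum-truncate (suc m) (n ∸ i ∸ j) (m<n∸i∸j i≤m j≤m)
          (λ k m<k k< → ∼0-*ˡ (Loc-* (Loc-f i (ℕₚ.≤-<-trans i≤m m<n)) (Loc-f j (ℕₚ.≤-<-trans j≤m m<n)))
                             (f∼0 k m<k (below i j k<))))
        (≈⇒∼ (sym (sum-*ˡ (suc m) (f i * f j) f)))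

      middle : ∀ i → i ℕ.≤ m → sum (n ∸ i) (λ j → sum (n ∸ i ∸ j) λ k → f i * f j * f k) ∼ f i * Σf * Σf
      middle i i≤m = ∼-trans
        (sum-truncate (suc m) (n ∸ i) (m<n∸i i≤m) (λ j m<j j< → ∼0-sum (n ∸ i ∸ j) (λ k k< →
          ∼-trans (≈⇒∼ (solve 3 (λ x y z → x :* y :* z := x :* z :* y) refl (f i) (f j) (f k)))
            (∼0-*ˡ (Loc-* (Loc-f i (ℕₚ.≤-<-trans i≤m m<n)) (Loc-f k (below i j k<)))
                   (f∼0 j m<j (below i 0 j<))))))
        (∼-trans (∼-sum (suc m) (λ j j≤m → innermost i j i≤m (ℕₚ.≤-pred j≤m)))
          (≈⇒∼ (sym (trans (*-congʳ (sum-*ˡ (suc m) (f i) f)) (sum-*ʳ (suc m) _ Σf)))))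

    tripleSum∼ : tripleSum n f ∼ Σf * Σf * Σf
    tripleSum∼ = ∼-trans
      (sum-truncate (suc m) n m<n (λ i m<i i<n → ∼0-sum (n ∸ i) (λ j j< → ∼0-sum (n ∸ i ∸ j) (λ k k< →
        ∼-trans (≈⇒∼ (solve 3 (λ x y z → x :* y :* z := y :* z :* x) refl (f i) (f j) (f k)))
          (∼0-*ˡ (Loc-* (Loc-f j (below i 0 j<)) (Loc-f k (below i j k<))) (f∼0 i m<i i<n))))))
      (∼-trans (∼-sum (suc m) (λ i i≤m → middle i (ℕₚ.≤-pred i≤m)))
        (≈⇒∼ (sym (trans (*-congʳ (sum-*ʳ (suc m) f Σf)) (sum-*ʳ (suc m) _ Σf)))))

-- The supercongruence over an abstract ring.

-- a = q², b = q, p = q²ᵈ, e = p / b, f = p / a and x = a pᵐ = q²ⁿ.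
module Summands {c ℓ} (R : CommutativeRing c ℓ) (b e f iβ : CommutativeRing.Carrier R)
  (ip ib : ℕ → CommutativeRing.Carrier R) (m : ℕ) where
  open CommutativeRing R
  open Sums R

  a p : Carrier
  a = b * b
  p = b * e

  open Pochhammer R p

  x : Carrier
  x = a * p ^ m

  -- c_q(k) without the factor (1 + b pᵏ) / (1 + b)
  kernel : ℕ → Carrier
  kernel k = sign k * p^tri k * e ^ k * (pochhammer a k * pochhammer a k) * (prod k ip * prod k ip)

  summand : ℕ → Carrier
  summand k = (1# + b * p ^ k) * iβ * kernel k

  limit-kernel : ℕ → Carrier
  limit-kernel j = (- a) ^ m * p^tri m * (f ^ j * (pochhammer a j * prod j ip))

  -- What the transformed series becomes at x = 1, apart from its normalisation. The factor 1 - x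
  -- stays next to `ib j`, because for one j the inverse may have a pole and only the product is
  -- assumed integral.
  limit : ℕ → Carrier
  limit j = iβ * ((1# - x) * ib j) * limit-kernel j

module Supercongruence {c ℓ ℓ′} (R : CommutativeRing c ℓ) (S : Subring R ℓ′)
  (b e f iβ : CommutativeRing.Carrier R)
  (ip ia ib ia² : ℕ → CommutativeRing.Carrier R)
  (af≈p : CommutativeRing._≈_ R (CommutativeRing._*_ R (CommutativeRing._*_ R b b) f) (CommutativeRing._*_ R b e))
  (ip-inv : Pochhammer.FactorsInvertedBy R (CommutativeRing._*_ R b e) (CommutativeRing._*_ R b e) ip)
  (ia-inv : Pochhammer.FactorsInvertedBy R (CommutativeRing._*_ R b e) (CommutativeRing._*_ R b b) ia)
  (ib-inv : Pochhammer.FactorsInvertedBy R (CommutativeRing._*_ R b e) b ib)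
  (ia²-inv : Pochhammer.FactorsInvertedBy R (CommutativeRing._*_ R b e)
    (CommutativeRing._*_ R (CommutativeRing._*_ R b b) (CommutativeRing._*_ R b b)) ia²)
  (m n : ℕ) (m<n : m ℕ.< n)
  (Loc-b : Subring.Loc S b) (Loc-e : Subring.Loc S e) (Loc-f : Subring.Loc S f) (Loc-iβ : Subring.Loc S iβ)
  (Loc-ip : ∀ i → suc i ℕ.< n → Subring.Loc S (ip i))
  -- The two hypotheses on `ia` leave out index m on purpose: there the inverted factor is 1 - x
  -- itself.
  (Loc-ia : ∀ i → i ℕ.< m → Subring.Loc S (ia i))
  (Loc-ia-beyond : ∀ k → k ℕ.< m → Subring.Loc S (ia (m ℕ.+ suc k)))
  (Loc-ia² : ∀ i → i ℕ.< m → Subring.Loc S (ia² i))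
  where
  open CommutativeRing R
  open import Relation.Binary.Reasoning.Setoid setoid
  open IntegerCoefficients R
  open Solver
  open Sums R
  open Summands R b e f iβ ip ib m
  open Pochhammer R p
  open Transformation R p b ip ia ib ip-inv ia-inv ib-inv hiding (a)

  μ : Carrier
  μ = (1# - x) * (1# - x)

  private
    module S = Subring S

    Loc-a : S.Loc a
    Loc-a = S.Loc-* Loc-b Loc-b

    Loc-p : S.Loc p
    Loc-p = S.Loc-* Loc-b Loc-e

    Loc-^ : ∀ {y} k → S.Loc y → S.Loc (y ^ k)
    Loc-^ zero    ly = S.Loc-1#
    Loc-^ (suc k) ly = S.Loc-* ly (Loc-^ k ly)

    Loc-1-x : S.Loc (1# - x)
    Loc-1-x = S.Loc-+ S.Loc-1# (S.Loc-neg (S.Loc-* Loc-a (Loc-^ m Loc-p)))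

  open Congruence R S μ (S.Loc-* Loc-1-x Loc-1-x)

  module _ (Loc-ib : ∀ j → j ℕ.≤ m → Loc ((1# - x) * ib j)) where

    private
      Loc-factor : ∀ {y} i → Loc y → Loc (factor y i)
      Loc-factor i ly = Loc-sub Loc-1# (Loc-* ly (Loc-^ i Loc-p))

      Loc-pochhammer : ∀ {y} k → Loc y → Loc (pochhammer y k)
      Loc-pochhammer k ly = Loc-prod k (λ i _ → Loc-factor i ly)

      Loc-sign : ∀ k → Loc (sign k)
      Loc-sign k = Loc-^ k (Loc-neg Loc-1#)

      Loc-tri : ∀ k → Loc (p^tri k)
      Loc-tri zero    = Loc-1#
      Loc-tri (suc k) = Loc-* (Loc-tri k) (Loc-^ k Loc-p)

    Loc-kernel : ∀ k → k ℕ.< n → Loc (kernel k)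
    Loc-kernel k k<n = Loc-* (Loc-* (Loc-* (Loc-* (Loc-sign k) (Loc-tri k)) (Loc-^ k Loc-e))
      (Loc-* (Loc-pochhammer k Loc-a) (Loc-pochhammer k Loc-a))) (Loc-* li li)
      where li = Loc-prod k (λ i i<k → Loc-ip i (ℕₚ.<-≤-trans (s≤s i<k) k<n))

    Loc-prefactor : ∀ k → Loc ((1# + b * p ^ k) * iβ)
    Loc-prefactor k = Loc-* (Loc-+ Loc-1# (Loc-* Loc-b (Loc-^ k Loc-p))) Loc-iβ

    Loc-summand : ∀ k → k ℕ.< n → Loc (summand k)
    Loc-summand k k<n = Loc-* (Loc-prefactor k) (Loc-kernel k k<n)

    summand∼0 : ∀ k → m ℕ.< k → k ℕ.< n → summand k ∼ 0#
    summand∼0 k m<k k<n = ∼-trans (≈⇒∼ (begin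
      summand k
        ≈⟨ *-congˡ (*-congʳ (*-congˡ (*-cong split split))) ⟩
      (1# + b * p ^ k) * iβ * (sign k * p^tri k * e ^ k * (A * (1# - x) * B * (A * (1# - x) * B)) * (prod k ip * prod k ip))
        ≈⟨ solve 6 (λ u v A y B I → u :* (v :* (A :* y :* B :* (A :* y :* B)) :* I) :=
             y :* y :* (u :* (v :* (A :* A) :* (B :* B) :* I))) refl _ _ _ _ _ _ ⟩
      μ * ((1# + b * p ^ k) * iβ * (sign k * p^tri k * e ^ k * (A * A) * (B * B) * (prod k ip * prod k ip))) ∎))
      (μ-multiple (Loc-* (Loc-prefactor k)
        (Loc-* (Loc-* (Loc-* (Loc-* (Loc-* (Loc-sign k) (Loc-tri k)) (Loc-^ k Loc-e)) (Loc-* lA lA)) (Loc-* lB lB))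
               (Loc-* li li))))
      where
      A B : Carrier
      A = pochhammer a m
      B = prod (k ∸ suc m) (λ i → factor a (suc m ℕ.+ i))
      lA = Loc-pochhammer m Loc-a
      lB = Loc-prod (k ∸ suc m) (λ i _ → Loc-factor (suc m ℕ.+ i) Loc-a)
      li = Loc-prod k (λ i i<k → Loc-ip i (ℕₚ.<-≤-trans (s≤s i<k) k<n))
      split : pochhammer a k ≈ A * (1# - x) * B
      split = trans (reflexive (≡.cong (λ j → prod j (factor a)) (≡.sym (ℕₚ.m+[n∸m]≡n m<k))))
                    (prod-+ (suc m) (k ∸ suc m) (factor a))

    private
      -- Together with 1 - x it scales the series to have 1 as its term k = 0. The factor 1 - x
      -- cancels `ia m`, which occurs in every term of `well-poised` and is the only inverse there
      -- not assumed to be integral.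
      norm : Carrier
      norm = pochhammer p m * prod m ia²

      norm-base : norm * (1# - x) * well-poised 0 m ≈ 1#
      norm-base = begin
        norm * (1# - x) * well-poised 0 m
          ≈⟨ solve 7 (λ P I x A A² J K →
               P :* I :* x :* (:1 :* :1 :* :1 :* A :* A² :* (J :* K)) := (P :* J) :* ((A² :* I) :* ((A :* x) :* K)))
               refl _ _ _ _ _ _ _ ⟩
        (pochhammer p m * prod m ip)
          * ((pochhammer (a * a) m * prod m ia²) * (pochhammer a (suc m) * prod (suc m) ia))
          ≈⟨ *-cong (prod-inverse m ip-inv) (*-cong (prod-inverse m ia²-inv) (prod-inverse (suc m) ia-inv)) ⟩
        1# * (1# * 1#)  ≈⟨ trans (*-identityˡ _) (*-identityˡ 1#) ⟩
        1#              ∎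

      ratio* : ℕ → ℕ → Carrier
      ratio* k l = - (p ^ k * b * (1# - p * p ^ l) * factor (a * a) (suc (ix k l)) * ia l * ia (suc (suc (ix k l))))

      ratio : ℕ → Carrier
      ratio k = - (p ^ k * e * (factor a k * factor a k) * (ip k * ip k))

      well-poised-suc : ∀ k l → well-poised (suc k) l ≈ ratio* k l * well-poised k (suc l)
      well-poised-suc k l rewrite ix-suc k l = begin
        well-poised (suc k) l
          ≈⟨ trans (*-cong (ip-inv l) (trans (*-congʳ (ia-inv l)) (*-identityˡ _))) (*-identityˡ _) ⟨
        (factor p l * ip l) * ((factor a l * ia l) * well-poised (suc k) l)
          ≈⟨ solve 17 (λ u v g i σ t y b B A A² h h′ J K z z′ →
               (u :* v) :* ((g :* i) :* ((:- :1 :* σ) :* (t :* y) :* (b :* B) :* A :* (A² :* h :* h′) :* (J :* (K :* z :* z′)))) :=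
               (:- (y :* b :* u :* h′ :* i :* z′)) :* (σ :* t :* B :* (A :* g) :* (A² :* h) :* (J :* v :* (K :* z))))
               refl _ _ _ _ _ _ _ _ _ _ _ _ _ _ _ _ _ ⟩
        _ ∎

      kernel-suc : ∀ k → kernel (suc k) ≈ ratio k * kernel k
      kernel-suc k = solve 9 (λ σ t y e E A g I i →
        (:- :1 :* σ) :* (t :* y) :* (e :* E) :* (A :* g :* (A :* g)) :* (I :* i :* (I :* i)) :=
        (:- (y :* e :* (g :* g) :* (i :* i))) :* (σ :* t :* E :* (A :* A) :* (I :* I)))
        refl _ _ _ _ _ _ _ _ _

      index : ∀ k l → k ℕ.+ suc l ≡ m → suc (suc (ix k l)) ≡ m ℕ.+ suc k
      index k l ≡.refl = go k
        where
        go : ∀ k → suc (suc (ix k l)) ≡ k ℕ.+ suc l ℕ.+ suc k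
        go zero    = ≡.cong suc (ℕₚ.+-comm 1 l)
        go (suc k) = ≡.cong suc (≡.trans (≡.cong suc (go k)) (≡.sym (ℕₚ.+-suc _ _)))

      -- As x = apᵏ⁺ˡ⁺¹, the ratio `ratio* k l` is -pᵏe times (1 - apᵏx)(1 - apᵏ/x) over (1 -
      -- pᵏ⁺¹x)(1 - pᵏ⁺¹/x). The constant b turns into e = bp/a because (1 - pˡ⁺¹)/(1 - apˡ) equals
      -- p/a times the quotient of the factors in 1/x. In `core` the cofactor of (1 - x)² is
      -- explicit.
      ratio-∼ : ∀ k l → k ℕ.+ suc l ≡ m → ratio* k l ∼ ratio k
      ratio-∼ k l k+l+1≡m = δ , Loc-δ , (begin
        ratio* k l - ratio k
          ≈⟨ +-cong insert* (-‿cong insert) ⟩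
        - (u * b * (1# - p * w) * A * i * i′) * ((factor p k * v) * (factor p k * v))
          - - (u * e * (factor a k * factor a k) * (v * v)) * ((factor a l * i) * (A′ * i′))
          ≈⟨ solve 12 (λ u b y A i i′ z v e h h′ A′ →
               :- (u :* b :* y :* A :* i :* i′) :* ((z :* v) :* (z :* v))
                 :- :- (u :* e :* (h :* h) :* (v :* v)) :* ((h′ :* i) :* (A′ :* i′)) :=
               :- (u :* (i :* i′ :* (v :* v))) :* (b :* y :* A :* (z :* z) :- e :* h′ :* A′ :* (h :* h)))
               refl _ _ _ _ _ _ _ _ _ _ _ _ ⟩
        - (u * (i * i′ * (v * v)))
          * (b * (1# - p * w) * A * (factor p k * factor p k) - e * factor a l * A′ * (factor a k * factor a k))
          ≈⟨ *-congˡ (+-cong (*-congʳ (*-congˡ A≈)) (-‿cong (*-congʳ (*-congˡ A′≈)))) ⟩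
        _ ≈⟨ *-congˡ (core b e u w) ⟩
        - (u * (i * i′ * (v * v))) * ((1# - x′) * (1# - x′) * γ)
          ≈⟨ *-congˡ (*-congʳ (*-cong x′≈x x′≈x)) ⟩
        - (u * (i * i′ * (v * v))) * (μ * γ)
          ≈⟨ solve 3 (λ x y z → x :* (y :* z) := y :* (x :* z)) refl _ _ _ ⟩
        μ * δ ∎)
        where
        u w i i′ v A A′ x′ γ δ : Carrier
        u = p ^ k
        w = p ^ l
        i = ia l
        i′ = ia (suc (suc (ix k l)))
        v = ip k
        A = factor (a * a) (suc (ix k l))
        A′ = factor a (suc (suc (ix k l)))
        x′ = a * (u * (p * w))
        γ = b * (factor p k * factor p k) - e * (factor a k * factor a k)
        δ = - (u * (i * i′ * (v * v))) * γ
        core : ∀ b e u w → let p = b * e; a = b * b; pu = 1# - p * u; au = 1# - a * u; x = a * (u * (p * w)) in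
          b * (1# - p * w) * (1# - a * a * (p * (u * u * w))) * (pu * pu)
            - e * (1# - a * w) * (1# - a * (p * (p * (u * u * w)))) * (au * au)
          ≈ (1# - x) * (1# - x) * (b * (pu * pu) - e * (au * au))
        core = solve 4 (λ b e u w →
          let p = b :* e; a = b :* b; pu = :1 :- p :* u; au = :1 :- a :* u; x = a :* (u :* (p :* w)) in
          b :* (:1 :- p :* w) :* (:1 :- a :* a :* (p :* (u :* u :* w))) :* (pu :* pu)
            :- e :* (:1 :- a :* w) :* (:1 :- a :* (p :* (p :* (u :* u :* w)))) :* (au :* au)
          := (:1 :- x) :* (:1 :- x) :* (b :* (pu :* pu) :- e :* (au :* au))) refl
        A≈ : A ≈ 1# - a * a * (p * (u * u * w))
        A≈ = +-congˡ (-‿cong (*-congˡ (*-congˡ (p^ix k l))))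
        A′≈ : A′ ≈ 1# - a * (p * (p * (u * u * w)))
        A′≈ = +-congˡ (-‿cong (*-congˡ (*-congˡ (*-congˡ (p^ix k l)))))
        x′≈x : 1# - x′ ≈ 1# - x
        x′≈x = +-congˡ (-‿cong (*-congˡ (trans (sym (^-homo-* p k (suc l))) (^-congʳ p k+l+1≡m))))
        insert* : ratio* k l ≈ ratio* k l * ((factor p k * v) * (factor p k * v))
        insert* = sym (trans (*-congˡ (trans (*-cong (ip-inv k) (ip-inv k)) (*-identityˡ 1#))) (*-identityʳ _))
        insert : ratio k ≈ ratio k * ((factor a l * i) * (A′ * i′))
        insert = sym (trans (*-congˡ (trans (*-cong (ia-inv l) (ia-inv _)) (*-identityˡ 1#))) (*-identityʳ _))
        k<m : k ℕ.< m
        k<m = ℕₚ.≤-trans (ℕₚ.m≤m+n (suc k) l) (ℕₚ.≤-reflexive (≡.trans (≡.sym (ℕₚ.+-suc k l)) k+l+1≡m))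
        l<m : l ℕ.< m
        l<m = ℕₚ.≤-trans (ℕₚ.m≤n+m (suc l) k) (ℕₚ.≤-reflexive k+l+1≡m)
        lv : Loc v
        lv = Loc-ip k (ℕₚ.≤-<-trans k<m m<n)
        Loc-δ : Loc δ
        Loc-δ = Loc-* (Loc-neg (Loc-* (Loc-^ k Loc-p) (Loc-* (Loc-* (Loc-ia l l<m)
            (≡.subst (λ j → Loc (ia j)) (≡.sym (index k l k+l+1≡m)) (Loc-ia-beyond k k<m))) (Loc-* lv lv))))
          (Loc-sub (Loc-* Loc-b (Loc-* (Loc-factor k Loc-p) (Loc-factor k Loc-p)))
                   (Loc-* Loc-e (Loc-* (Loc-factor k Loc-a) (Loc-factor k Loc-a))))

      -- Induction through ratios of consecutive terms: the perturbed factors in 1/x then never have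
      -- to be written as products.
      well-poised-∼ : ∀ k l → k ℕ.+ l ≡ m → norm * (1# - x) * well-poised k l ∼ kernel k
      well-poised-∼ zero    l ≡.refl = ≈⇒∼ (trans norm-base (solve 0 (:1 := :1 :* :1 :* :1 :* (:1 :* :1) :* (:1 :* :1)) refl))
      well-poised-∼ (suc k) l k+l≡m = ∼-trans (≈⇒∼ (begin
          norm * (1# - x) * well-poised (suc k) l                   ≈⟨ *-congˡ (well-poised-suc k l) ⟩
          norm * (1# - x) * (ratio* k l * well-poised k (suc l))
            ≈⟨ solve 3 (λ u v w → u :* (v :* w) := v :* (u :* w)) refl _ _ _ ⟩
          ratio* k l * (norm * (1# - x) * well-poised k (suc l))    ∎))
        (∼-trans (∼-* Loc-ratio (Loc-kernel k k<n) (ratio-∼ k l k+1+l≡m) (well-poised-∼ k (suc l) k+1+l≡m))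
                 (≈⇒∼ (sym (kernel-suc k))))
        where
        k+1+l≡m = ≡.trans (ℕₚ.+-suc k l) k+l≡m
        k<m : k ℕ.< m
        k<m = ℕₚ.≤-trans (ℕₚ.m≤m+n (suc k) l) (ℕₚ.≤-reflexive k+l≡m)
        k<n = ℕₚ.<-trans k<m m<n
        lip = Loc-ip k (ℕₚ.≤-<-trans k<m m<n)
        Loc-ratio : Loc (ratio k)
        Loc-ratio = Loc-neg (Loc-* (Loc-* (Loc-* (Loc-^ k Loc-p) Loc-e)
          (Loc-* (Loc-factor k Loc-a) (Loc-factor k Loc-a))) (Loc-* lip lip))

      transformed-kernel : ℕ → ℕ → Carrier
      transformed-kernel j r = norm * ((- a) ^ r * p^tri r * pochhammer (a * a) (ix j r) * (prod r ip * prod j ip * prod j ia))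

    private
      limit-ratio : ℕ → Carrier
      limit-ratio j = f * (factor a j * ip j)

      Loc-limit-ratio : ∀ j → j ℕ.< m → Loc (limit-ratio j)
      Loc-limit-ratio j j<m = Loc-* Loc-f (Loc-* (Loc-factor j Loc-a) (Loc-ip j (ℕₚ.≤-<-trans j<m m<n)))

      Loc-ips : ∀ k → k ℕ.≤ m → Loc (prod k ip)
      Loc-ips k k≤m = Loc-prod k (λ i i<k → Loc-ip i (ℕₚ.≤-<-trans (ℕₚ.<-≤-trans i<k k≤m) m<n))

      Loc-limit-kernel : ∀ j → j ℕ.≤ m → Loc (limit-kernel j)
      Loc-limit-kernel j j≤m = Loc-* (Loc-* (Loc-^ m (Loc-neg Loc-a)) (Loc-tri m))
        (Loc-* (Loc-^ j Loc-f) (Loc-* (Loc-pochhammer j Loc-a) (Loc-ips j j≤m)))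

      Loc-transformed-kernel : ∀ j r → j ℕ.≤ m → r ℕ.≤ m → Loc (transformed-kernel j r)
      Loc-transformed-kernel j r j≤m r≤m = Loc-*
        (Loc-* (Loc-pochhammer m Loc-p) (Loc-prod m Loc-ia²))
        (Loc-* (Loc-* (Loc-* (Loc-^ r (Loc-neg Loc-a)) (Loc-tri r)) (Loc-pochhammer (ix j r) (Loc-* Loc-a Loc-a)))
          (Loc-* (Loc-* (Loc-ips r r≤m) (Loc-ips j j≤m)) (Loc-prod j (λ i i<j → Loc-ia i (ℕₚ.<-≤-trans i<j j≤m)))))

      limit-suc : ∀ j → limit-kernel (suc j) ≈ limit-ratio j * limit-kernel j
      limit-suc j = solve 7 (λ C f F g A i I → C :* (f :* F :* (A :* g :* (I :* i))) := (f :* (g :* i)) :* (C :* (F :* (A :* I))))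
        refl _ _ _ _ _ _ _

      -- x is invertible modulo μ with inverse 2 - x, so a and p may be cancelled.
      transformed-step : ∀ j r → j ℕ.+ suc r ≡ m →
        transformed-kernel (suc j) r ∼ limit-ratio j * transformed-kernel j (suc r)
      transformed-step j r j+r+1≡m = δ , Loc-δ , (begin
        Δ                                  ≈⟨ solve 2 (λ x D → D := x :* (con (+ 2) :- x) :* D :+ (:1 :- x) :* (:1 :- x) :* D) refl x Δ ⟩
        x * (two - x) * Δ + μ * Δ          ≈⟨ +-congʳ (*-congʳ (*-congʳ x≈x′)) ⟩
        x′ * (two - x) * Δ + μ * Δ
          ≈⟨ solve 7 (λ a s p w y D M → (a :* (s :* (p :* w))) :* y :* D :+ M := p :* s :* y :* (a :* w :* D) :+ M)
               refl a s p w _ _ _ ⟩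
        p * s * (two - x) * (a * w * Δ) + μ * Δ
          ≈⟨ +-congʳ (*-congˡ awΔ) ⟩
        p * s * (two - x) * (- (μ * (t * v * Go))) + μ * Δ
          ≈⟨ solve 4 (λ c M z D → c :* (:- (M :* z)) :+ M :* D := M :* (D :- c :* z)) refl _ _ _ _ ⟩
        μ * δ ∎)
        where
        s w t v x′ u two Gn Go Δ δ : Carrier
        s = p ^ j
        w = p ^ r
        t = ip j
        v = ia j
        u = factor a j
        x′ = a * (s * (p * w))
        two = 1# + 1#
        Gn = transformed-kernel (suc j) r
        Go = transformed-kernel j (suc r)
        Δ = Gn - limit-ratio j * Go
        δ = Δ - p * s * (two - x) * (t * v * Go)
        x≈x′ : x ≈ x′
        x≈x′ = *-congˡ (trans (^-congʳ p (≡.sym j+r+1≡m)) (^-homo-* p j (suc r)))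
        aa-factor : factor (a * a) (suc (ix j r)) ≈ 1# - a * s * x′
        aa-factor = +-congˡ (-‿cong (trans (*-congˡ (*-congˡ (p^ix j r)))
          (solve 4 (λ a p s w → a :* a :* (p :* (s :* s :* w)) := a :* s :* (a :* (s :* (p :* w)))) refl _ _ _ _)))
        Gn-Go : a * w * Gn ≈ - ((1# - p * w) * (1# - a * s * x′) * t * v * Go)
        Gn-Go = begin
          a * w * Gn ≈⟨ trans (*-congˡ (ip-inv r)) (*-identityʳ _) ⟨
          a * w * Gn * (factor p r * ip r)
            ≈⟨ solve 15 (λ a w N A T P h h′ J K t L v y i →
                 a :* w :* (N :* (A :* T :* (P :* h :* h′) :* (J :* (K :* t) :* (L :* v)))) :* (y :* i) :=
                 :- (y :* h′ :* t :* v :* (N :* ((:- a :* A) :* (T :* w) :* (P :* h) :* (J :* i :* K :* L)))))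
                 refl a w _ _ _ _ (factor (a * a) (ix j r)) _ _ _ _ _ _ _ _ ⟩
          - ((1# - p * w) * factor (a * a) (suc (ix j r)) * t * v *
             (norm * ((- a) ^ suc r * p^tri (suc r) * (pochhammer (a * a) (suc (ix j r))) * (prod (suc r) ip * prod j ip * prod j ia))))
            ≈⟨ -‿cong (*-cong (*-congʳ (*-congʳ (*-congˡ aa-factor)))
                 (*-congˡ (*-congʳ (*-congˡ (reflexive (≡.cong (pochhammer (a * a)) (≡.sym (ix-suc j r)))))))) ⟩
          _ ∎
        awΔ : a * w * Δ ≈ - (μ * (t * v * Go))
        awΔ = begin
          a * w * (Gn - f * (u * t) * Go)
            ≈⟨ solve 7 (λ a w G f u t H → a :* w :* (G :- f :* (u :* t) :* H) := a :* w :* G :- (a :* f) :* (w :* (u :* t)) :* H)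
                 refl a w Gn f u t Go ⟩
          a * w * Gn - (a * f) * (w * (u * t)) * Go
            ≈⟨ +-cong Gn-Go (-‿cong (*-congʳ (*-congʳ af≈p))) ⟩
          - ((1# - p * w) * (1# - a * s * x′) * t * v * Go) - p * (w * (u * t)) * Go
            ≈⟨ +-congˡ (trans (-‿cong (*-congˡ (ia-inv j))) (-‿cong (*-identityʳ _))) ⟨
          - ((1# - p * w) * (1# - a * s * x′) * t * v * Go) - p * (w * (u * t)) * Go * (factor a j * v)
            -- The identity behind this is (1 - pw)(1 - asx) + pw(1 - as)² = (1 - x)² for x = aspw.
            ≈⟨ solve 7 (λ a p s w t v H →
                 :- ((:1 :- p :* w) :* (:1 :- a :* s :* (a :* (s :* (p :* w)))) :* t :* v :* H)
                   :- p :* (w :* ((:1 :- a :* s) :* t)) :* H :* ((:1 :- a :* s) :* v) :=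
                 :- ((:1 :- a :* (s :* (p :* w))) :* (:1 :- a :* (s :* (p :* w))) :* (t :* v :* H)))
                 refl a p s w t v Go ⟩
          - ((1# - x′) * (1# - x′) * (t * v * Go))
            ≈⟨ -‿cong (*-congʳ (*-cong 1-x′ 1-x′)) ⟩
          - (μ * (t * v * Go)) ∎
          where
          1-x′ : 1# - x′ ≈ 1# - x
          1-x′ = +-congˡ (-‿cong (sym x≈x′))
        j<m : j ℕ.< m
        j<m = ℕₚ.≤-trans (ℕₚ.m≤m+n (suc j) r) (ℕₚ.≤-reflexive (≡.trans (≡.sym (ℕₚ.+-suc j r)) j+r+1≡m))
        r<m : r ℕ.< m
        r<m = ℕₚ.≤-trans (ℕₚ.m≤n+m (suc r) j) (ℕₚ.≤-reflexive j+r+1≡m)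
        Loc-Go : Loc Go
        Loc-Go = Loc-transformed-kernel j (suc r) (ℕₚ.<⇒≤ j<m) r<m
        Loc-δ : Loc δ
        Loc-δ = Loc-sub
          (Loc-sub (Loc-transformed-kernel (suc j) r j<m (ℕₚ.<⇒≤ r<m)) (Loc-* (Loc-limit-ratio j j<m) Loc-Go))
          (Loc-* (Loc-* (Loc-* Loc-p (Loc-^ j Loc-p)) (Loc-sub (Loc-+ Loc-1# Loc-1#) (Loc-* Loc-a (Loc-^ m Loc-p))))
                 (Loc-* (Loc-* (Loc-ip j (ℕₚ.≤-<-trans j<m m<n)) (Loc-ia j j<m)) Loc-Go))

      transformed-∼ : ∀ j r → j ℕ.+ r ≡ m → transformed-kernel j r ∼ limit-kernel j
      transformed-∼ zero    r ≡.refl = ≈⇒∼ (begin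
        transformed-kernel 0 m
          ≈⟨ solve 6 (λ P I A T A² J → P :* I :* (A :* T :* A² :* (J :* :1 :* :1)) :=
               (P :* J) :* (A² :* I) :* (A :* T :* (:1 :* (:1 :* :1)))) refl _ _ _ _ _ _ ⟩
        (pochhammer p m * prod m ip) * (pochhammer (a * a) m * prod m ia²) * limit-kernel 0
          ≈⟨ *-congʳ (*-cong (prod-inverse m ip-inv) (prod-inverse m ia²-inv)) ⟩
        1# * 1# * limit-kernel 0  ≈⟨ trans (*-congʳ (*-identityˡ 1#)) (*-identityˡ _) ⟩
        limit-kernel 0            ∎)
      transformed-∼ (suc j) r j+r≡m = ∼-trans (transformed-step j r j+1+r≡m)
        (∼-trans (∼-*ˡ (Loc-limit-ratio j j<m) (transformed-∼ j (suc r) j+1+r≡m)) (≈⇒∼ (sym (limit-suc j))))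
        where
        j+1+r≡m = ≡.trans (ℕₚ.+-suc j r) j+r≡m
        j<m : j ℕ.< m
        j<m = ℕₚ.≤-trans (ℕₚ.m≤m+n (suc j) r) (ℕₚ.≤-reflexive j+r≡m)

    single-sum : sum (suc m) summand ∼ sum (suc m) limit
    single-sum = ∼-trans (≈⇒∼ (sym (conv≈sum m summand))) (∼-trans (∼-sym (∼-conv m perturb))
      (∼-trans (≈⇒∼ exact) (∼-trans (∼-conv m unperturb) (≈⇒∼ (conv≈sum m limit)))))
      where
      C : Carrier
      -- The same factor 1 - x serves both sides: it cancels `ia m` in the original series and
      -- controls the pole of `ib j` in the transformed one.
      C = iβ * (norm * (1# - x))
      perturb : ∀ k l → k ℕ.+ l ≡ m → C * ((1# + b * p ^ k) * well-poised k l) ∼ summand k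
      perturb k l k+l≡m = ∼-trans
        (≈⇒∼ (solve 4 (λ i N y W → (i :* N) :* (y :* W) := (y :* i) :* (N :* W)) refl _ _ _ _))
        (∼-*ˡ (Loc-prefactor k) (well-poised-∼ k l k+l≡m))
      exact : conv m (λ k l → C * ((1# + b * p ^ k) * well-poised k l)) ≈ conv m (λ j r → C * transformed j r)
      exact = begin
        conv m (λ k l → C * ((1# + b * p ^ k) * well-poised k l))   ≈⟨ conv-*ˡ m C _ ⟨
        C * conv m (λ k l → (1# + b * p ^ k) * well-poised k l)     ≈⟨ *-congˡ (transformation m) ⟩
        C * conv m transformed                                      ≈⟨ conv-*ˡ m C _ ⟩
        conv m (λ j r → C * transformed j r)                        ∎
      unperturb : ∀ j r → j ℕ.+ r ≡ m → C * transformed j r ∼ limit j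
      unperturb j r j+r≡m = ∼-trans
        (≈⇒∼ (solve 5 (λ i N y W z → (i :* (N :* y)) :* (W :* z) := (i :* (y :* z)) :* (N :* W)) refl _ _ _ _ _))
        (∼-*ˡ (Loc-* Loc-iβ (Loc-ib j (ℕₚ.≤-trans (ℕₚ.m≤m+n j r) (ℕₚ.≤-reflexive j+r≡m)))) (transformed-∼ j r j+r≡m))

    module _ (3m<n : m ℕ.+ m ℕ.+ m ℕ.< n) where
      open TripleSum summand n m 3m<n Loc-summand summand∼0

      triple-sum : tripleSum n summand ∼ sum (suc m) limit * sum (suc m) limit * sum (suc m) limit
      triple-sum = ∼-trans tripleSum∼ (∼-* (Loc-* lS lS) lS (∼-* lS lS single-sum single-sum) single-sum)
        where
        lS : Loc (sum (suc m) limit)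
        lS = Loc-sum (suc m) (λ j j<1+m →
          Loc-* (Loc-* Loc-iβ (Loc-ib j (ℕₚ.≤-pred j<1+m))) (Loc-limit-kernel j (ℕₚ.≤-pred j<1+m)))

-- The commutative ring of integer polynomials.

module Polynomials where
  open Sums ℤₚ.+-*-commutativeRing
  open IntegerCoefficients ℤₚ.+-*-commutativeRing
  open Solver

  coef : Poly → ℕ → ℤ
  coef []      i       = + 0
  coef (a ∷ f) zero    = a
  coef (a ∷ f) (suc i) = coef f i

  infix 4 _≋_

  record _≋_ (f g : Poly) : Set where
    constructor coefficientwise
    field at : ∀ i → coef f i ≡ coef g i
  open _≋_ public

  coef-⊕ : ∀ f g i → coef (f ⊕ g) i ≡ coef f i ℤ.+ coef g i
  coef-⊕ []      g       i       = ≡.sym (ℤₚ.+-identityˡ _)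
  coef-⊕ (a ∷ f) []      i       = ≡.sym (ℤₚ.+-identityʳ _)
  coef-⊕ (a ∷ f) (b ∷ g) zero    = ≡.refl
  coef-⊕ (a ∷ f) (b ∷ g) (suc i) = coef-⊕ f g i

  coef-scale : ∀ c f i → coef (scale c f) i ≡ c ℤ.* coef f i
  coef-scale c []      i       = ≡.sym (ℤₚ.*-zeroʳ c)
  coef-scale c (a ∷ f) zero    = ≡.refl
  coef-scale c (a ∷ f) (suc i) = coef-scale c f i

  coef-neg : ∀ f i → coef (neg f) i ≡ ℤ.- coef f i
  coef-neg f i = ≡.trans (coef-scale ℤ.-1ℤ f i) (ℤₚ.-1*i≡-i (coef f i))

  coef-⊖ : ∀ f g i → coef (f ⊖ g) i ≡ coef f i ℤ.- coef g i
  coef-⊖ f g i = ≡.trans (coef-⊕ f (neg g) i) (≡.cong (ℤ._+_ (coef f i)) (coef-neg g i))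

  private
    conv-0 : ∀ n (g : ℕ → ℤ) → conv n (λ _ k → + 0 ℤ.* g k) ≡ + 0
    conv-0 zero    g = ≡.refl
    conv-0 (suc n) g = ≡.trans (≡.cong₂ ℤ._+_ {v = + 0} (ℤₚ.*-zeroˡ (g (suc n))) (conv-0 n g)) ≡.refl

    conv-flip : ∀ n f → conv n f ≡ conv n (λ i j → f j i)
    conv-flip zero    f = ≡.refl
    conv-flip (suc n) f = ≡.trans (≡.cong (ℤ._+_ (f 0 (suc n))) (conv-flip n (λ i j → f (suc i) j)))
      (≡.trans (ℤₚ.+-comm (f 0 (suc n)) _) (≡.sym (conv-snoc n (λ i j → f j i))))

  -- Multiplication of lists becomes the Cauchy product, so the ring laws reduce to properties of
  -- `conv`.
  coef-⊗ : ∀ f g i → coef (f ⊗ g) i ≡ conv i (λ j k → coef f j ℤ.* coef g k)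
  coef-⊗ []      g i       = ≡.sym (conv-0 i (coef g))
  coef-⊗ (a ∷ f) g zero    = ≡.trans (coef-⊕ (scale a g) _ 0)
    (≡.trans (ℤₚ.+-identityʳ _) (coef-scale a g 0))
  coef-⊗ (a ∷ f) g (suc i) = ≡.trans (coef-⊕ (scale a g) _ (suc i))
    (≡.cong₂ ℤ._+_ (coef-scale a g (suc i)) (coef-⊗ f g i))

  ≋⇒≈P : ∀ {f g} → f ≋ g → f ≈P g
  ≋⇒≈P {f} {g} f≋g = zeros (f ⊖ g) λ i → ≡.trans (coef-⊖ f g i) (ℤₚ.i≡j⇒i-j≡0 (at f≋g i))
    where
    zeros : ∀ h → (∀ i → coef h i ≡ + 0) → All (λ c → c ≡ + 0) h
    zeros []      e = []
    zeros (a ∷ h) e = e 0 ∷ zeros h (λ i → e (suc i))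

  private
    ≋-isEquivalence : IsEquivalence _≋_
    ≋-isEquivalence = record
      { refl  = coefficientwise λ i → ≡.refl
      ; sym   = λ f≋g → coefficientwise λ i → ≡.sym (at f≋g i)
      ; trans = λ f≋g g≋h → coefficientwise λ i → ≡.trans (at f≋g i) (at g≋h i)
      }

    ⊕-cong : ∀ {f f′ g g′} → f ≋ f′ → g ≋ g′ → f ⊕ g ≋ f′ ⊕ g′
    ⊕-cong {f} {f′} {g} {g′} e e′ = coefficientwise λ i → ≡.trans (coef-⊕ f g i)
      (≡.trans (≡.cong₂ ℤ._+_ (at e i) (at e′ i)) (≡.sym (coef-⊕ f′ g′ i)))

    neg-cong : ∀ {f g} → f ≋ g → neg f ≋ neg g
    neg-cong {f} {g} e = coefficientwise λ i → ≡.trans (coef-neg f i)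
      (≡.trans (≡.cong ℤ.-_ (at e i)) (≡.sym (coef-neg g i)))

    ⊗-cong : ∀ {f f′ g g′} → f ≋ f′ → g ≋ g′ → f ⊗ g ≋ f′ ⊗ g′
    ⊗-cong {f} {f′} {g} {g′} e e′ = coefficientwise λ i → ≡.trans (coef-⊗ f g i)
      (≡.trans (conv-cong i (λ j k _ → ≡.cong₂ ℤ._*_ (at e j) (at e′ k))) (≡.sym (coef-⊗ f′ g′ i)))

    ⊕-assoc : ∀ f g h → (f ⊕ g) ⊕ h ≋ f ⊕ (g ⊕ h)
    ⊕-assoc f g h = coefficientwise λ i → begin
      coef ((f ⊕ g) ⊕ h) i                     ≡⟨ coef-⊕ (f ⊕ g) h i ⟩
      coef (f ⊕ g) i ℤ.+ coef h i              ≡⟨ ≡.cong (ℤ._+ coef h i) (coef-⊕ f g i) ⟩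
      coef f i ℤ.+ coef g i ℤ.+ coef h i       ≡⟨ ℤₚ.+-assoc (coef f i) _ _ ⟩
      coef f i ℤ.+ (coef g i ℤ.+ coef h i)     ≡⟨ ≡.cong (ℤ._+_ (coef f i)) (coef-⊕ g h i) ⟨
      coef f i ℤ.+ coef (g ⊕ h) i              ≡⟨ coef-⊕ f (g ⊕ h) i ⟨
      coef (f ⊕ (g ⊕ h)) i                     ∎
      where open ≡.≡-Reasoning

    ⊕-comm : ∀ f g → f ⊕ g ≋ g ⊕ f
    ⊕-comm f g = coefficientwise λ i → ≡.trans (coef-⊕ f g i)
      (≡.trans (ℤₚ.+-comm (coef f i) _) (≡.sym (coef-⊕ g f i)))

    ⊕-identityʳ : ∀ f → f ⊕ [] ≋ f
    ⊕-identityʳ f = coefficientwise λ i → ≡.trans (coef-⊕ f [] i) (ℤₚ.+-identityʳ _)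

    neg-inverseʳ : ∀ f → f ⊕ neg f ≋ []
    neg-inverseʳ f = coefficientwise λ i → ≡.trans (coef-⊖ f f i) (ℤₚ.+-inverseʳ (coef f i))

    ⊗-assoc : ∀ f g h → (f ⊗ g) ⊗ h ≋ f ⊗ (g ⊗ h)
    ⊗-assoc f g h = coefficientwise λ i → begin
      coef ((f ⊗ g) ⊗ h) i
        ≡⟨ coef-⊗ (f ⊗ g) h i ⟩
      conv i (λ k l → coef (f ⊗ g) k ℤ.* coef h l)
        ≡⟨ conv-cong i (λ k l _ → ≡.trans (≡.cong (ℤ._* coef h l) (coef-⊗ f g k))
             (≡.trans (ℤₚ.*-comm (conv k _) (coef h l)) (≡.trans (conv-*ˡ k (coef h l) _)
               (conv-cong k (λ j r _ → solve 3 (λ x y z → x :* (y :* z) := y :* (z :* x)) ≡.refl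
                 (coef h l) (coef f j) (coef g r)))))) ⟩
      conv i (λ k l → conv k (λ j r → coef f j ℤ.* (coef g r ℤ.* coef h l)))
        ≡⟨ conv-assoc i (λ j r l → coef f j ℤ.* (coef g r ℤ.* coef h l)) ⟩
      conv i (λ j k → conv k (λ r l → coef f j ℤ.* (coef g r ℤ.* coef h l)))
        ≡⟨ conv-cong i (λ j k _ → ≡.trans (≡.cong (ℤ._*_ (coef f j)) (coef-⊗ g h k)) (conv-*ˡ k (coef f j) _)) ⟨
      conv i (λ j k → coef f j ℤ.* coef (g ⊗ h) k)
        ≡⟨ coef-⊗ f (g ⊗ h) i ⟨
      coef (f ⊗ (g ⊗ h)) i ∎
      where open ≡.≡-Reasoning

    ⊗-comm : ∀ f g → f ⊗ g ≋ g ⊗ f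
    ⊗-comm f g = coefficientwise λ i → ≡.trans (coef-⊗ f g i) (≡.trans (conv-flip i _)
      (≡.trans (conv-cong i (λ j k _ → ℤₚ.*-comm (coef f k) (coef g j))) (≡.sym (coef-⊗ g f i))))

    ⊗-identityˡ : ∀ f → one ⊗ f ≋ f
    ⊗-identityˡ f = coefficientwise λ
      { zero    → ≡.trans (coef-⊗ one f 0) (ℤₚ.*-identityˡ (coef f 0))
      ; (suc i) → ≡.trans (coef-⊗ one f (suc i))
          (≡.trans (≡.cong₂ ℤ._+_ (ℤₚ.*-identityˡ (coef f (suc i))) (conv-0 i (coef f))) (ℤₚ.+-identityʳ _)) }

    ⊗-distribʳ : ∀ h f g → (f ⊕ g) ⊗ h ≋ f ⊗ h ⊕ g ⊗ h
    ⊗-distribʳ h f g = coefficientwise λ i → begin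
      coef ((f ⊕ g) ⊗ h) i
        ≡⟨ coef-⊗ (f ⊕ g) h i ⟩
      conv i (λ j k → coef (f ⊕ g) j ℤ.* coef h k)
        ≡⟨ conv-cong i (λ j k _ → ≡.trans (≡.cong (ℤ._* coef h k) (coef-⊕ f g j))
             (ℤₚ.*-distribʳ-+ (coef h k) (coef f j) (coef g j))) ⟩
      conv i (λ j k → coef f j ℤ.* coef h k ℤ.+ coef g j ℤ.* coef h k)
        ≡⟨ conv-+ i _ _ ⟩
      conv i (λ j k → coef f j ℤ.* coef h k) ℤ.+ conv i (λ j k → coef g j ℤ.* coef h k)
        ≡⟨ ≡.cong₂ ℤ._+_ (coef-⊗ f h i) (coef-⊗ g h i) ⟨
      coef (f ⊗ h) i ℤ.+ coef (g ⊗ h) i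
        ≡⟨ coef-⊕ (f ⊗ h) (g ⊗ h) i ⟨
      coef (f ⊗ h ⊕ g ⊗ h) i ∎
      where open ≡.≡-Reasoning

    module E = IsEquivalence ≋-isEquivalence

  polyRing : CommutativeRing 0ℓ 0ℓ
  polyRing = record
    { Carrier = Poly
    ; _≈_     = _≋_
    ; _+_     = _⊕_
    ; _*_     = _⊗_
    ; -_      = neg
    ; 0#      = []
    ; 1#      = one
    ; isCommutativeRing = record
      { isRing = record
        { +-isAbelianGroup = record
          { isGroup = record
            { isMonoid = record
              { isSemigroup = record
                { isMagma = record { isEquivalence = ≋-isEquivalence ; ∙-cong = ⊕-cong }
                ; assoc   = ⊕-assoc
                }
              ; identity = (λ f → E.refl) , ⊕-identityʳ
              }
            ; inverse = (λ f → E.trans (⊕-comm (neg f) f) (neg-inverseʳ f)) , neg-inverseʳ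
            ; ⁻¹-cong = neg-cong
            }
          ; comm = ⊕-comm
          }
        ; *-cong     = ⊗-cong
        ; *-assoc    = ⊗-assoc
        ; *-identity = ⊗-identityˡ , (λ f → E.trans (⊗-comm f one) (⊗-identityˡ f))
        ; distrib    = (λ h f g → E.trans (⊗-comm h (f ⊕ g)) (E.trans (⊗-distribʳ h f g)
                           (⊕-cong (⊗-comm f h) (⊗-comm g h)))) , ⊗-distribʳ
        }
      ; *-comm = ⊗-comm
      }
    }

  -- Induction on the lowest nonvanishing coefficient of f.
  ⊗-regular : ∀ {g f} → coef g 0 ≢ + 0 → g ⊗ f ≋ [] → f ≋ []
  ⊗-regular {g} {f} g₀≢0 gf≋0 = coefficientwise λ i → upTo (suc i) i ℕₚ.≤-refl
    where
    conv-below : ∀ i (h : ℕ → ℤ) → (∀ k → k ℕ.< suc i → coef f k ≡ + 0) →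
      conv i (λ j k → h j ℤ.* coef f k) ≡ + 0
    conv-below i h f≡0 = ≡.trans
      (conv-cong i (λ j k j+k≡i → ≡.trans (≡.cong (ℤ._*_ (h j))
        (f≡0 k (s≤s (ℕₚ.≤-trans (ℕₚ.m≤n+m k j) (ℕₚ.≤-reflexive j+k≡i))))) (≡.trans (ℤₚ.*-zeroʳ (h j)) (≡.sym (ℤₚ.*-zeroˡ (h k))))))
      (conv-0 i h)
    cancel : ∀ y → coef g 0 ℤ.* y ≡ + 0 → y ≡ + 0
    cancel y e with ℤₚ.i*j≡0⇒i≡0∨j≡0 (coef g 0) e
    ... | inj₁ g₀≡0 with () ← g₀≢0 g₀≡0
    ... | inj₂ y≡0 = y≡0
    next : ∀ i → (∀ k → k ℕ.< i → coef f k ≡ + 0) → coef f i ≡ + 0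
    next zero    f≡0 = cancel _ (≡.trans (≡.sym (coef-⊗ g f 0)) (at gf≋0 0))
    next (suc i) f≡0 = cancel _ (begin
      coef g 0 ℤ.* coef f (suc i)
        ≡⟨ ≡.trans (≡.cong (ℤ._+_ (coef g 0 ℤ.* coef f (suc i))) (conv-below i (λ j → coef g (suc j)) f≡0)) (ℤₚ.+-identityʳ _) ⟨
      conv (suc i) (λ j k → coef g j ℤ.* coef f k)  ≡⟨ coef-⊗ g f (suc i) ⟨
      coef (g ⊗ f) (suc i)                          ≡⟨ at gf≋0 (suc i) ⟩
      + 0 ∎)
      where open ≡.≡-Reasoning
    upTo : ∀ n i → i ℕ.< n → coef f i ≡ + 0
    upTo (suc n) i i<1+n with ℕₚ.m≤n⇒m<n∨m≡n (ℕₚ.≤-pred i<1+n)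
    ... | inj₁ i<n    = upTo n i i<n
    ... | inj₂ ≡.refl = next i (upTo n)

-- Localisation at a multiplicative set of cancellable elements.

module Localization {c ℓ s} (R : CommutativeRing c ℓ) (Regular : CommutativeRing.Carrier R → Set s)
  (regular-1# : Regular (CommutativeRing.1# R))
  (regular-* : ∀ {g h} → Regular g → Regular h → Regular (CommutativeRing._*_ R g h))
  (regular-cancel : ∀ {g f} → Regular g →
    CommutativeRing._≈_ R (CommutativeRing._*_ R g f) (CommutativeRing.0# R) →
    CommutativeRing._≈_ R f (CommutativeRing.0# R))
  where
  open CommutativeRing R
  open import Relation.Binary.Reasoning.Setoid setoid
  open IntegerCoefficients R
  open Solver

  record Fraction : Set (c ⊔ s) where
    constructor fraction
    field
      num         : Carrier
      den         : Carrier
      den-regular : Regular den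
  open Fraction public

  infix 4 _≃_

  record _≃_ (x y : Fraction) : Set ℓ where
    constructor cross
    field uncross : num x * den y ≈ num y * den x
  open _≃_ public

  private
    _+′_ _*′_ : Fraction → Fraction → Fraction
    fraction a b rb +′ fraction c e re = fraction (a * e + c * b) (b * e) (regular-* rb re)
    fraction a b rb *′ fraction c e re = fraction (a * c) (b * e) (regular-* rb re)

    -′_ : Fraction → Fraction
    -′ fraction a b rb = fraction (- a) b rb

    ≃-trans : ∀ {x y z} → x ≃ y → y ≃ z → x ≃ z
    ≃-trans {fraction a b _} {fraction c d rd} {fraction e f _} (cross ad≈cb) (cross cf≈ed) = cross (begin
      a * f            ≈⟨ solve 2 (λ x y → x := (x :- y) :+ y) refl _ (e * b) ⟩
      -- Cross-multiplication is transitive only because the middle denominator d can be cancelled.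
      (a * f - e * b) + e * b ≈⟨ +-congʳ (regular-cancel rd (begin
        d * (a * f - e * b)
          ≈⟨ solve 6 (λ a b c d e f → d :* (a :* f :- e :* b) :=
               (a :* d) :* f :- (e :* d) :* b) refl a b c d e f ⟩
        (a * d) * f - (e * d) * b  ≈⟨ +-cong (*-congʳ ad≈cb) (-‿cong (*-congʳ (sym cf≈ed))) ⟩
        (c * b) * f - (c * f) * b
          ≈⟨ solve 3 (λ c b f → (c :* b) :* f :- (c :* f) :* b := :0) refl c b f ⟩
        0# ∎)) ⟩
      0# + e * b       ≈⟨ +-identityˡ _ ⟩
      e * b            ∎)

    +′-cong : ∀ {x x′ y y′} → x ≃ x′ → y ≃ y′ → (x +′ y) ≃ (x′ +′ y′)
    +′-cong {fraction a b _} {fraction a′ b′ _} {fraction c e _} {fraction c′ e′ _} (cross p) (cross q) = cross (begin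
      (a * e + c * b) * (b′ * e′)
        ≈⟨ solve 6 (λ a b c e b′ e′ → (a :* e :+ c :* b) :* (b′ :* e′) :=
             (a :* b′) :* (e :* e′) :+ (c :* e′) :* (b :* b′)) refl a b c e b′ e′ ⟩
      (a * b′) * (e * e′) + (c * e′) * (b * b′)
        ≈⟨ +-cong (*-congʳ p) (*-congʳ q) ⟩
      (a′ * b) * (e * e′) + (c′ * e) * (b * b′)
        ≈⟨ solve 6 (λ a′ b c′ e b′ e′ → (a′ :* b) :* (e :* e′) :+ (c′ :* e) :* (b :* b′) :=
             (a′ :* e′ :+ c′ :* b′) :* (b :* e)) refl a′ b c′ e b′ e′ ⟩
      (a′ * e′ + c′ * b′) * (b * e) ∎)

    *′-cong : ∀ {x x′ y y′} → x ≃ x′ → y ≃ y′ → (x *′ y) ≃ (x′ *′ y′)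
    *′-cong {fraction a b _} {fraction a′ b′ _} {fraction c e _} {fraction c′ e′ _} (cross p) (cross q) = cross (begin
      (a * c) * (b′ * e′)
        ≈⟨ solve 4 (λ a c b e → (a :* c) :* (b :* e) := (a :* b) :* (c :* e)) refl _ _ _ _ ⟩
      (a * b′) * (c * e′)  ≈⟨ *-cong p q ⟩
      (a′ * b) * (c′ * e)
        ≈⟨ solve 4 (λ a c b e → (a :* c) :* (b :* e) := (a :* b) :* (c :* e)) refl _ _ _ _ ⟩
      (a′ * c′) * (b * e)  ∎)

  localization : CommutativeRing (c ⊔ s) ℓ
  localization = record
    { Carrier = Fraction
    ; _≈_     = _≃_
    ; _+_     = _+′_
    ; _*_     = _*′_
    ; -_      = -′_
    ; 0#      = fraction 0# 1# regular-1#
    ; 1#      = fraction 1# 1# regular-1#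
    ; isCommutativeRing = record
      { isRing = record
        { +-isAbelianGroup = record
          { isGroup = record
            { isMonoid = record
              { isSemigroup = record
                { isMagma = record
                  { isEquivalence = record
                    { refl  = cross refl
                    ; sym   = λ e → cross (sym (uncross e))
                    ; trans = ≃-trans
                    }
                  ; ∙-cong = +′-cong
                  }
                ; assoc = λ { (fraction a b _) (fraction c e _) (fraction f g _) → cross
                    (solve 6 (λ a b c e f g →
                      ((a :* e :+ c :* b) :* g :+ f :* (b :* e)) :* (b :* (e :* g)) :=
                      (a :* (e :* g) :+ (c :* g :+ f :* e) :* b) :* (b :* e :* g)) refl a b c e f g) }
                }
              ; identity = (λ { (fraction a b _) → cross
                    (solve 2 (λ a b → (:0 :* b :+ a :* :1) :* b := a :* (:1 :* b)) refl a b) })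
                , (λ { (fraction a b _) → cross
                    (solve 2 (λ a b → (a :* :1 :+ :0 :* b) :* b := a :* (b :* :1)) refl a b) })
              }
            ; inverse = (λ { (fraction a b _) → cross
                    (solve 2 (λ a b → ((:- a) :* b :+ a :* b) :* :1 := :0 :* (b :* b)) refl a b) })
                , (λ { (fraction a b _) → cross
                    (solve 2 (λ a b → (a :* b :+ (:- a) :* b) :* :1 := :0 :* (b :* b)) refl a b) })
            ; ⁻¹-cong = λ { {fraction a b _} {fraction c e _} (cross p) → cross (begin
                - a * e    ≈⟨ solve 2 (λ a e → (:- a) :* e := :- (a :* e)) refl a e ⟩
                - (a * e)  ≈⟨ -‿cong p ⟩
                - (c * b)  ≈⟨ solve 2 (λ a e → (:- a) :* e := :- (a :* e)) refl c b ⟨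
                - c * b    ∎) }
            }
          ; comm = λ { (fraction a b _) (fraction c e _) → cross
              (solve 4 (λ a b c e → (a :* e :+ c :* b) :* (e :* b) := (c :* b :+ a :* e) :* (b :* e)) refl a b c e) }
          }
        ; *-cong = *′-cong
        ; *-assoc = λ { (fraction a b _) (fraction c e _) (fraction f g _) → cross
            (solve 6 (λ a b c e f g → (a :* c :* f) :* (b :* (e :* g)) := (a :* (c :* f)) :* (b :* e :* g)) refl a b c e f g) }
        ; *-identity = (λ { (fraction a b _) → cross
              (solve 2 (λ a b → (:1 :* a) :* b := a :* (:1 :* b)) refl a b) })
            , (λ { (fraction a b _) → cross
              (solve 2 (λ a b → (a :* :1) :* b := a :* (b :* :1)) refl a b) })
        ; distrib = (λ { (fraction a b _) (fraction c e _) (fraction f g _) → cross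
              (solve 6 (λ a b c e f g →
                (a :* (c :* g :+ f :* e)) :* (b :* e :* (b :* g)) :=
                (a :* c :* (b :* g) :+ a :* f :* (b :* e)) :* (b :* (e :* g))) refl a b c e f g) })
            , (λ { (fraction a b _) (fraction c e _) (fraction f g _) → cross
              (solve 6 (λ a b c e f g →
                ((c :* g :+ f :* e) :* a) :* (e :* b :* (g :* b)) :=
                (c :* a :* (g :* b) :+ f :* a :* (e :* b)) :* (e :* g :* b)) refl a b c e f g) })
        }
      ; *-comm = λ { (fraction a b _) (fraction c e _) → cross
          (solve 4 (λ a b c e → (a :* c) :* (e :* b) := (c :* a) :* (b :* e)) refl a b c e) }
      }
    }

  private module K = CommutativeRing localization

  ι : Carrier → Fraction
  ι f = fraction f 1# regular-1#

  recip : ∀ g → Regular g → Fraction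
  recip g rg = fraction 1# g rg

  ι-cong : ∀ {f g} → f ≈ g → ι f K.≈ ι g
  ι-cong f≈g = cross (*-congʳ f≈g)

  ι-+ : ∀ f g → ι (f + g) K.≈ ι f K.+ ι g
  ι-+ f g = cross (solve 2 (λ f g → (f :+ g) :* (:1 :* :1) := (f :* :1 :+ g :* :1) :* :1) refl f g)

  ι-* : ∀ f g → ι (f * g) K.≈ ι f K.* ι g
  ι-* f g = cross (solve 2 (λ f g → (f :* g) :* (:1 :* :1) := (f :* g) :* :1) refl f g)

  ι-neg : ∀ f → ι (- f) K.≈ K.- ι f
  ι-neg f = K.refl

  ι-recip : ∀ g (rg : Regular g) → ι g K.* recip g rg K.≈ K.1#
  ι-recip g rg = cross (solve 1 (λ g → (g :* :1) :* :1 := :1 :* (:1 :* g)) refl g)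

-- Divisibility, and coprimality up to scalars.

module Divisibility {c ℓ s} (R : CommutativeRing c ℓ) (Scalar : CommutativeRing.Carrier R → Set s)
  (scalar-1# : Scalar (CommutativeRing.1# R))
  (scalar-* : ∀ {y z} → Scalar y → Scalar z → Scalar (CommutativeRing._*_ R y z))
  where
  open CommutativeRing R
  open import Relation.Binary.Reasoning.Setoid setoid
  open IntegerCoefficients R
  open Solver

  infix 4 _∣_

  record _∣_ (f g : Carrier) : Set (c ⊔ ℓ) where
    constructor divides
    field
      quotient : Carrier
      equality : g ≈ f * quotient

  ∣-refl : ∀ {f} → f ∣ f
  ∣-refl = divides 1# (sym (*-identityʳ _))

  ∣-trans : ∀ {f g h} → f ∣ g → g ∣ h → f ∣ h
  ∣-trans (divides u e) (divides v e′) = divides (u * v) (trans e′ (trans (*-congʳ e) (*-assoc _ u v)))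

  ∣-respʳ : ∀ {f g h} → g ≈ h → f ∣ g → f ∣ h
  ∣-respʳ g≈h (divides w e) = divides w (trans (sym g≈h) e)

  ∣-respˡ : ∀ {f g h} → f ≈ g → f ∣ h → g ∣ h
  ∣-respˡ f≈g (divides w e) = divides w (trans e (*-congʳ f≈g))

  ∣-*ˡ : ∀ {f g} h → f ∣ g → f ∣ h * g
  ∣-*ˡ {f} h (divides w e) = divides (h * w) (trans (*-congˡ e)
    (solve 3 (λ h f w → h :* (f :* w) := f :* (h :* w)) refl h f w))

  ∣-*ʳ : ∀ {f g} h → f ∣ g → f ∣ g * h
  ∣-*ʳ h f∣g = ∣-respʳ (*-comm h _) (∣-*ˡ h f∣g)

  ∣-* : ∀ {f g h k} → f ∣ g → h ∣ k → f * h ∣ g * k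
  ∣-* {f} {g} {h} {k} (divides u e) (divides v e′) = divides (u * v) (trans (*-cong e e′)
    (solve 4 (λ f u h v → (f :* u) :* (h :* v) := (f :* h) :* (u :* v)) refl f u h v))

  -- A Bézout identity with cleared denominators. For polynomials the scalars are the nonzero
  -- integer constants, so this is coprimality over ℚ and the form in which `CongMod` demands it.
  record Coprime (f g : Carrier) : Set (c ⊔ ℓ ⊔ s) where
    constructor bézout
    field
      u v z  : Carrier
      scalar : Scalar z
      combo  : u * f + v * g ≈ z

  coprime-sym : ∀ {f g} → Coprime f g → Coprime g f
  coprime-sym (bézout u v z sz e) = bézout v u z sz (trans (+-comm _ _) e)

  coprime-∣ˡ : ∀ {f g h} → f ∣ g → Coprime g h → Coprime f h
  coprime-∣ˡ {f} {g} {h} (divides w g≈fw) (bézout u v z sz e) = bézout (u * w) v z sz (begin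
    u * w * f + v * h    ≈⟨ +-congʳ (solve 3 (λ u w f → u :* w :* f := u :* (f :* w)) refl u w f) ⟩
    u * (f * w) + v * h  ≈⟨ +-congʳ (*-congˡ g≈fw) ⟨
    u * g + v * h        ≈⟨ e ⟩
    z                    ∎)

  coprime-∣ʳ : ∀ {f g h} → f ∣ h → Coprime g h → Coprime g f
  coprime-∣ʳ f∣h c = coprime-sym (coprime-∣ˡ f∣h (coprime-sym c))

  coprime-1# : ∀ h → Coprime 1# h
  coprime-1# h = bézout 1# 0# 1# scalar-1#
    (solve 1 (λ h → :1 :* :1 :+ :0 :* h := :1) refl h)

  coprime-* : ∀ {f g h} → Coprime f h → Coprime g h → Coprime (f * g) h
  coprime-* {f} {g} {h} (bézout u v z sz e) (bézout u′ v′ z′ sz′ e′) =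
    bézout (u * u′) (u * f * v′ + v * (u′ * g + v′ * h)) (z * z′) (scalar-* sz sz′) (begin
      u * u′ * (f * g) + (u * f * v′ + v * (u′ * g + v′ * h)) * h
        ≈⟨ solve 7 (λ u v u′ v′ f g h →
             u :* u′ :* (f :* g) :+ (u :* f :* v′ :+ v :* (u′ :* g :+ v′ :* h)) :* h :=
             (u :* f :+ v :* h) :* (u′ :* g :+ v′ :* h)) refl u v u′ v′ f g h ⟩
      (u * f + v * h) * (u′ * g + v′ * h)  ≈⟨ *-cong e e′ ⟩
      z * z′                               ∎)

  coprime-*ʳ : ∀ {f g h} → Coprime f g → Coprime f h → Coprime f (g * h)
  coprime-*ʳ c c′ = coprime-sym (coprime-* (coprime-sym c) (coprime-sym c′))

  -- Multiply uf + vg = z by yh: the first summand is divisible by fg since g divides h, the second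
  -- since f divides yh. The asymmetry suits an accumulated product f, which divides h only up to a
  -- scalar, and a new factor g.
  coprime-product-∣ : ∀ {f g h y} → Scalar y → Coprime f g → f ∣ y * h → g ∣ h →
    ∃ λ z → Scalar z × f * g ∣ z * h
  coprime-product-∣ {f} {g} {h} {y} sy (bézout u v z sz e) (divides w yh≈fw) (divides w′ h≈gw′) =
    z * y , scalar-* sz sy , divides (u * (y * w′) + v * w) (begin
      (z * y) * h                          ≈⟨ *-congʳ (*-congʳ e) ⟨
      ((u * f + v * g) * y) * h
        ≈⟨ solve 6 (λ u f v g h y → ((u :* f :+ v :* g) :* y) :* h := u :* f :* (y :* h) :+ v :* g :* (y :* h))
             refl u f v g h y ⟩
      u * f * (y * h) + v * g * (y * h)    ≈⟨ +-cong (*-congˡ (*-congˡ h≈gw′)) (*-congˡ yh≈fw) ⟩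
      u * f * (y * (g * w′)) + v * g * (f * w)
        ≈⟨ solve 7 (λ u f v g w w′ y → u :* f :* (y :* (g :* w′)) :+ v :* g :* (f :* w) :=
             (f :* g) :* (u :* (y :* w′) :+ v :* w)) refl u f v g w w′ y ⟩
      (f * g) * (u * (y * w′) + v * w)     ∎)

  regular-cancel : ∀ {g f h} → (∀ k → g * k ≈ 0# → k ≈ 0#) → g * f ≈ g * h → f ≈ h
  regular-cancel {g} {f} {h} reg e = begin
    f              ≈⟨ solve 2 (λ f h → f := (f :- h) :+ h) refl f h ⟩
    (f - h) + h    ≈⟨ +-congʳ (reg (f - h) (begin
      g * (f - h)    ≈⟨ solve 3 (λ g f h → g :* (f :- h) := g :* f :- g :* h) refl g f h ⟩
      g * f - g * h  ≈⟨ +-congʳ e ⟩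
      g * h - g * h  ≈⟨ -‿inverseʳ (g * h) ⟩
      0#             ∎)) ⟩
    0# + h         ≈⟨ +-identityˡ h ⟩
    h              ∎

  division-step : ∀ {f t g q r} → f - t * g ≈ g * q + r → f ≈ g * (t + q) + r
  division-step {f} {t} {g} {q} {r} e = begin
    f                    ≈⟨ solve 3 (λ f t g → f := (f :- t :* g) :+ t :* g) refl f t g ⟩
    (f - t * g) + t * g  ≈⟨ +-congʳ e ⟩
    (g * q + r) + t * g  ≈⟨ solve 4 (λ g q r t → (g :* q :+ r) :+ t :* g := g :* (t :+ q) :+ r) refl g q r t ⟩
    g * (t + q) + r      ∎

  scaled-remainder : ∀ {z f g q r w} → f ≈ g * q + r → z * f ≈ g * w → z * r ≈ g * (w - z * q)
  scaled-remainder {z} {f} {g} {q} {r} {w} f≈gq+r zf≈gw = begin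
    z * r                          ≈⟨ solve 4 (λ z r g q → z :* r := z :* (g :* q :+ r) :- g :* (z :* q)) refl z r g q ⟩
    z * (g * q + r) - g * (z * q)  ≈⟨ +-congʳ (*-congˡ f≈gq+r) ⟨
    z * f - g * (z * q)            ≈⟨ +-congʳ zf≈gw ⟩
    g * w - g * (z * q)            ≈⟨ solve 3 (λ g w u → g :* w :- g :* u := g :* (w :- u)) refl g w (z * q) ⟩
    g * (w - z * q)                ∎

-- Degrees and division by monic polynomials.

module PolynomialDivision where
  open Polynomials public
  open CommutativeRing polyRing using (refl; sym; trans; reflexive)
    renaming (+-identityʳ to ⊕-identityʳ; zeroˡ to ⊗-zeroˡ; zeroʳ to ⊗-zeroʳ;
              *-assoc to ⊗-assoc; *-identityˡ to ⊗-identityˡ;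
              +-congˡ to ⊕-congˡ; *-congˡ to ⊗-congˡ; *-congʳ to ⊗-congʳ)

  cst-⊗ : ∀ a f → cst a ⊗ f ≋ scale a f
  cst-⊗ a f = coefficientwise λ i → ≡.trans (coef-⊕ (scale a f) (+ 0 ∷ []) i)
    (≡.trans (≡.cong (ℤ._+_ (coef (scale a f) i)) (zeros i)) (ℤₚ.+-identityʳ _))
    where
    zeros : ∀ i → coef (+ 0 ∷ []) i ≡ + 0
    zeros zero    = ≡.refl
    zeros (suc i) = ≡.refl

  *-nonzero : ∀ {i j} → i ≢ + 0 → j ≢ + 0 → i ℤ.* j ≢ + 0
  *-nonzero {i} i≢0 j≢0 ij≡0 with ℤₚ.i*j≡0⇒i≡0∨j≡0 i ij≡0
  ... | inj₁ i≡0 = i≢0 i≡0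
  ... | inj₂ j≡0 = j≢0 j≡0

  NonzeroConstant : Poly → Set
  NonzeroConstant f = ∃ λ z → z ≢ + 0 × f ≋ cst z

  nonzeroConstant-one : NonzeroConstant one
  nonzeroConstant-one = + 1 , (λ ()) , refl

  nonzeroConstant-⊗ : ∀ {f g} → NonzeroConstant f → NonzeroConstant g → NonzeroConstant (f ⊗ g)
  nonzeroConstant-⊗ {f} {g} (y , y≢0 , f≋y) (z , z≢0 , g≋z) = y ℤ.* z , *-nonzero y≢0 z≢0 ,
    trans (trans (⊗-congʳ {g} {f} {cst y} f≋y) (⊗-congˡ {cst y} {g} {cst z} g≋z)) (cst-⊗ y (cst z))

  nonzeroConstant-regular : ∀ {f} → NonzeroConstant f → coef f 0 ≢ + 0
  nonzeroConstant-regular (z , z≢0 , f≋z) f₀≡0 = z≢0 (≡.trans (≡.sym (at f≋z 0)) f₀≡0)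

  open Divisibility polyRing NonzeroConstant nonzeroConstant-one nonzeroConstant-⊗ public

  Degree< : ℕ → Poly → Set
  Degree< n f = ∀ i → n ℕ.≤ i → coef f i ≡ + 0

  Monic : ℕ → Poly → Set
  Monic k f = coef f k ≡ + 1 × Degree< (suc k) f

  Degree<-resp : ∀ {n f g} → f ≋ g → Degree< n f → Degree< n g
  Degree<-resp f≋g df i n≤i = ≡.trans (≡.sym (at f≋g i)) (df i n≤i)

  Degree<-length : ∀ f → Degree< (length f) f
  Degree<-length []      i       _         = ≡.refl
  Degree<-length (a ∷ f) (suc i) (s≤s n≤i) = Degree<-length f i n≤i

  Degree<-zero : ∀ {f} → Degree< 0 f → f ≋ []
  Degree<-zero df = coefficientwise λ i → df i z≤n

  private
    coef-∷-⊗ : ∀ a f g i → coef ((a ∷ f) ⊗ g) (suc i) ≡ a ℤ.* coef g (suc i) ℤ.+ coef (f ⊗ g) i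
    coef-∷-⊗ a f g i = ≡.trans (coef-⊕ (scale a g) _ (suc i)) (≡.cong (ℤ._+ coef (f ⊗ g) i) (coef-scale a g (suc i)))

    coef-∷-⊗-const : ∀ a f g i → f ≋ [] → coef ((a ∷ f) ⊗ g) i ≡ a ℤ.* coef g i
    coef-∷-⊗-const a f g zero    f≋0 = ≡.trans (coef-⊗ (a ∷ f) g 0) ≡.refl
    coef-∷-⊗-const a f g (suc i) f≋0 = ≡.trans (coef-∷-⊗ a f g i)
      (≡.trans (≡.cong (ℤ._+_ (a ℤ.* coef g (suc i))) (at (trans (⊗-congʳ {g} {f} {[]} f≋0) (⊗-zeroˡ g)) i)) (ℤₚ.+-identityʳ _))

    tail-Degree< : ∀ {k a f} → Degree< (suc k) (a ∷ f) → Degree< k f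
    tail-Degree< df i k≤i = df (suc i) (s≤s k≤i)

  Degree<-⊗ : ∀ j k f g → Degree< (suc j) f → Degree< k g → Degree< (j ℕ.+ k) (f ⊗ g)
  Degree<-⊗ j       k []      g df dg i       j+k≤i = ≡.refl
  Degree<-⊗ zero    k (a ∷ f) g df dg i       k≤i   =
    ≡.trans (coef-∷-⊗-const a f g i (Degree<-zero (tail-Degree< {a = a} df)))
      (≡.trans (≡.cong (ℤ._*_ a) (dg i k≤i)) (ℤₚ.*-zeroʳ a))
  Degree<-⊗ (suc j) k (a ∷ f) g df dg (suc i) (s≤s j+k≤i) = ≡.trans (coef-∷-⊗ a f g i)
    (≡.cong₂ ℤ._+_ (≡.trans (≡.cong (ℤ._*_ a) (dg (suc i) (ℕₚ.m≤n⇒m≤1+n (ℕₚ.≤-trans (ℕₚ.m≤n+m k j) j+k≤i)))) (ℤₚ.*-zeroʳ a))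
      (Degree<-⊗ j k f g (tail-Degree< {a = a} df) dg i j+k≤i))

  leading-⊗ : ∀ j k f g → Degree< (suc j) f → Degree< (suc k) g → coef (f ⊗ g) (j ℕ.+ k) ≡ coef f j ℤ.* coef g k
  leading-⊗ j       k []      g df dg = ≡.sym (ℤₚ.*-zeroˡ (coef g k))
  leading-⊗ zero    k (a ∷ f) g df dg = coef-∷-⊗-const a f g k (Degree<-zero (tail-Degree< {a = a} df))
  leading-⊗ (suc j) k (a ∷ f) g df dg = ≡.trans (coef-∷-⊗ a f g (j ℕ.+ k))
    (≡.trans (≡.cong₂ ℤ._+_ (≡.trans (≡.cong (ℤ._*_ a) (dg (suc (j ℕ.+ k)) (s≤s (ℕₚ.m≤n+m k j)))) (ℤₚ.*-zeroʳ a))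
      (leading-⊗ j k f g (tail-Degree< {a = a} df) dg)) (ℤₚ.+-identityˡ _))

  Monic-one : Monic 0 one
  Monic-one = ≡.refl , λ { (suc i) _ → ≡.refl }

  Monic-resp : ∀ {k f g} → f ≋ g → Monic k f → Monic k g
  Monic-resp {k} f≋g (lc , df) = ≡.trans (≡.sym (at f≋g k)) lc , Degree<-resp f≋g df

  Monic-⊗ : ∀ {j k f g} → Monic j f → Monic k g → Monic (j ℕ.+ k) (f ⊗ g)
  Monic-⊗ {j} {k} {f} {g} (lf , df) (lg , dg) =
    ≡.trans (leading-⊗ j k f g df dg) (≡.cong₂ ℤ._*_ lf lg) ,
    ≡.subst (λ n → Degree< n (f ⊗ g)) (ℕₚ.+-suc j k) (Degree<-⊗ j (suc k) f g df dg)

  private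
    ≋-++0 : ∀ f → f ++ + 0 ∷ [] ≋ f
    ≋-++0 []      = coefficientwise λ { zero → ≡.refl ; (suc i) → ≡.refl }
    ≋-++0 (a ∷ f) = coefficientwise λ { zero → ≡.refl ; (suc i) → at (≋-++0 f) i }

    reverse-dropZeros : ∀ r → reverse (dropZeros r) ≋ reverse r
    reverse-dropZeros []      = refl
    reverse-dropZeros (a ∷ r) with a ℤₚ.≟ + 0
    ... | no _       = refl
    ... | yes ≡.refl = trans (reverse-dropZeros r)
      (trans (sym (≋-++0 (reverse r))) (reflexive (≡.sym (Listₚ.unfold-reverse (+ 0) r))))

    -- A view of the output of `trim`: it exposes the nonzero leading coefficient, from which the
    -- length and `lastZ` can be read off.
    data Trimmed : Poly → Set where
      zero    : Trimmed []
      leading : ∀ f a → a ≢ + 0 → Trimmed (f ++ a ∷ [])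

    reverse-dropZeros-trimmed : ∀ r → Trimmed (reverse (dropZeros r))
    reverse-dropZeros-trimmed []      = zero
    reverse-dropZeros-trimmed (a ∷ r) with a ℤₚ.≟ + 0
    ... | yes _  = reverse-dropZeros-trimmed r
    ... | no a≢0 = ≡.subst Trimmed (≡.sym (Listₚ.unfold-reverse a r)) (leading (reverse r) a a≢0)

    trimmed : ∀ f → Trimmed (trim f)
    trimmed f = reverse-dropZeros-trimmed (reverse f)

    lastZ-++ : ∀ f a → lastZ (f ++ a ∷ []) ≡ a
    lastZ-++ []          a = ≡.refl
    lastZ-++ (b ∷ [])    a = ≡.refl
    lastZ-++ (b ∷ c ∷ f) a = lastZ-++ (c ∷ f) a

    coef-++ : ∀ f a → coef (f ++ a ∷ []) (length f) ≡ a
    coef-++ []      a = ≡.refl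
    coef-++ (b ∷ f) a = coef-++ f a

    length-++1 : ∀ (f : Poly) a → length (f ++ a ∷ []) ≡ suc (length f)
    length-++1 f a = ≡.trans (Listₚ.length-++ f) (ℕₚ.+-comm (length f) 1)

    length-trimmed : ∀ {f n} → Trimmed f → Degree< n f → length f ℕ.≤ n
    length-trimmed zero              df = z≤n
    length-trimmed {n = n} (leading f a a≢0) df with ℕₚ.≤-total n (length f)
    ... | inj₁ n≤l = contradiction (≡.trans (≡.sym (coef-++ f a)) (df (length f) n≤l)) a≢0
    ... | inj₂ l≤n with ℕₚ.m≤n⇒m<n∨m≡n l≤n
    ...   | inj₁ l<n    = ℕₚ.≤-trans (ℕₚ.≤-reflexive (length-++1 f a)) l<n
    ...   | inj₂ ≡.refl = contradiction (≡.trans (≡.sym (coef-++ f a)) (df (length f) ℕₚ.≤-refl)) a≢0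

  trim≋ : ∀ f → trim f ≋ f
  trim≋ f = trans (reverse-dropZeros (reverse f)) (reflexive (Listₚ.reverse-involutive f))

  length-trim≤ : ∀ {n f} → Degree< n f → length (trim f) ℕ.≤ n
  length-trim≤ {n} {f} df = length-trimmed (trimmed f) (Degree<-resp (sym (trim≋ f)) df)

  Degree<-length-trim : ∀ f → Degree< (length (trim f)) f
  Degree<-length-trim f = Degree<-resp (trim≋ f) (Degree<-length (trim f))

  leading-coefficient : ∀ f → f ≋ [] ⊎ ∃ λ k → coef f k ≢ + 0 × Degree< (suc k) f
  leading-coefficient f with trim f | trimmed f | trim≋ f
  ... | _ | zero            | e = inj₁ (sym e)
  ... | _ | leading h a a≢0 | e = inj₂ (length h ,
    (λ c≡0 → a≢0 (≡.trans (≡.sym (coef-++ h a)) (≡.trans (at e (length h)) c≡0))) ,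
    Degree<-resp e (≡.subst (λ n → Degree< n (h ++ a ∷ [])) (length-++1 h a) (Degree<-length (h ++ a ∷ []))))

  length-trim-Monic : ∀ {k f} → Monic k f → length (trim f) ≡ suc k
  length-trim-Monic {k} {f} (lc , df) = ℕₚ.≤-antisym (length-trim≤ {suc k} {f} df) (ℕₚ.≰⇒> λ l≤k →
    contradiction (≡.trans (≡.sym lc) (Degree<-length-trim f k l≤k)) λ ())

  lastZ-trim : ∀ f {k} → length (trim f) ≡ suc k → lastZ (trim f) ≡ coef f k
  lastZ-trim f {k} l≡ with trim f | trimmed f | trim≋ f
  ... | _ | leading h a a≢0 | e rewrite ℕₚ.suc-injective (≡.trans (≡.sym l≡) (length-++1 h a)) =
    ≡.trans (lastZ-++ h a) (≡.trans (≡.sym (coef-++ h a)) (at e (length h)))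

  shift-⊗ : ∀ f g → (+ 0 ∷ f) ⊗ g ≋ + 0 ∷ (f ⊗ g)
  shift-⊗ f g = coefficientwise λ i → ≡.trans (coef-⊕ (scale (+ 0) g) (+ 0 ∷ (f ⊗ g)) i)
    (≡.trans (≡.cong (ℤ._+ coef (+ 0 ∷ (f ⊗ g)) i) (≡.trans (coef-scale (+ 0) g i) (ℤₚ.*-zeroˡ (coef g i)))) (ℤₚ.+-identityˡ _))

  coef-qpow-⊗ : ∀ e g i → coef (qpow e ⊗ g) (e ℕ.+ i) ≡ coef g i
  coef-qpow-⊗ zero    g i = at (⊗-identityˡ g) i
  coef-qpow-⊗ (suc e) g i = ≡.trans (at (shift-⊗ (qpow e) g) (suc e ℕ.+ i)) (coef-qpow-⊗ e g i)

  coef-scale-qpow-⊗ : ∀ c e g i → coef (scale c (qpow e) ⊗ g) (e ℕ.+ i) ≡ c ℤ.* coef g i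
  coef-scale-qpow-⊗ c e g i = ≡.trans
    (at (trans (⊗-congʳ {g} {scale c (qpow e)} {cst c ⊗ qpow e} (sym (cst-⊗ c (qpow e))))
      (trans (⊗-assoc (cst c) (qpow e) g) (cst-⊗ c (qpow e ⊗ g)))) (e ℕ.+ i))
    (≡.trans (coef-scale c (qpow e ⊗ g) (e ℕ.+ i)) (≡.cong (ℤ._*_ c) (coef-qpow-⊗ e g i)))

  -- Each step removes the leading coefficient of the dividend, so its trimmed length drops and a
  -- fuel of that length is never exhausted early.
  division : ∀ {k g} → Monic k g → ∀ fuel f → length (trim f) ℕ.≤ fuel →
    ∃ λ r → Degree< k r × f ≋ g ⊗ divMonicFuel fuel f g ⊕ r
  division {k} {g} mg zero f l≤0 = [] , (λ i _ → ≡.refl) ,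
    trans (Degree<-zero (≡.subst (λ n → Degree< n f) (ℕₚ.n≤0⇒n≡0 l≤0) (Degree<-length-trim f)))
          (sym (trans (⊕-identityʳ (g ⊗ [])) (⊗-zeroʳ g)))
  division {k} {g} mg (suc fuel) f l≤ with length (trim f) ℕ.<ᵇ length (trim g) in l<
  ... | true = f , Degree<-small , coefficientwise (λ i → ≡.sym (≡.trans (coef-⊕ (g ⊗ []) f i)
      (≡.trans (≡.cong (ℤ._+ coef f i) (at (⊗-zeroʳ g) i)) (ℤₚ.+-identityˡ _))))
    where
    Degree<-small : Degree< k f
    Degree<-small i k≤i = Degree<-length-trim f i (ℕₚ.≤-trans (ℕₚ.≤-pred
      (ℕₚ.≤-trans (ℕₚ.<ᵇ⇒< _ _ (≡.subst T (≡.sym l<) tt)) (ℕₚ.≤-reflexive (length-trim-Monic {k} {g} mg)))) k≤i)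
  ... | false = r , dr , trans (sym (trim≋ f)) (division-step {trim f} {t} {g} {q} {r} eq)
    where
    N e : ℕ
    N = pred (length (trim f))
    e = length (trim f) ∸ length (trim g)
    c : ℤ
    c = lastZ (trim f)
    t f′ : Poly
    t = scale c (qpow e)
    f′ = trim f ⊖ t ⊗ g
    k<l : k ℕ.< length (trim f)
    k<l = ℕₚ.≤-trans (ℕₚ.≤-reflexive (≡.sym (length-trim-Monic {k} {g} mg)))
      (ℕₚ.≮⇒≥ λ l<l → ≡.subst T l< (ℕₚ.<⇒<ᵇ l<l))
    l≡ : length (trim f) ≡ suc N
    l≡ = ≡.sym (ℕₚ.suc-pred (length (trim f)) {{ℕ.>-nonZero (ℕₚ.≤-<-trans z≤n k<l)}})
    e+k≡N : e ℕ.+ k ≡ N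
    e+k≡N = ℕₚ.suc-injective (≡.trans (≡.sym (ℕₚ.+-suc e k))
      (≡.trans (≡.cong (λ n → length (trim f) ∸ n ℕ.+ suc k) (length-trim-Monic {k} {g} mg))
        (≡.trans (ℕₚ.m∸n+n≡m k<l) l≡)))
    -- At index e + k = N the leading terms cancel because g is monic; beyond N both polynomials
    -- vanish.
    df′ : Degree< N f′
    df′ i N≤i = ≡.trans (coef-⊖ (trim f) (t ⊗ g) i) (ℤₚ.i≡j⇒i-j≡0 (≡.trans (at (trim≋ f) i) (agree (i ∸ e) i≡)))
      where
      e+k≤i : e ℕ.+ k ℕ.≤ i
      e+k≤i = ℕₚ.≤-trans (ℕₚ.≤-reflexive e+k≡N) N≤i
      i≡ : e ℕ.+ (i ∸ e) ≡ i
      i≡ = ℕₚ.m+[n∸m]≡n (ℕₚ.≤-trans (ℕₚ.m≤m+n e k) e+k≤i)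
      agree : ∀ j → e ℕ.+ j ≡ i → coef f i ≡ coef (t ⊗ g) i
      agree j ≡.refl with ℕₚ.m≤n⇒m<n∨m≡n (ℕₚ.+-cancelˡ-≤ e k j e+k≤i)
      ... | inj₁ k<j = ≡.trans
        (Degree<-length-trim f (e ℕ.+ j) (ℕₚ.≤-trans (ℕₚ.≤-reflexive (≡.trans l≡ (≡.cong suc (≡.sym e+k≡N))))
          (ℕₚ.≤-trans (ℕₚ.≤-reflexive (≡.sym (ℕₚ.+-suc e k))) (ℕₚ.+-monoʳ-≤ e k<j))))
        (≡.sym (≡.trans (coef-scale-qpow-⊗ c e g j) (≡.trans (≡.cong (ℤ._*_ c) (proj₂ mg j k<j)) (ℤₚ.*-zeroʳ c))))
      ... | inj₂ ≡.refl = ≡.sym (≡.trans (coef-scale-qpow-⊗ c e g k)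
        (≡.trans (≡.cong (ℤ._*_ c) (proj₁ mg)) (≡.trans (ℤₚ.*-identityʳ c)
          (≡.trans (lastZ-trim f l≡) (≡.cong (coef f) (≡.sym e+k≡N))))))
    IH = division {k} {g} mg fuel f′ (ℕₚ.≤-trans (length-trim≤ {N} {f′} df′) (ℕₚ.≤-pred (ℕₚ.≤-trans (ℕₚ.≤-reflexive (≡.sym l≡)) l≤)))
    r = proj₁ IH
    dr = proj₁ (proj₂ IH)
    eq = proj₂ (proj₂ IH)
    q = divMonicFuel fuel f′ g

  -- Over ℚ the remainder of an exact division vanishes; the constant y clears denominators.
  divMonic-exact : ∀ {k g f y} → Monic k g → NonzeroConstant y → g ∣ y ⊗ f → g ⊗ divMonic f g ≋ f
  divMonic-exact {k} {g} {f} {y} mg cy@(z , _ , y≋z) (divides w yf≋gw) = sym (trans f≋gq+r (trans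
    (⊕-congˡ {g ⊗ q} {r} {[]} (⊗-regular {y} {r} (nonzeroConstant-regular cy)
      (trans yr≋gv (trans (⊗-congˡ {g} {v} {[]} v≋0) (⊗-zeroʳ g)))))
    (⊕-identityʳ (g ⊗ q))))
    where
    div = division {k} {g} mg (suc (length f)) f (ℕₚ.m≤n⇒m≤1+n (length-trim≤ {length f} {f} (Degree<-length f)))
    r = proj₁ div
    dr = proj₁ (proj₂ div)
    f≋gq+r = proj₂ (proj₂ div)
    q = divMonic f g
    v : Poly
    v = w ⊖ y ⊗ q
    yr≋gv : y ⊗ r ≋ g ⊗ v
    yr≋gv = scaled-remainder {y} {f} {g} {q} {r} {w} f≋gq+r yf≋gw
    -- If v were nonzero, gv would have degree at least k, while yr has degree below k.
    v≋0 : v ≋ []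
    v≋0 with leading-coefficient v
    ... | inj₁ v≋0 = v≋0
    ... | inj₂ (N , c≢0 , dv) = contradiction (begin
      coef v N                   ≡⟨ ℤₚ.*-identityˡ _ ⟨
      + 1 ℤ.* coef v N           ≡⟨ ≡.cong (ℤ._* coef v N) (proj₁ mg) ⟨
      coef g k ℤ.* coef v N      ≡⟨ leading-⊗ k N g v (proj₂ mg) dv ⟨
      coef (g ⊗ v) (k ℕ.+ N)     ≡⟨ at yr≋gv (k ℕ.+ N) ⟨
      coef (y ⊗ r) (k ℕ.+ N)     ≡⟨ at (trans (⊗-congʳ {r} {y} {cst z} y≋z) (cst-⊗ z r)) (k ℕ.+ N) ⟩
      coef (scale z r) (k ℕ.+ N) ≡⟨ coef-scale z r (k ℕ.+ N) ⟩
      z ℤ.* coef r (k ℕ.+ N)     ≡⟨ ≡.cong (ℤ._*_ z) (dr (k ℕ.+ N) (ℕₚ.m≤m+n k N)) ⟩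
      z ℤ.* + 0                  ≡⟨ ℤₚ.*-zeroʳ z ⟩
      + 0 ∎) c≢0
      where open ≡.≡-Reasoning

  Monic-quotient : ∀ {j n f g} → Monic j f → Monic n (f ⊗ g) → ∃ λ k → Monic k g
  Monic-quotient {j} {n} {f} {g} mf mfg with leading-coefficient g
  ... | inj₁ g≋0 = contradiction (≡.trans (≡.sym (proj₁ mfg)) (at (trans (⊗-congˡ {f} {g} {[]} g≋0) (⊗-zeroʳ f)) n)) λ ()
  ... | inj₂ (k , c≢0 , dg) = k , lc , dg
    where
    top : coef (f ⊗ g) (j ℕ.+ k) ≡ coef g k
    top = ≡.trans (leading-⊗ j k f g (proj₂ mf) dg) (≡.trans (≡.cong (ℤ._* coef g k) (proj₁ mf)) (ℤₚ.*-identityˡ _))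
    n≤j+k : n ℕ.≤ j ℕ.+ k
    n≤j+k = ℕₚ.≮⇒≥ λ j+k<n → contradiction
      (≡.trans (≡.sym (proj₁ mfg)) (Degree<-⊗ j (suc k) f g (proj₂ mf) dg n (ℕₚ.≤-trans (ℕₚ.≤-reflexive (ℕₚ.+-suc j k)) j+k<n))) λ ()
    lc : coef g k ≡ + 1
    lc with ℕₚ.m≤n⇒m<n∨m≡n n≤j+k
    ... | inj₁ n<j+k  = contradiction (≡.trans (≡.sym top) (proj₂ mfg (j ℕ.+ k) n<j+k)) c≢0
    ... | inj₂ ≡.refl = ≡.trans (≡.sym top) (proj₁ mfg)

-- Greatest common divisors of the elements Qⁿ - 1.

module PowersMinusOne {c ℓ s} (R : CommutativeRing c ℓ) (Scalar : CommutativeRing.Carrier R → Set s)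
  (scalar-1# : Scalar (CommutativeRing.1# R))
  (scalar-* : ∀ {y z} → Scalar y → Scalar z → Scalar (CommutativeRing._*_ R y z))
  (scalar-fromℕ : ∀ k → Scalar (IntegerCoefficients.fromℕ R (suc k)))
  (Q : ℕ → CommutativeRing.Carrier R)
  (Q-0 : CommutativeRing._≈_ R (Q 0) (CommutativeRing.1# R))
  (Q-+ : ∀ m n → CommutativeRing._≈_ R (Q (m ℕ.+ n)) (CommutativeRing._*_ R (Q m) (Q n)))
  where
  open CommutativeRing R
  open import Relation.Binary.Reasoning.Setoid setoid
  open IntegerCoefficients R
  open Solver
  open Divisibility R Scalar scalar-1# scalar-*

  Q-1 : ℕ → Carrier
  Q-1 n = Q n - 1#

  Q-1-+ : ∀ m n → Q-1 (m ℕ.+ n) ≈ Q-1 m + Q m * Q-1 n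
  Q-1-+ m n = trans (+-congʳ (Q-+ m n))
    (solve 2 (λ x y → x :* y :- :1 := (x :- :1) :+ x :* (y :- :1)) refl (Q m) (Q n))

  Q-1-0 : Q-1 0 ≈ 0#
  Q-1-0 = trans (+-congʳ Q-0) (-‿inverseʳ 1#)

  -- S is the geometric sum of the powers of Qᵍ; each of its k summands is 1 modulo Qᵍ - 1, and this
  -- is the source of the scalars in later Bézout identities.
  geometric : ∀ g k → ∃ λ S → ∃ λ t → Q-1 (k ℕ.* g) ≈ Q-1 g * S × S ≈ fromℕ k + Q-1 g * t
  geometric g zero = 0# , 0# , trans Q-1-0 (sym (zeroʳ _)) , sym (trans (+-identityˡ _) (zeroʳ _))
  geometric g (suc k) with geometric g k
  ... | S , t , e , e′ = 1# + Q g * S , t + S , (begin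
      Q-1 (g ℕ.+ k ℕ.* g)                   ≈⟨ Q-1-+ g (k ℕ.* g) ⟩
      Q-1 g + Q g * Q-1 (k ℕ.* g)           ≈⟨ +-congˡ (*-congˡ e) ⟩
      Q-1 g + Q g * (Q-1 g * S)
        ≈⟨ solve 3 (λ d x s → d :+ x :* (d :* s) := d :* (:1 :+ x :* s)) refl _ _ _ ⟩
      Q-1 g * (1# + Q g * S)                ∎) , (begin
      1# + Q g * S
        ≈⟨ solve 2 (λ x s → :1 :+ x :* s := :1 :+ s :+ (x :- :1) :* s) refl _ _ ⟩
      1# + S + Q-1 g * S                    ≈⟨ +-congʳ (+-congˡ e′) ⟩
      1# + (fromℕ k + Q-1 g * t) + Q-1 g * S
        ≈⟨ solve 4 (λ k d t s → :1 :+ (k :+ d :* t) :+ d :* s := :1 :+ k :+ d :* (t :+ s)) refl _ _ _ _ ⟩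
      1# + fromℕ k + Q-1 g * (t + S)        ≈⟨ +-congʳ (fromℕ-suc k) ⟨
      fromℕ (suc k) + Q-1 g * (t + S)       ∎)

  Q-1-∣ : ∀ {m n} → m ℕ∣.∣ n → Q-1 m ∣ Q-1 n
  Q-1-∣ {m} (ℕ∣.divides k ≡.refl) with geometric m k
  ... | S , _ , e , _ = divides S e

  -- If d + yn = xm, then Qˣᵐ - 1 = (Qᵈ - 1) + Qᵈ(Qʸⁿ - 1), so the Bézout identity of the exponents
  -- lifts to the powers.
  Q-1-gcd : ∀ m n → ∃ λ u → ∃ λ v → u * Q-1 m + v * Q-1 n ≈ Q-1 (GCD.gcd m n)
  Q-1-gcd m n with GCD.Bézout.identity (GCD.gcd-GCD m n)
  ... | GCD.Bézout.+- x y e with Q-1-∣ (ℕ∣.n∣m*n x {m}) | Q-1-∣ (ℕ∣.n∣m*n y {n})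
  ...   | divides u eu | divides v ev = u , - (Q d * v) , (begin
      u * Q-1 m + - (Q d * v) * Q-1 n
        ≈⟨ solve 5 (λ u a q v b → u :* a :+ :- (q :* v) :* b := a :* u :- q :* (b :* v)) refl _ _ _ _ _ ⟩
      Q-1 m * u - Q d * (Q-1 n * v)                       ≈⟨ +-cong eu (-‿cong (*-congˡ ev)) ⟨
      Q-1 (x ℕ.* m) - Q d * Q-1 (y ℕ.* n)                 ≡⟨ ≡.cong (λ k → Q-1 k - Q d * Q-1 (y ℕ.* n)) e ⟨
      Q-1 (d ℕ.+ y ℕ.* n) - Q d * Q-1 (y ℕ.* n)           ≈⟨ +-congʳ (Q-1-+ d (y ℕ.* n)) ⟩
      (Q-1 d + Q d * Q-1 (y ℕ.* n)) - Q d * Q-1 (y ℕ.* n) ≈⟨ solve 2 (λ a b → (a :+ b) :- b := a) refl _ _ ⟩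
      Q-1 d                                               ∎)
      where d = GCD.gcd m n
  Q-1-gcd m n | GCD.Bézout.-+ x y e with Q-1-∣ (ℕ∣.n∣m*n x {m}) | Q-1-∣ (ℕ∣.n∣m*n y {n})
  ...   | divides u eu | divides v ev = - (Q d * u) , v , (begin
      - (Q d * u) * Q-1 m + v * Q-1 n
        ≈⟨ solve 5 (λ u a q v b → :- (q :* u) :* a :+ v :* b := b :* v :- q :* (a :* u)) refl _ _ _ _ _ ⟩
      Q-1 n * v - Q d * (Q-1 m * u)                       ≈⟨ +-cong ev (-‿cong (*-congˡ eu)) ⟨
      Q-1 (y ℕ.* n) - Q d * Q-1 (x ℕ.* m)                 ≡⟨ ≡.cong (λ k → Q-1 k - Q d * Q-1 (x ℕ.* m)) e ⟨
      Q-1 (d ℕ.+ x ℕ.* m) - Q d * Q-1 (x ℕ.* m)           ≈⟨ +-congʳ (Q-1-+ d (x ℕ.* m)) ⟩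
      (Q-1 d + Q d * Q-1 (x ℕ.* m)) - Q d * Q-1 (x ℕ.* m) ≈⟨ solve 2 (λ a b → (a :+ b) :- b := a) refl _ _ ⟩
      Q-1 d                                               ∎)
      where d = GCD.gcd m n

  -- (Qⁿ - 1) / (Qᵍ - 1) is congruent to the constant n / g modulo Qᵍ - 1.
  coprime-to-Q-1 : ∀ {j n φ e} .{{_ : ℕ.NonZero n}} → (∀ k → Q-1 (GCD.gcd j n) * k ≈ 0# → k ≈ 0#) →
    e * φ ≈ Q-1 n → Q-1 (GCD.gcd j n) ∣ e → Coprime φ (Q-1 j)
  coprime-to-Q-1 {j} {n} {φ} {e} reg eφ≈ (divides t e≈) with GCD.gcd[m,n]∣n j n
  ... | ℕ∣.divides r n≡rg with geometric (GCD.gcd j n) r | Q-1-gcd j n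
  ...   | S , w , e₁ , e₂ | u , v , e₃ = bézout (t - w * v * e) (- (w * u)) (fromℕ r) (scalar-r r n≡rg) (begin
      (t - w * v * e) * φ + - (w * u) * Q-1 j
        ≈⟨ solve 7 (λ t w v e φ u d → (t :- w :* v :* e) :* φ :+ :- (w :* u) :* d :=
             t :* φ :- w :* (u :* d :+ v :* (e :* φ))) refl t w v e φ u (Q-1 j) ⟩
      t * φ - w * (u * Q-1 j + v * (e * φ))  ≈⟨ +-cong tφ≈S (-‿cong (*-congˡ (trans (+-congˡ (*-congˡ eφ≈)) e₃))) ⟩
      S - w * G                              ≈⟨ +-congʳ e₂ ⟩
      (fromℕ r + G * w) - w * G              ≈⟨ solve 3 (λ r g w → (r :+ g :* w) :- w :* g := r) refl _ _ _ ⟩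
      fromℕ r                                ∎)
      where
      G : Carrier
      G = Q-1 (GCD.gcd j n)
      tφ≈S : t * φ ≈ S
      tφ≈S = regular-cancel reg (begin
        G * (t * φ)  ≈⟨ *-assoc G t φ ⟨
        (G * t) * φ  ≈⟨ *-congʳ e≈ ⟨
        e * φ        ≈⟨ eφ≈ ⟩
        Q-1 n        ≡⟨ ≡.cong Q-1 n≡rg ⟩
        Q-1 (r ℕ.* GCD.gcd j n) ≈⟨ e₁ ⟩
        G * S        ∎)
      scalar-r : ∀ r → n ≡ r ℕ.* GCD.gcd j n → Scalar (fromℕ r)
      scalar-r zero    n≡0 = contradiction n≡0 (ℕ.≢-nonZero⁻¹ n)
      scalar-r (suc r) _   = scalar-fromℕ r

-- Correctness of the recursively computed cyclotomic polynomials.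

module Cyclotomic where
  open PolynomialDivision public
  open CommutativeRing polyRing using (refl; sym; trans; reflexive)
    renaming (*-identityˡ to ⊗-identityˡ; *-identityʳ to ⊗-identityʳ;
              *-congˡ to ⊗-congˡ)
  open IntegerCoefficients polyRing using (fromℕ)

  nonzeroConstant-fromℕ : ∀ k → NonzeroConstant (fromℕ (suc k))
  nonzeroConstant-fromℕ k = + suc k , (λ ()) , constant k
    where
    constant : ∀ k → fromℕ (suc k) ≋ cst (+ suc k)
    constant zero    = refl
    constant (suc k) = coefficientwise λ i → ≡.trans (coef-⊕ one (fromℕ (suc k)) i)
      (≡.trans (≡.cong (ℤ._+_ (coef one i)) (at (constant k) i)) (≡.sym (coef-⊕ one (cst (+ suc k)) i)))

  qpow-+ : ∀ m n → qpow (m ℕ.+ n) ≋ qpow m ⊗ qpow n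
  qpow-+ zero    n = sym (⊗-identityˡ (qpow n))
  qpow-+ (suc m) n = trans (coefficientwise λ { zero → ≡.refl ; (suc i) → at (qpow-+ m n) i })
    (sym (shift-⊗ (qpow m) (qpow n)))

  open PowersMinusOne polyRing NonzeroConstant nonzeroConstant-one nonzeroConstant-⊗ nonzeroConstant-fromℕ
    qpow refl qpow-+ public

  Q-1-regular : ∀ {n} .{{_ : ℕ.NonZero n}} f → Q-1 n ⊗ f ≋ [] → f ≋ []
  Q-1-regular {suc n} f = ⊗-regular {Q-1 (suc n)} {f} λ ()

  Q-1-Monic : ∀ n .{{_ : ℕ.NonZero n}} → Monic n (Q-1 n)
  Q-1-Monic (suc n) = ≡.trans (coef-⊖ (qpow (suc n)) one (suc n)) (≡.cong (ℤ._- + 0) (top n)) ,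
    λ { (suc i) (s≤s n<i) → ≡.trans (coef-⊖ (qpow (suc n)) one (suc i)) (≡.cong (ℤ._- + 0) (above n i n<i)) }
    where
    top : ∀ n → coef (qpow n) n ≡ + 1
    top zero    = ≡.refl
    top (suc n) = top n
    above : ∀ n → Degree< (suc n) (qpow n)
    above zero    (suc i) _         = ≡.refl
    above (suc n) (suc i) (s≤s n<i) = above n i n<i

  length-cycloList : ∀ N → length (cycloList N) ≡ N
  length-cycloList zero    = ≡.refl
  length-cycloList (suc N) = ≡.trans (Listₚ.length-++ (cycloList N))
    (≡.trans (ℕₚ.+-comm _ 1) (≡.cong suc (length-cycloList N)))

  -- The product of the Φ_e over the divisors e ≤ N of m.
  Φ-product : ℕ → ℕ → Poly
  Φ-product m N = divisorProd m 1 (cycloList N)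

  Φ-suc : ∀ N → Φ (suc N) ≡ divMonic (Q-1 (suc N)) (Φ-product (suc N) N)
  Φ-suc N = nth-++ N (cycloList N) _ (length-cycloList N)
    where
    nth-++ : ∀ k φs φ → length φs ≡ k → nth k (φs ++ φ ∷ []) ≡ φ
    nth-++ zero    []       φ _ = ≡.refl
    nth-++ (suc k) (ψ ∷ φs) φ e = nth-++ k φs φ (ℕₚ.suc-injective e)

  Φ-factor : ℕ → ℕ → Poly
  Φ-factor m N = if does (suc N ℕ∣.∣? m) then Φ (suc N) else one

  divisorProd-++ : ∀ m φ i φs → divisorProd m i (φs ++ φ ∷ []) ≋
    divisorProd m i φs ⊗ (if does ((i ℕ.+ length φs) ℕ∣.∣? m) then φ else one)
  divisorProd-++ m φ i [] rewrite ℕₚ.+-identityʳ i = trans (⊗-identityʳ ψ) (sym (⊗-identityˡ ψ))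
    where ψ = if does (i ℕ∣.∣? m) then φ else one
  divisorProd-++ m φ i (ψ ∷ φs) = trans (⊗-congˡ {χ} {divisorProd m (suc i) (φs ++ φ ∷ [])} (≡.subst
      (λ k → divisorProd m (suc i) (φs ++ φ ∷ []) ≋
             divisorProd m (suc i) φs ⊗ (if does (k ℕ∣.∣? m) then φ else one))
      (≡.sym (ℕₚ.+-suc i (length φs))) (divisorProd-++ m φ (suc i) φs)))
    (sym (CommutativeRing.*-assoc polyRing χ (divisorProd m (suc i) φs) _))
    where χ = if does (i ℕ∣.∣? m) then ψ else one

  Φ-product-suc : ∀ m N → Φ-product m (suc N) ≋ Φ-product m N ⊗ Φ-factor m N
  Φ-product-suc m N = ≡.subst
    (λ φ → Φ-product m (suc N) ≋ Φ-product m N ⊗ (if does (suc N ℕ∣.∣? m) then φ else one)) (≡.sym (Φ-suc N))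
    (≡.subst (λ k → Φ-product m (suc N) ≋ Φ-product m N ⊗ (if does (suc k ℕ∣.∣? m) then φ else one))
      (length-cycloList N) (divisorProd-++ m φ 1 (cycloList N)))
    where
    φ : Poly
    φ = divMonic (Q-1 (suc N)) (Φ-product (suc N) N)

  private
    if-elim : ∀ {a p} {A : Set a} {x y : Poly} (P : Poly → Set p) (d : Dec A) →
      (A → P x) → (¬ A → P y) → P (if does d then x else y)
    if-elim P (yes a) f g = f a
    if-elim P (no ¬a) f g = g ¬a

  Φ-factor-elim : ∀ {p} m N (P : Poly → Set p) → (suc N ℕ∣.∣ m → P (Φ (suc N))) → P one → P (Φ-factor m N)
  Φ-factor-elim m N P f g = if-elim P (suc N ℕ∣.∣? m) f (λ _ → g)

  Φ-factor-∣ : ∀ {m N} → suc N ℕ∣.∣ m → Φ-factor m N ≡ Φ (suc N)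
  Φ-factor-∣ {m} {N} N∣m = if-elim (_≡ Φ (suc N)) (suc N ℕ∣.∣? m) (λ _ → ≡.refl) (λ N∤m → contradiction N∣m N∤m)

  -- The invariant of the induction. Monicity is carried along because `divMonic` is exact only for
  -- monic divisors, and the product formula because coprimality is derived from it.
  record Correct (N : ℕ) : Set where
    field
      degree  : ℕ
      monic   : Monic degree (Φ (suc N))
      product : Φ-product (suc N) N ⊗ Φ (suc N) ≋ Q-1 (suc N)
  open Correct

  module Below (N : ℕ) (correct : ∀ i → i ℕ.< N → Correct i) where

    Φ∣Q-1 : ∀ i → i ℕ.< N → Φ (suc i) ∣ Q-1 (suc i)
    Φ∣Q-1 i i<N = ∣-respʳ {Φ (suc i)} (product (correct i i<N))
      (∣-*ˡ {Φ (suc i)} {Φ (suc i)} (Φ-product (suc i) i) (∣-refl {Φ (suc i)}))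

    Φ-product-Monic : ∀ m K → K ℕ.≤ N → ∃ λ k → Monic k (Φ-product m K)
    Φ-product-Monic m zero    K≤N = 0 , Monic-one
    Φ-product-Monic m (suc K) K≤N with Φ-product-Monic m K (ℕₚ.<⇒≤ K≤N) | factor-Monic
      where
      factor-Monic : ∃ λ k → Monic k (Φ-factor m K)
      factor-Monic = Φ-factor-elim m K (λ φ → ∃ λ k → Monic k φ)
        (λ _ → degree (correct K K≤N) , monic (correct K K≤N)) (0 , Monic-one)
    ... | j , mj | k , mk = j ℕ.+ k , Monic-resp {f = Φ-product m K ⊗ Φ-factor m K} {Φ-product m (suc K)}
      (sym (Φ-product-suc m K)) (Monic-⊗ {j} {k} {Φ-product m K} {Φ-factor m K} mj mk)

    Φ-product-self : ∀ g → g ℕ.< N → Φ-product (suc g) (suc g) ≋ Q-1 (suc g)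
    Φ-product-self g g<N = trans (Φ-product-suc (suc g) g)
      (trans (⊗-congˡ {Φ-product (suc g) g} (reflexive (Φ-factor-∣ {suc g} {g} ℕ∣.∣-refl))) (product (correct g g<N)))

    Φ-product-∣ : ∀ {g m} → g ℕ∣.∣ m → ∀ K → Φ-product g K ∣ Φ-product m K
    Φ-product-∣ g∣m zero    = ∣-refl {one}
    Φ-product-∣ {g} {m} g∣m (suc K) =
      ∣-respˡ {Φ-product g K ⊗ Φ-factor g K} {Φ-product g (suc K)} (sym (Φ-product-suc g K))
        (∣-respʳ {_} {Φ-product m K ⊗ Φ-factor m K} (sym (Φ-product-suc m K))
          (∣-* {Φ-product g K} {_} {Φ-factor g K} (Φ-product-∣ g∣m K) factor-∣))
      where
      factor-∣ : Φ-factor g K ∣ Φ-factor m K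
      factor-∣ = Φ-factor-elim g K (_∣ Φ-factor m K)
        (λ K∣g → ≡.subst (Φ (suc K) ∣_) (≡.sym (Φ-factor-∣ {m} {K} (ℕ∣.∣-trans K∣g g∣m))) (∣-refl {Φ (suc K)}))
        (divides (Φ-factor m K) (sym (⊗-identityˡ (Φ-factor m K))))

    Φ-product-mono : ∀ m {K L} → K ℕ.≤ L → Φ-product m K ∣ Φ-product m L
    Φ-product-mono m {K} {zero}  z≤n = ∣-refl {one}
    Φ-product-mono m {K} {suc L} K≤1+L with ℕₚ.m≤n⇒m<n∨m≡n K≤1+L
    ... | inj₂ ≡.refl = ∣-refl {Φ-product m K}
    ... | inj₁ K<1+L  = ∣-respʳ {Φ-product m K} {Φ-product m L ⊗ Φ-factor m L} (sym (Φ-product-suc m L))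
      (∣-*ʳ {Φ-product m K} {Φ-product m L} (Φ-factor m L) (Φ-product-mono m (ℕₚ.≤-pred K<1+L)))

    -- By the product formula qᵍ - 1 is the product of the Φ_e with e ∣ g, and each such e is at
    -- most K and divides m.
    Q-1-∣-Φ-product : ∀ {g m} .{{_ : ℕ.NonZero g}} K → g ℕ∣.∣ m → g ℕ.≤ K → K ℕ.≤ N → Q-1 g ∣ Φ-product m K
    Q-1-∣-Φ-product {suc g} {m} K g∣m g≤K K≤N =
      ∣-respˡ {Φ-product (suc g) (suc g)} {Q-1 (suc g)} (Φ-product-self g (ℕₚ.≤-trans g≤K K≤N))
        (∣-trans {_} {Φ-product m (suc g)} (Φ-product-∣ g∣m (suc g)) (Φ-product-mono m g≤K))

    -- As i + 1 does not divide j, the gcd g of the two is a proper divisor of i + 1. Hence qᵍ - 1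
    -- divides the cofactor of Φ in the product formula, as `coprime-to-Q-1` requires.
    Φ-coprime : ∀ i j → i ℕ.< N → ¬ (suc i ℕ∣.∣ j) → Coprime (Φ (suc i)) (Q-1 j)
    Φ-coprime i j i<N i∤j = coprime-to-Q-1 {j} {suc i} {Φ (suc i)} {Φ-product (suc i) i}
      (λ k → Q-1-regular {g} k) (product (correct i i<N))
      (Q-1-∣-Φ-product i (GCD.gcd[m,n]∣n j (suc i)) g≤i (ℕₚ.<⇒≤ i<N))
      where
      g : ℕ
      g = GCD.gcd j (suc i)
      instance
        g≢0 : ℕ.NonZero g
        g≢0 = ℕ.≢-nonZero (GCD.gcd[m,n]≢0 j (suc i) (inj₂ λ ()))
      g≤i : g ℕ.≤ i
      g≤i with ℕₚ.m≤n⇒m<n∨m≡n (ℕ∣.∣⇒≤ (GCD.gcd[m,n]∣n j (suc i)))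
      ... | inj₁ g<1+i = ℕₚ.≤-pred g<1+i
      ... | inj₂ g≡1+i = contradiction (≡.subst (ℕ∣._∣ j) g≡1+i (GCD.gcd[m,n]∣m j (suc i))) i∤j

    -- Every factor Φ_e has e ≤ K < i + 1 and divides qᵉ - 1, to which Φ with the larger index i + 1
    -- is coprime.
    Φ-product-coprime : ∀ m K i → K ℕ.≤ i → i ℕ.< N → Coprime (Φ-product m K) (Φ (suc i))
    Φ-product-coprime m zero    i K≤i i<N = coprime-1# (Φ (suc i))
    Φ-product-coprime m (suc K) i K<i i<N =
      coprime-∣ˡ {Φ-product m (suc K)} {Φ-product m K ⊗ Φ-factor m K} {Φ (suc i)}
        (∣-respˡ {Φ-product m K ⊗ Φ-factor m K} (sym (Φ-product-suc m K)) (∣-refl {Φ-product m K ⊗ Φ-factor m K}))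
        (coprime-* {Φ-product m K} {Φ-factor m K} {Φ (suc i)} (Φ-product-coprime m K i (ℕₚ.<⇒≤ K<i) i<N) factor-coprime)
      where
      factor-coprime : Coprime (Φ-factor m K) (Φ (suc i))
      factor-coprime = Φ-factor-elim m K (λ φ → Coprime φ (Φ (suc i)))
        (λ _ → coprime-∣ˡ {Φ (suc K)} {Q-1 (suc K)} {Φ (suc i)} (Φ∣Q-1 K (ℕₚ.<-trans K<i i<N))
          (coprime-sym {Φ (suc i)} {Q-1 (suc K)} (Φ-coprime i (suc K) i<N (ℕ∣.>⇒∤ (s≤s K<i)))))
        (coprime-1# (Φ (suc i)))

    -- The factors are adjoined one at a time, and each Bézout identity may enlarge the constant z.
    -- `divMonic-exact` removes it at the end.
    Φ-product-∣-Q-1 : ∀ m K → K ℕ.≤ N → ∃ λ z → NonzeroConstant z × Φ-product m K ∣ z ⊗ Q-1 m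
    Φ-product-∣-Q-1 m zero    K≤N = one , nonzeroConstant-one ,
      divides (one ⊗ Q-1 m) (sym (⊗-identityˡ (one ⊗ Q-1 m)))
    Φ-product-∣-Q-1 m (suc K) K<N with Φ-product-∣-Q-1 m K (ℕₚ.<⇒≤ K<N)
    ... | z , cz , e = proj₁ result , proj₁ (proj₂ result) ,
      ∣-respˡ {Φ-product m K ⊗ Φ-factor m K} {Φ-product m (suc K)} (sym (Φ-product-suc m K)) (proj₂ (proj₂ result))
      where
      result : ∃ λ y → NonzeroConstant y × Φ-product m K ⊗ Φ-factor m K ∣ y ⊗ Q-1 m
      result = Φ-factor-elim m K (λ φ → ∃ λ y → NonzeroConstant y × Φ-product m K ⊗ φ ∣ y ⊗ Q-1 m)
        (λ K∣m → coprime-product-∣ {Φ-product m K} {Φ (suc K)} {Q-1 m} {z} cz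
          (Φ-product-coprime m K K ℕₚ.≤-refl K<N) e
          (∣-trans {Φ (suc K)} {Q-1 (suc K)} (Φ∣Q-1 K K<N) (Q-1-∣ K∣m)))
        (z , cz , ∣-respˡ {Φ-product m K} {Φ-product m K ⊗ one} (sym (⊗-identityʳ (Φ-product m K))) e)

    correct-next : Correct N
    correct-next with Φ-product-Monic (suc N) N ℕₚ.≤-refl | Φ-product-∣-Q-1 (suc N) N ℕₚ.≤-refl
    ... | k , mk | z , cz , z∣ = record
      { degree  = proj₁ monic-Φ
      ; monic   = proj₂ monic-Φ
      ; product = exact
      }
      where
      exact : Φ-product (suc N) N ⊗ Φ (suc N) ≋ Q-1 (suc N)
      exact = ≡.subst (λ φ → Φ-product (suc N) N ⊗ φ ≋ Q-1 (suc N)) (≡.sym (Φ-suc N))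
        (divMonic-exact {k} {Φ-product (suc N) N} {Q-1 (suc N)} {z} mk cz z∣)
      monic-Φ : ∃ λ j → Monic j (Φ (suc N))
      monic-Φ = Monic-quotient {k} {suc N} {Φ-product (suc N) N} {Φ (suc N)} mk
        (Monic-resp {suc N} {Q-1 (suc N)} {Φ-product (suc N) N ⊗ Φ (suc N)} (sym exact) (Q-1-Monic (suc N)))

  Φ-correct : ∀ N → Correct N
  Φ-correct = <-rec Correct (λ N rec → Below.correct-next N (λ i i<N → rec i<N))

  Φ∣Q-1 : ∀ n .{{_ : ℕ.NonZero n}} → Φ n ∣ Q-1 n
  Φ∣Q-1 (suc n) = Below.Φ∣Q-1 (suc n) (λ i _ → Φ-correct i) n ℕₚ.≤-refl

  Φ-coprime-Q-1 : ∀ n j .{{_ : ℕ.NonZero n}} → ¬ (n ℕ∣.∣ j) → Coprime (Φ n) (Q-1 j)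
  Φ-coprime-Q-1 (suc n) j n∤j = Below.Φ-coprime (suc n) (λ i _ → Φ-correct i) n j ℕₚ.≤-refl n∤j

-- Elementary identities, the substitution of -q for q, and the modulus.

module RingIdentities {c ℓ} (R : CommutativeRing c ℓ) where
  open CommutativeRing R
  open IntegerCoefficients R
  open Solver

  difference-of-squares : ∀ x → (x - 1#) * (x + 1#) ≈ x * x - 1#
  difference-of-squares x = solve 1 (λ x → (x :- :1) :* (x :+ :1) := x :* x :- :1) refl x

  square-of-product : ∀ x y → (x * (x * 1#)) * (y * (y * 1#)) ≈ (y * x) * (y * x)
  square-of-product x y =
    solve 2 (λ x y → (x :* (x :* :1)) :* (y :* (y :* :1)) := (y :* x) :* (y :* x)) refl x y

  negated-factor : ∀ x y → - x - 1# ≈ y → x + 1# ≈ y * - 1#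
  negated-factor x y e = trans (solve 1 (λ x → x :+ :1 := (:- x :- :1) :* :- :1) refl x) (*-congʳ e)

  reversed-difference : ∀ x → x - 1# ≈ (1# - x) * - 1#
  reversed-difference x = solve 1 (λ x → x :- :1 := (:1 :- x) :* :- :1) refl x

module Modulus where
  open Cyclotomic public
  open Sums ℤₚ.+-*-commutativeRing
  open CommutativeRing polyRing using (refl; sym; trans)
    renaming (+-congʳ to ⊕-congʳ; +-cong to ⊕-cong)
  open IntegerCoefficients ℤₚ.+-*-commutativeRing
  open Solver
  open RingIdentities polyRing

  parity : ℕ → ℤ
  parity zero    = + 1
  parity (suc i) = ℤ.- parity i

  parity-+ : ∀ i j → parity (i ℕ.+ j) ≡ parity i ℤ.* parity j
  parity-+ zero    j = ≡.sym (ℤₚ.*-identityˡ (parity j))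
  parity-+ (suc i) j = ≡.trans (≡.cong ℤ.-_ (parity-+ i j)) (ℤₚ.neg-distribˡ-* (parity i) (parity j))

  coef-negVar : ∀ f i → coef (negVar f) i ≡ parity i ℤ.* coef f i
  coef-negVar []      i       = ≡.sym (ℤₚ.*-zeroʳ (parity i))
  coef-negVar (a ∷ f) zero    = ≡.sym (ℤₚ.*-identityˡ a)
  coef-negVar (a ∷ f) (suc i) = ≡.trans (coef-neg (negVar f) i)
    (≡.trans (≡.cong ℤ.-_ (coef-negVar f i)) (ℤₚ.neg-distribˡ-* (parity i) (coef f i)))

  negVar-cong : ∀ {f g} → f ≋ g → negVar f ≋ negVar g
  negVar-cong {f} {g} e = coefficientwise λ i → ≡.trans (coef-negVar f i)
    (≡.trans (≡.cong (ℤ._*_ (parity i)) (at e i)) (≡.sym (coef-negVar g i)))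

  negVar-⊕ : ∀ f g → negVar (f ⊕ g) ≋ negVar f ⊕ negVar g
  negVar-⊕ f g = coefficientwise λ i → begin
    coef (negVar (f ⊕ g)) i                             ≡⟨ coef-negVar (f ⊕ g) i ⟩
    parity i ℤ.* coef (f ⊕ g) i                         ≡⟨ ≡.cong (ℤ._*_ (parity i)) (coef-⊕ f g i) ⟩
    parity i ℤ.* (coef f i ℤ.+ coef g i)                ≡⟨ ℤₚ.*-distribˡ-+ (parity i) (coef f i) (coef g i) ⟩
    parity i ℤ.* coef f i ℤ.+ parity i ℤ.* coef g i     ≡⟨ ≡.cong₂ ℤ._+_ (coef-negVar f i) (coef-negVar g i) ⟨
    coef (negVar f) i ℤ.+ coef (negVar g) i             ≡⟨ coef-⊕ (negVar f) (negVar g) i ⟨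
    coef (negVar f ⊕ negVar g) i                        ∎
    where open ≡.≡-Reasoning

  negVar-⊗ : ∀ f g → negVar (f ⊗ g) ≋ negVar f ⊗ negVar g
  negVar-⊗ f g = coefficientwise λ i → begin
    coef (negVar (f ⊗ g)) i
      ≡⟨ coef-negVar (f ⊗ g) i ⟩
    parity i ℤ.* coef (f ⊗ g) i
      ≡⟨ ≡.cong (ℤ._*_ (parity i)) (coef-⊗ f g i) ⟩
    parity i ℤ.* conv i (λ j k → coef f j ℤ.* coef g k)
      ≡⟨ conv-*ˡ i (parity i) _ ⟩
    conv i (λ j k → parity i ℤ.* (coef f j ℤ.* coef g k))
      ≡⟨ conv-cong i (λ { j k ≡.refl → ≡.trans (≡.cong (ℤ._* (coef f j ℤ.* coef g k)) (parity-+ j k))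
           (≡.trans (solve 4 (λ s t x y → (s :* t) :* (x :* y) := (s :* x) :* (t :* y)) ≡.refl
                      (parity j) (parity k) (coef f j) (coef g k))
                    (≡.sym (≡.cong₂ ℤ._*_ (coef-negVar f j) (coef-negVar g k)))) }) ⟩
    conv i (λ j k → coef (negVar f) j ℤ.* coef (negVar g) k)
      ≡⟨ coef-⊗ (negVar f) (negVar g) i ⟨
    coef (negVar f ⊗ negVar g) i ∎
    where open ≡.≡-Reasoning

  negVar-qpow : ∀ n → negVar (qpow n) ≋ scale (parity n) (qpow n)
  negVar-qpow n = coefficientwise λ i → ≡.trans (coef-negVar (qpow n) i) (≡.trans (single n i (λ j → parity j))
    (≡.sym (coef-scale (parity n) (qpow n) i)))
    where
    single : ∀ n i (h : ℕ → ℤ) → h i ℤ.* coef (qpow n) i ≡ h n ℤ.* coef (qpow n) i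
    single zero    zero    h = ≡.refl
    single zero    (suc i) h = ≡.trans (ℤₚ.*-zeroʳ (h (suc i))) (≡.sym (ℤₚ.*-zeroʳ (h 0)))
    single (suc n) zero    h = ≡.trans (ℤₚ.*-zeroʳ (h 0)) (≡.sym (ℤₚ.*-zeroʳ (h (suc n))))
    single (suc n) (suc i) h = single n i (λ j → h (suc j))

  negVar-∣ : ∀ {f g} → f ∣ g → negVar f ∣ negVar g
  negVar-∣ {f} {g} (divides w e) = divides (negVar w) (trans (negVar-cong {g} {f ⊗ w} e) (negVar-⊗ f w))

  negVar-coprime : ∀ {f g} → Coprime f g → Coprime (negVar f) (negVar g)
  negVar-coprime {f} {g} (bézout u v z (y , y≢0 , z≋y) e) =
    bézout (negVar u) (negVar v) (negVar z) (y , y≢0 , negVar-cong {z} {cst y} z≋y)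
      (trans (sym (trans (negVar-⊕ (u ⊗ f) (v ⊗ g))
                         (⊕-cong {negVar (u ⊗ f)} {negVar u ⊗ negVar f} (negVar-⊗ u f) (negVar-⊗ v g))))
             (negVar-cong {u ⊗ f ⊕ v ⊗ g} {z} e))

  parity-double : ∀ j → parity (2 ℕ.* j) ≡ + 1
  parity-double j = ≡.trans (≡.cong parity (≡.cong (ℕ._+_ j) (ℕₚ.+-identityʳ j)))
    (≡.trans (parity-+ j j) (square j))
    where
    square : ∀ j → parity j ℤ.* parity j ≡ + 1
    square zero    = ≡.refl
    square (suc j) = ≡.trans (solve 1 (λ s → (:- s) :* (:- s) := s :* s) ≡.refl (parity j)) (square j)

  negVar-Q-1-even : ∀ j → negVar (Q-1 (2 ℕ.* j)) ≋ Q-1 (2 ℕ.* j)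
  negVar-Q-1-even j = trans (negVar-⊕ (qpow (2 ℕ.* j)) (neg one))
    (⊕-congʳ {neg one} {negVar (qpow (2 ℕ.* j))} {qpow (2 ℕ.* j)} (trans (negVar-qpow (2 ℕ.* j))
      (coefficientwise λ i → ≡.trans (coef-scale (parity (2 ℕ.* j)) (qpow (2 ℕ.* j)) i)
        (≡.trans (≡.cong (ℤ._* coef (qpow (2 ℕ.* j)) i) (parity-double j)) (ℤₚ.*-identityˡ _)))))

  negVar-Q-1-odd : ∀ k → negVar (Q-1 (suc (2 ℕ.* k))) ≋ neg (qpow (suc (2 ℕ.* k))) ⊖ one
  negVar-Q-1-odd k = trans (negVar-⊕ (qpow n) (neg one))
    (⊕-congʳ {neg one} {negVar (qpow n)} {neg (qpow n)} (trans (negVar-qpow n)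
      (coefficientwise λ i → ≡.trans (coef-scale (parity n) (qpow n) i)
        (≡.trans (≡.cong (ℤ._* coef (qpow n) i) (≡.cong ℤ.-_ (parity-double k))) (≡.sym (coef-scale ℤ.-1ℤ (qpow n) i))))))
    where n = suc (2 ℕ.* k)

  module Odd (k : ℕ) where
    n : ℕ
    n = suc (2 ℕ.* k)

    odd-divides-double : ∀ {j} → n ℕ∣.∣ 2 ℕ.* j → n ℕ∣.∣ j
    odd-divides-double {j} = Coprimality.coprime-divisor {n} {2} {j} λ { {d} (d∣n , d∣2) →
      ℕ∣.∣1⇒≡1 (ℕ∣.∣m+n∣m⇒∣n {d} {2 ℕ.* k} {1} (≡.subst (d ℕ∣.∣_) (ℕₚ.+-comm 1 (2 ℕ.* k)) d∣n) (ℕ∣.∣m⇒∣m*n {d} {2} k d∣2)) }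

    -- For odd n, replacing q by -q turns qⁿ - 1 into -(qⁿ + 1). So the two factors divide the
    -- complementary parts qⁿ - 1 and qⁿ + 1 of q²ⁿ - 1.
    Φ⊗negVarΦ∣Q-1 : Φ n ⊗ negVar (Φ n) ∣ Q-1 (2 ℕ.* n)
    Φ⊗negVarΦ∣Q-1 = ∣-respʳ {Φ n ⊗ negVar (Φ n)} {Q-1 n ⊗ (qpow n ⊕ one)} factorisation
      (∣-* {Φ n} {Q-1 n} {negVar (Φ n)} {qpow n ⊕ one} (Φ∣Q-1 n)
        (∣-trans {negVar (Φ n)} {negVar (Q-1 n)} (negVar-∣ {Φ n} {Q-1 n} (Φ∣Q-1 n))
          (divides (neg one) (negated-factor (qpow n) (negVar (Q-1 n)) (sym (negVar-Q-1-odd k))))))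
      where
      factorisation : Q-1 n ⊗ (qpow n ⊕ one) ≋ Q-1 (2 ℕ.* n)
      factorisation = trans (difference-of-squares (qpow n))
        (⊕-congʳ {neg one} {qpow n ⊗ qpow n} {qpow (2 ℕ.* n)}
          (≡.subst (λ j → qpow n ⊗ qpow n ≋ qpow j) (≡.cong (ℕ._+_ n) (≡.sym (ℕₚ.+-identityʳ n))) (sym (qpow-+ n n))))

    modulus∣ : modulus n ∣ Q-1 (2 ℕ.* n) ⊗ Q-1 (2 ℕ.* n)
    modulus∣ = ∣-respˡ {(Φ n ⊗ negVar (Φ n)) ⊗ (Φ n ⊗ negVar (Φ n))} {modulus n}
      (sym (square-of-product (negVar (Φ n)) (Φ n)))
      (∣-* {Φ n ⊗ negVar (Φ n)} {Q-1 (2 ℕ.* n)} {Φ n ⊗ negVar (Φ n)} {Q-1 (2 ℕ.* n)} Φ⊗negVarΦ∣Q-1 Φ⊗negVarΦ∣Q-1)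

    -- The passage to q²ʲ - 1 makes the polynomial even, so its coprimality to Φ_n(q) carries over
    -- to Φ_n(-q). As n is odd, it still does not divide 2j.
    Q-1-coprime-modulus : ∀ j → ¬ (n ℕ∣.∣ j) → Coprime (Q-1 j) (modulus n)
    Q-1-coprime-modulus j n∤j = coprime-∣ˡ {Q-1 j} {Q-1 (2 ℕ.* j)} {modulus n} (Q-1-∣ (ℕ∣.n∣m*n 2))
      (coprime-*ʳ {D} {pow (negVar (Φ n)) 2} {pow (Φ n) 2} (squared (negVar (Φ n)) coprime-negVarΦ) (squared (Φ n) coprime-Φ))
      where
      D : Poly
      D = Q-1 (2 ℕ.* j)
      Φ-coprime : Coprime (Φ n) D
      Φ-coprime = Φ-coprime-Q-1 n (2 ℕ.* j) (λ n∣2j → n∤j (odd-divides-double n∣2j))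
      coprime-Φ : Coprime D (Φ n)
      coprime-Φ = coprime-sym {Φ n} {D} Φ-coprime
      coprime-negVarΦ : Coprime D (negVar (Φ n))
      coprime-negVarΦ = coprime-sym {negVar (Φ n)} {D}
        (coprime-∣ʳ {D} {negVar (Φ n)} {negVar D} (∣-respʳ {D} {D} {negVar D} (sym (negVar-Q-1-even j)) (∣-refl {D}))
          (negVar-coprime {Φ n} {D} Φ-coprime))
      squared : ∀ φ → Coprime D φ → Coprime D (pow φ 2)
      squared φ c = coprime-*ʳ {D} {φ} {φ ⊗ one} c
        (coprime-*ʳ {D} {φ} {one} c (coprime-sym {one} {D} (coprime-1# D)))

-- Arithmetic of the exponents of q.

module Exponents where
  open import Data.Nat.Base using (_+_; _*_)

  x-exponent : ∀ d m → 2 + 2 * d * m ≡ 2 * suc (m * d)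
  x-exponent = solve-∀

  kernel-zero : ∀ d → 0 ≡ suc d * 0 * 0 + d * 0
  kernel-zero = solve-∀

  kernel-suc : ∀ d k →
    (suc d * k * k + d * k) + (2 * suc d * k + (d + 1 * suc d)) ≡ suc d * suc k * suc k + d * suc k
  kernel-suc = solve-∀

  tri-base : ∀ d k → suc (suc k * d) + 1 ≡ 2 + k * d + d
  tri-base = solve-∀

  tri-suc : ∀ d k → suc k * (2 + k * d) + (2 + 2 * d * suc k) ≡ suc (suc k) * (2 + suc k * d)
  tri-suc = solve-∀

  cube : ∀ m z → 3 * m * z ≡ m * z + (m * z + m * z)
  cube = solve-∀

  triple : ∀ m → m + m + m ≡ m * 3
  triple = solve-∀

  ip-exponent : ∀ d i → 2 * d + 2 * d * i ≡ 2 * (d * suc i)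
  ip-exponent = solve-∀

  ia-exponent : ∀ d i → 2 + 2 * d * i ≡ 2 * suc (d * i)
  ia-exponent = solve-∀

  ia-beyond-exponent : ∀ d m i → 2 + 2 * d * (m + suc i) ≡ 2 * (suc (m * d) + d * suc i)
  ia-beyond-exponent = solve-∀

  ia²-exponent : ∀ d i → 4 + 2 * d * i ≡ 2 * (2 + d * i)
  ia²-exponent = solve-∀

  ib-exponent : ∀ d j → suc (1 + 2 * d * j) ≡ suc (d * j) + suc (d * j)
  ib-exponent = solve-∀

-- Admissible denominators and an interface to the ring of fractions.

module RegularPolynomials where
  open Modulus public

  -- All denominators of the theorem are products of 1 + q and factors 1 - qʲ with j > 0, so their
  -- constant term is 1. This set is closed under products, its elements are cancellable, and
  -- membership of a single factor is decided by computation.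
  Regular : Poly → Set
  Regular f = coef f 0 ≡ + 1

  regular-⊗ : ∀ {f g} → Regular f → Regular g → Regular (f ⊗ g)
  regular-⊗ {f} {g} rf rg = ≡.trans (coef-⊗ f g 0) (≡.cong₂ ℤ._*_ rf rg)

  regular-pow : ∀ f k → Regular f → Regular (pow f k)
  regular-pow f zero    rf = ≡.refl
  regular-pow f (suc k) rf = regular-⊗ {f} {pow f k} rf (regular-pow f k rf)

  regular-one⊖ : ∀ r g → Regular (one ⊖ qpow (suc r) ⊗ g)
  regular-one⊖ r g = ≡.trans (coef-⊖ one (qpow (suc r) ⊗ g) 0)
    (≡.cong (λ z → + 1 ℤ.- z) (coef-⊗ (qpow (suc r)) g 0))

  regular-poch : ∀ r s k → Regular (poch (qpow (suc r)) s k)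
  regular-poch r s zero    = ≡.refl
  regular-poch r s (suc k) = regular-⊗ {poch (qpow (suc r)) s k} {one ⊖ qpow (suc r) ⊗ pow s k}
    (regular-poch r s k) (regular-one⊖ r (pow s k))

-- All that the evaluation uses of the ring of fractions: it contains ℤ[q], and polynomials with
-- constant term 1 have inverses. The fractions themselves stay abstract until the end.
record RegularEmbedding {c ℓ} (K : CommutativeRing c ℓ) : Set (c ⊔ ℓ) where
  open CommutativeRing K
  open RegularPolynomials using (_≋_; Regular)
  field
    ι           : Poly → Carrier
    ι-cong      : ∀ {f g} → f ≋ g → ι f ≈ ι g
    ι-injective : ∀ {f g} → ι f ≈ ι g → f ≋ g
    ι-⊕         : ∀ f g → ι (f ⊕ g) ≈ ι f + ι g
    ι-⊗         : ∀ f g → ι (f ⊗ g) ≈ ι f * ι g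
    ι-neg       : ∀ f → ι (neg f) ≈ - ι f
    ι-one       : ι one ≈ 1#
    inverse     : ∀ f → Regular f → Carrier
    ι-inverse   : ∀ f r → ι f * inverse f r ≈ 1#

-- Formal fractions and their values; elements integral at a polynomial.

module Representation {c ℓ} (K : CommutativeRing c ℓ) (emb : RegularEmbedding K) where
  open CommutativeRing K
  open RegularEmbedding emb public
  open RegularPolynomials public using (Regular; regular-⊗; regular-pow; regular-poch; _≋_; Coprime; bézout; Q-1; _∣_; divides)
  open import Relation.Binary.Reasoning.Setoid setoid
  open IntegerCoefficients K
  open Solver
  open Sums K

  ι-⊖ : ∀ f g → ι (f ⊖ g) ≈ ι f - ι g
  ι-⊖ f g = trans (ι-⊕ f (neg g)) (+-congˡ (ι-neg g))

  ι-[] : ι [] ≈ 0#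
  ι-[] = begin
    ι []                  ≈⟨ ι-cong (CommutativeRing.sym polyRing (CommutativeRing.-‿inverseʳ polyRing one)) ⟩
    ι (one ⊖ one)         ≈⟨ ι-⊖ one one ⟩
    ι one - ι one         ≈⟨ -‿inverseʳ (ι one) ⟩
    0#                    ∎
    where open Polynomials using (polyRing)

  infix 4 _represents_

  record _represents_ (φ : Frac) (κ : Carrier) : Set ℓ where
    constructor represent
    field
      regular : Regular (proj₂ φ)
      value   : ι (proj₂ φ) * κ ≈ ι (proj₁ φ)
  open _represents_ public

  represents-resp : ∀ {φ κ κ′} → κ ≈ κ′ → φ represents κ → φ represents κ′
  represents-resp κ≈κ′ (represent r v) = represent r (trans (*-congˡ (sym κ≈κ′)) v)

  represents-zeroF : zeroF represents 0#
  represents-zeroF = represent ≡.refl (trans (zeroʳ _) (sym ι-[]))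

  represents-+F : ∀ {φ ψ κ κ′} → φ represents κ → ψ represents κ′ → φ +F ψ represents κ + κ′
  represents-+F {a , b} {a′ , b′} {κ} {κ′} (represent r v) (represent r′ v′) = represent (regular-⊗ {b} {b′} r r′) (begin
    ι (b ⊗ b′) * (κ + κ′)               ≈⟨ *-congʳ (ι-⊗ b b′) ⟩
    (ι b * ι b′) * (κ + κ′)
      ≈⟨ solve 4 (λ b b′ k k′ → (b :* b′) :* (k :+ k′) := (b :* k) :* b′ :+ (b′ :* k′) :* b) refl _ _ _ _ ⟩
    (ι b * κ) * ι b′ + (ι b′ * κ′) * ι b  ≈⟨ +-cong (*-congʳ v) (*-congʳ v′) ⟩
    ι a * ι b′ + ι a′ * ι b             ≈⟨ +-cong (ι-⊗ a b′) (ι-⊗ a′ b) ⟨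
    ι (a ⊗ b′) + ι (a′ ⊗ b)             ≈⟨ ι-⊕ (a ⊗ b′) (a′ ⊗ b) ⟨
    ι (a ⊗ b′ ⊕ a′ ⊗ b)                 ∎)

  represents-*F : ∀ {φ ψ κ κ′} → φ represents κ → ψ represents κ′ → φ *F ψ represents κ * κ′
  represents-*F {a , b} {a′ , b′} {κ} {κ′} (represent r v) (represent r′ v′) = represent (regular-⊗ {b} {b′} r r′) (begin
    ι (b ⊗ b′) * (κ * κ′)      ≈⟨ *-congʳ (ι-⊗ b b′) ⟩
    (ι b * ι b′) * (κ * κ′)
      ≈⟨ solve 4 (λ b b′ k k′ → (b :* b′) :* (k :* k′) := (b :* k) :* (b′ :* k′)) refl _ _ _ _ ⟩
    (ι b * κ) * (ι b′ * κ′)    ≈⟨ *-cong v v′ ⟩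
    ι a * ι a′                 ≈⟨ ι-⊗ a a′ ⟨
    ι (a ⊗ a′)                 ∎)

  represents-sumF : ∀ n {φ κ} → (∀ i → φ i represents κ i) → sumF n φ represents sum n κ
  represents-sumF zero    rep = represents-zeroF
  represents-sumF (suc n) rep = represents-+F (represents-sumF n rep) (rep n)

  -- The elements that become polynomials after multiplication by some D coprime to P. No reduced
  -- form is needed, and D is the denominator that `CongMod` asks for.
  localSubring : Poly → Subring K _
  localSubring P = record
    { Loc      = Loc
    ; Loc-resp = λ { x≈y (D , w , cop , e) → D , w , cop , trans (*-congˡ (sym x≈y)) e }
    ; Loc-1#   = one , one , coprime-1# P , *-identityʳ (ι one)
    ; Loc-+    = λ { {x} {y} (D , w , cop , e) (D′ , w′ , cop′ , e′) →
        D ⊗ D′ , w ⊗ D′ ⊕ w′ ⊗ D , coprime-* {D} {D′} {P} cop cop′ , (begin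
          ι (D ⊗ D′) * (x + y)               ≈⟨ *-congʳ (ι-⊗ D D′) ⟩
          (ι D * ι D′) * (x + y)
            ≈⟨ solve 4 (λ b b′ k k′ → (b :* b′) :* (k :+ k′) := (b :* k) :* b′ :+ (b′ :* k′) :* b) refl _ _ _ _ ⟩
          (ι D * x) * ι D′ + (ι D′ * y) * ι D  ≈⟨ +-cong (*-congʳ e) (*-congʳ e′) ⟩
          ι w * ι D′ + ι w′ * ι D            ≈⟨ +-cong (ι-⊗ w D′) (ι-⊗ w′ D) ⟨
          ι (w ⊗ D′) + ι (w′ ⊗ D)            ≈⟨ ι-⊕ (w ⊗ D′) (w′ ⊗ D) ⟨
          ι (w ⊗ D′ ⊕ w′ ⊗ D)                ∎) }
    ; Loc-*    = λ { {x} {y} (D , w , cop , e) (D′ , w′ , cop′ , e′) →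
        D ⊗ D′ , w ⊗ w′ , coprime-* {D} {D′} {P} cop cop′ , (begin
          ι (D ⊗ D′) * (x * y)      ≈⟨ *-congʳ (ι-⊗ D D′) ⟩
          (ι D * ι D′) * (x * y)
            ≈⟨ solve 4 (λ b b′ k k′ → (b :* b′) :* (k :* k′) := (b :* k) :* (b′ :* k′)) refl _ _ _ _ ⟩
          (ι D * x) * (ι D′ * y)    ≈⟨ *-cong e e′ ⟩
          ι w * ι w′                ≈⟨ ι-⊗ w w′ ⟨
          ι (w ⊗ w′)                ∎) }
    ; Loc-neg  = λ { {x} (D , w , cop , e) → D , neg w , cop , (begin
          ι D * - x    ≈⟨ solve 2 (λ d x → d :* (:- x) := :- (d :* x)) refl _ _ ⟩
          - (ι D * x)  ≈⟨ -‿cong e ⟩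
          - ι w        ≈⟨ ι-neg w ⟨
          ι (neg w)    ∎) }
    }
    where
    open RegularPolynomials using (coprime-1#; coprime-*)
    Loc : Carrier → Set _
    Loc x = ∃ λ D → ∃ λ w → Coprime D P × ι D * x ≈ ι w

  Loc-ι : ∀ P f → Subring.Loc (localSubring P) (ι f)
  Loc-ι P f = one , f , RegularPolynomials.coprime-1# P , trans (*-congʳ ι-one) (*-identityˡ (ι f))

  Loc-inverse : ∀ P f r → Coprime f P → Subring.Loc (localSubring P) (inverse f r)
  Loc-inverse P f r cop = f , one , cop , trans (ι-inverse f r) (sym ι-one)

  represents⇒CongMod : ∀ {P μ φ ψ κ κ′ z} → φ represents κ → ψ represents κ′ → P ∣ μ →
    Subring.Loc (localSubring P) z → κ - κ′ ≈ ι μ * z → CongMod P φ ψ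
  represents⇒CongMod {P} {μ} {a , b} {c′ , e} {κ} {κ′} {z} (represent _ bκ≈a) (represent _ eκ′≈c) (divides w₀ μ≋Pw₀)
    (D , w₁ , bézout u v y (y₀ , y₀≢0 , y≋y₀) uD+vP≋y , Dz≈w₁) κ-κ′≈μz =
    -- With μ = Pw₀ and z = w₁/D, the difference μz is Pw₀w₁/D, which dictates the witnesses N and
    -- D.
    P ⊗ (w₀ ⊗ w₁) , D , w₀ ⊗ w₁ , u , v , y₀ , y₀≢0 , ≋⇒≈P {D ⊗ (a ⊗ e ⊖ c′ ⊗ b)} {P ⊗ (w₀ ⊗ w₁) ⊗ (b ⊗ e)} (ι-injective (begin
      ι (D ⊗ (a ⊗ e ⊖ c′ ⊗ b))
        ≈⟨ trans (ι-⊗ D _) (*-congˡ (trans (ι-⊖ (a ⊗ e) (c′ ⊗ b)) (+-cong (ι-⊗ a e) (-‿cong (ι-⊗ c′ b))))) ⟩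
      ι D * (ι a * ι e - ι c′ * ι b)
        ≈⟨ *-congˡ (+-cong (*-congʳ bκ≈a) (-‿cong (*-congʳ eκ′≈c))) ⟨
      ι D * ((ι b * κ) * ι e - (ι e * κ′) * ι b)
        ≈⟨ solve 5 (λ D b k e k′ → D :* ((b :* k) :* e :- (e :* k′) :* b) := (D :* (k :- k′)) :* (b :* e)) refl _ _ _ _ _ ⟩
      (ι D * (κ - κ′)) * (ι b * ι e)
        ≈⟨ *-cong (*-congˡ (trans κ-κ′≈μz (*-congʳ (trans (ι-cong μ≋Pw₀) (ι-⊗ P w₀))))) (sym (ι-⊗ b e)) ⟩
      (ι D * ((ι P * ι w₀) * z)) * ι (b ⊗ e)
        ≈⟨ *-congʳ (solve 4 (λ D P w z → D :* ((P :* w) :* z) := P :* (w :* (D :* z))) refl _ _ _ _) ⟩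
      (ι P * (ι w₀ * (ι D * z))) * ι (b ⊗ e)
        ≈⟨ *-congʳ (*-congˡ (*-congˡ Dz≈w₁)) ⟩
      (ι P * (ι w₀ * ι w₁)) * ι (b ⊗ e)
        ≈⟨ *-congʳ (trans (ι-⊗ P (w₀ ⊗ w₁)) (*-congˡ (ι-⊗ w₀ w₁))) ⟨
      ι (P ⊗ (w₀ ⊗ w₁)) * ι (b ⊗ e)
        ≈⟨ ι-⊗ (P ⊗ (w₀ ⊗ w₁)) (b ⊗ e) ⟨
      ι (P ⊗ (w₀ ⊗ w₁) ⊗ (b ⊗ e)) ∎)) ,
    ≋⇒≈P {P ⊗ (w₀ ⊗ w₁)} {P ⊗ (w₀ ⊗ w₁)} (CommutativeRing.refl polyRing) ,
    ≋⇒≈P {u ⊗ D ⊕ v ⊗ P} {cst y₀} (CommutativeRing.trans polyRing uD+vP≋y y≋y₀)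
    where open Polynomials using (≋⇒≈P; polyRing)

-- Both sides of the theorem as values of the abstract series.

module Evaluation {c ℓ} (K : CommutativeRing c ℓ) (emb : RegularEmbedding K) (d₁ m : ℕ) where
  open CommutativeRing K
  open Representation K emb public
  open import Relation.Binary.Reasoning.Setoid setoid
  open IntegerCoefficients K
  open Solver
  open Sums K

  d n : ℕ
  d = suc d₁
  n = suc (m ℕ.* d)

  qᵏ : ℕ → Carrier
  qᵏ k = ι (qpow k)

  -- 1 / (1 - qʲ); the junk value at j = 0 is 1 / (1 - q).
  1/1-q : ℕ → Carrier
  1/1-q j = inverse (one ⊖ qpow (suc (pred j))) ≡.refl

  b e f iβ : Carrier
  b = qᵏ 1
  e = qᵏ (2 ℕ.* d ∸ 1)
  f = qᵏ (2 ℕ.* d₁)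
  iβ = inverse (one ⊕ qpow 1) ≡.refl

  ip ia ib ia² : ℕ → Carrier
  ip i = 1/1-q (2 ℕ.* d ℕ.+ 2 ℕ.* d ℕ.* i)
  ia i = 1/1-q (2 ℕ.+ 2 ℕ.* d ℕ.* i)
  ib i = 1/1-q (1 ℕ.+ 2 ℕ.* d ℕ.* i)
  ia² i = 1/1-q (4 ℕ.+ 2 ℕ.* d ℕ.* i)

  open Summands K b e f iβ ip ib m public
  open Pochhammer K p

  qᵏ-+ : ∀ i j → qᵏ (i ℕ.+ j) ≈ qᵏ i * qᵏ j
  qᵏ-+ i j = trans (ι-cong (RegularPolynomials.qpow-+ i j)) (ι-⊗ (qpow i) (qpow j))

  p≈ : p ≈ qᵏ (2 ℕ.* d)
  p≈ = sym (qᵏ-+ 1 (2 ℕ.* d ∸ 1))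

  a≈ : a ≈ qᵏ 2
  a≈ = sym (qᵏ-+ 1 1)

  aa≈ : a * a ≈ qᵏ 4
  aa≈ = trans (*-cong a≈ a≈) (sym (qᵏ-+ 2 2))

  af≈p : a * f ≈ p
  af≈p = begin
    a * f                 ≈⟨ *-congʳ a≈ ⟩
    qᵏ 2 * f              ≈⟨ qᵏ-+ 2 (2 ℕ.* d₁) ⟨
    qᵏ (2 ℕ.+ 2 ℕ.* d₁)   ≡⟨ ≡.cong qᵏ (ℕₚ.*-suc 2 d₁) ⟨
    qᵏ (2 ℕ.* d)          ≈⟨ p≈ ⟨
    p                     ∎

  power≈ : ∀ {y} r i → y ≈ qᵏ r → y ^ i ≈ qᵏ (r ℕ.* i)
  power≈ {y} r zero y≈ rewrite ℕₚ.*-zeroʳ r = sym ι-one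
  power≈ {y} r (suc i) y≈ = begin
    y * y ^ i               ≈⟨ *-cong y≈ (power≈ r i y≈) ⟩
    qᵏ r * qᵏ (r ℕ.* i)     ≈⟨ qᵏ-+ r (r ℕ.* i) ⟨
    qᵏ (r ℕ.+ r ℕ.* i)      ≡⟨ ≡.cong qᵏ (ℕₚ.*-suc r i) ⟨
    qᵏ (r ℕ.* suc i)        ∎

  shifted≈ : ∀ {y} r i → y ≈ qᵏ r → y * p ^ i ≈ qᵏ (r ℕ.+ 2 ℕ.* d ℕ.* i)
  shifted≈ {y} r i y≈ = trans (*-cong y≈ (power≈ (2 ℕ.* d) i p≈)) (sym (qᵏ-+ r (2 ℕ.* d ℕ.* i)))

  factor≈ : ∀ {y} r i → y ≈ qᵏ r → factor y i ≈ ι (one ⊖ qpow (r ℕ.+ 2 ℕ.* d ℕ.* i))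
  factor≈ {y} r i y≈ = trans (+-cong (sym ι-one) (-‿cong (shifted≈ r i y≈)))
    (sym (ι-⊖ one (qpow (r ℕ.+ 2 ℕ.* d ℕ.* i))))

  inverse-factor : ∀ {y} r → y ≈ qᵏ (suc r) → FactorsInvertedBy y (λ i → 1/1-q (suc r ℕ.+ 2 ℕ.* d ℕ.* i))
  inverse-factor {y} r y≈ i = trans (*-congʳ (factor≈ (suc r) i y≈)) (ι-inverse (one ⊖ qpow (suc r ℕ.+ 2 ℕ.* d ℕ.* i)) ≡.refl)

  ip-inv : FactorsInvertedBy p ip
  ip-inv = inverse-factor (2 ℕ.* d ∸ 1) p≈

  ia-inv : FactorsInvertedBy a ia
  ia-inv = inverse-factor 1 a≈

  ib-inv : FactorsInvertedBy b ib
  ib-inv = inverse-factor 0 refl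

  ia²-inv : FactorsInvertedBy (a * a) ia²
  ia²-inv = inverse-factor 3 aa≈

  β-inv : (1# + b) * iβ ≈ 1#
  β-inv = trans (*-congʳ (trans (+-congʳ (sym ι-one)) (sym (ι-⊕ one (qpow 1))))) (ι-inverse (one ⊕ qpow 1) ≡.refl)

  x≈ : x ≈ qᵏ (2 ℕ.* n)
  x≈ = trans (shifted≈ 2 m a≈) (reflexive (≡.cong qᵏ
    (Exponents.x-exponent d m)))

  ι-pow : ∀ g k → ι (pow g k) ≈ ι g ^ k
  ι-pow g zero    = ι-one
  ι-pow g (suc k) = trans (ι-⊗ g (pow g k)) (*-congˡ (ι-pow g k))

  ι-square : ∀ {y} g → ι g ≈ y → ι (pow g 2) ≈ y * y
  ι-square g e = trans (ι-pow g 2) (trans (*-cong e (*-congʳ e)) (*-congˡ (*-identityʳ _)))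

  ι-sgn : ∀ k → ι (sgn k) ≈ sign k
  ι-sgn k = trans (ι-pow (cst ℤ.-1ℤ) k) (Exp.^-cong semiring (trans (ι-neg one) (-‿cong ι-one)) (≡.refl {x = k}))
    where import Algebra.Properties.Semiring.Exp as Exp

  ι-poch : ∀ {y} r k → y ≈ qᵏ r → ι (poch (qpow r) (qpow (2 ℕ.* d)) k) ≈ pochhammer y k
  ι-poch r zero    y≈ = ι-one
  ι-poch {y} r (suc k) y≈ = trans (ι-⊗ (poch (qpow r) (qpow (2 ℕ.* d)) k) _) (*-cong (ι-poch r k y≈) (begin
    ι (one ⊖ qpow r ⊗ pow (qpow (2 ℕ.* d)) k)       ≈⟨ ι-⊖ one _ ⟩
    ι one - ι (qpow r ⊗ pow (qpow (2 ℕ.* d)) k)     ≈⟨ +-cong ι-one (-‿cong (ι-⊗ (qpow r) _)) ⟩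
    1# - qᵏ r * ι (pow (qpow (2 ℕ.* d)) k)
      ≈⟨ +-congˡ (-‿cong (*-cong (sym y≈) (trans (ι-pow (qpow (2 ℕ.* d)) k) (Exp.^-cong semiring (sym p≈) (≡.refl {x = k}))))) ⟩
    factor y k                                      ∎))
    where import Algebra.Properties.Semiring.Exp as Exp

  -- The exponent is dk(k-1) + (2d-1)k = dk² + (d-1)k; this is what fixes e = p/b.
  kernel-power : ∀ k → p^tri k * e ^ k ≈ qᵏ (d ℕ.* k ℕ.* k ℕ.+ d₁ ℕ.* k)
  kernel-power zero = begin
    1# * 1#    ≈⟨ *-identityˡ 1# ⟩
    1#         ≈⟨ ι-one ⟨
    qᵏ 0       ≡⟨ ≡.cong qᵏ (Exponents.kernel-zero d₁) ⟩
    qᵏ (d ℕ.* 0 ℕ.* 0 ℕ.+ d₁ ℕ.* 0) ∎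
  kernel-power (suc k) = begin
    (p^tri k * p ^ k) * (e * e ^ k)
      ≈⟨ solve 4 (λ t y e E → (t :* y) :* (e :* E) := (t :* E) :* (y :* e)) refl _ _ _ _ ⟩
    (p^tri k * e ^ k) * (p ^ k * e)
      ≈⟨ *-cong (kernel-power k) (trans (*-congʳ (power≈ (2 ℕ.* d) k p≈)) (sym (qᵏ-+ (2 ℕ.* d ℕ.* k) (2 ℕ.* d ∸ 1)))) ⟩
    qᵏ (d ℕ.* k ℕ.* k ℕ.+ d₁ ℕ.* k) * qᵏ (2 ℕ.* d ℕ.* k ℕ.+ (2 ℕ.* d ∸ 1))
      ≈⟨ qᵏ-+ (d ℕ.* k ℕ.* k ℕ.+ d₁ ℕ.* k) (2 ℕ.* d ℕ.* k ℕ.+ (2 ℕ.* d ∸ 1)) ⟨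
    qᵏ ((d ℕ.* k ℕ.* k ℕ.+ d₁ ℕ.* k) ℕ.+ (2 ℕ.* d ℕ.* k ℕ.+ (2 ℕ.* d ∸ 1)))
      ≡⟨ ≡.cong qᵏ (Exponents.kernel-suc d₁ k) ⟩
    qᵏ (d ℕ.* suc k ℕ.* suc k ℕ.+ d₁ ℕ.* suc k) ∎

  cq-represents : ∀ k → cq d k represents summand k
  cq-represents k = represent
    (regular-⊗ {one ⊕ qpow 1} {pow (poch (qpow (2 ℕ.* d)) (qpow (2 ℕ.* d)) k) 2} ≡.refl
      (regular-pow (poch (qpow (2 ℕ.* d)) (qpow (2 ℕ.* d)) k) 2 (regular-poch (2 ℕ.* d ∸ 1) (qpow (2 ℕ.* d)) k))) (begin
    ι ((one ⊕ qpow 1) ⊗ pow (poch (qpow (2 ℕ.* d)) (qpow (2 ℕ.* d)) k) 2) * summand k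
      ≈⟨ *-congʳ (trans (ι-⊗ (one ⊕ qpow 1) _) (*-cong (trans (ι-⊕ one (qpow 1)) (+-congʳ ι-one))
           (ι-square _ (ι-poch (2 ℕ.* d) k p≈)))) ⟩
    ((1# + b) * (A * A)) * ((1# + b * p ^ k) * iβ * (sign k * p^tri k * e ^ k * (B * B) * (I * I)))
      ≈⟨ solve 9 (λ u A y i σ t E B I →
           (u :* (A :* A)) :* (y :* i :* (σ :* t :* E :* (B :* B) :* (I :* I))) :=
           ((u :* i) :* ((A :* I) :* (A :* I))) :* (σ :* y :* (B :* B) :* (t :* E))) refl _ _ _ _ _ _ _ _ _ ⟩
    (((1# + b) * iβ) * ((A * I) * (A * I))) * (sign k * (1# + b * p ^ k) * (B * B) * (p^tri k * e ^ k))
      ≈⟨ *-congʳ (trans (*-cong β-inv (*-cong (prod-inverse k ip-inv) (prod-inverse k ip-inv)))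
           (trans (*-identityˡ _) (*-identityˡ 1#))) ⟩
    1# * (sign k * (1# + b * p ^ k) * (B * B) * (p^tri k * e ^ k))
      ≈⟨ *-identityˡ _ ⟩
    sign k * (1# + b * p ^ k) * (B * B) * (p^tri k * e ^ k)
      ≈⟨ *-cong (*-cong (*-cong (sym (ι-sgn k)) prefactor) (sym (ι-square _ (ι-poch 2 k a≈)))) (kernel-power k) ⟩
    ι (sgn k) * ι (one ⊕ qpow (2 ℕ.* d ℕ.* k ℕ.+ 1)) * ι (pow (poch (qpow 2) (qpow (2 ℕ.* d)) k) 2)
      * qᵏ (d ℕ.* k ℕ.* k ℕ.+ d₁ ℕ.* k)
      ≈⟨ trans (ι-⊗ (sgn k ⊗ (one ⊕ qpow (2 ℕ.* d ℕ.* k ℕ.+ 1)) ⊗ pow (poch (qpow 2) (qpow (2 ℕ.* d)) k) 2) _)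
           (*-congʳ (trans (ι-⊗ (sgn k ⊗ (one ⊕ qpow (2 ℕ.* d ℕ.* k ℕ.+ 1))) _)
             (*-congʳ (ι-⊗ (sgn k) (one ⊕ qpow (2 ℕ.* d ℕ.* k ℕ.+ 1)))))) ⟨
    ι (proj₁ (cq d k)) ∎)
    where
    A B I : Carrier
    A = pochhammer p k
    B = pochhammer a k
    I = prod k ip
    prefactor : 1# + b * p ^ k ≈ ι (one ⊕ qpow (2 ℕ.* d ℕ.* k ℕ.+ 1))
    prefactor = begin
      1# + b * p ^ k                              ≈⟨ +-cong ι-one (trans (reflexive (≡.cong qᵏ (ℕₚ.+-comm _ 1))) (sym (shifted≈ 1 k refl))) ⟨
      ι one + qᵏ (2 ℕ.* d ℕ.* k ℕ.+ 1)            ≈⟨ ι-⊕ one (qpow (2 ℕ.* d ℕ.* k ℕ.+ 1)) ⟨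
      ι (one ⊕ qpow (2 ℕ.* d ℕ.* k ℕ.+ 1))        ∎

  lhs-represents : lhs n d represents tripleSum n summand
  lhs-represents = represents-sumF n λ i → represents-sumF (n ∸ i) λ j → represents-sumF (n ∸ i ∸ j) λ s →
    represents-*F {cq d i *F cq d j} (represents-*F {cq d i} (cq-represents i) (cq-represents j)) (cq-represents s)

  -- The quotient (b;p)_k / (bp;p)_k of the stated summand telescopes to (1 - b)/(1 - bpᵏ), which
  -- leaves `ib k` as its only inverse.
  inner : ℕ → Carrier
  inner k = f ^ k * (pochhammer a k * prod k ip) * ((1# - b) * ib k)

  pochhammer-ratio : ∀ k → pochhammer (b * p) k * (1# - b) ≈ pochhammer b k * factor b k
  pochhammer-ratio k = begin
    pochhammer (b * p) k * (1# - b)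
      ≈⟨ *-cong (prod-cong k (λ i → +-congˡ (-‿cong (*-congʳ (*-congˡ (sym (*-identityʳ p)))))))
           (solve 1 (λ b → :1 :- b := :1 :* (:1 :- b :* :1)) refl b) ⟩
    pochhammer (b * p ^ 1) k * pochhammer b 1   ≈⟨ *-comm _ _ ⟩
    pochhammer b 1 * pochhammer (b * p ^ 1) k   ≈⟨ pochhammer-+ b 1 k ⟨
    pochhammer b (suc k)                        ∎

  innerSum-represents : innerSum d m represents sum (suc m) inner
  innerSum-represents = represents-sumF (suc m) λ k → represent
    (regular-⊗ {poch (qpow (2 ℕ.* d)) (qpow (2 ℕ.* d)) k} {poch (qpow (2 ℕ.* d ℕ.+ 1)) (qpow (2 ℕ.* d)) k}
      (regular-poch (2 ℕ.* d ∸ 1) (qpow (2 ℕ.* d)) k) (regular-poch (2 ℕ.* d ∸ 1 ℕ.+ 1) (qpow (2 ℕ.* d)) k)) (begin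
    ι (poch (qpow (2 ℕ.* d)) (qpow (2 ℕ.* d)) k ⊗ poch (qpow (2 ℕ.* d ℕ.+ 1)) (qpow (2 ℕ.* d)) k) * inner k
      ≈⟨ *-congʳ (trans (ι-⊗ (poch (qpow (2 ℕ.* d)) (qpow (2 ℕ.* d)) k) _) (*-cong (ι-poch (2 ℕ.* d) k p≈) (ι-poch (2 ℕ.* d ℕ.+ 1) k bp≈))) ⟩
    (pochhammer p k * pochhammer (b * p) k) * (f ^ k * (pochhammer a k * prod k ip) * ((1# - b) * ib k))
      ≈⟨ solve 7 (λ P B F A I y i → (P :* B) :* (F :* (A :* I) :* (y :* i)) :=
           (P :* I) :* (A :* F :* ((B :* y) :* i))) refl _ _ _ _ _ _ _ ⟩
    (pochhammer p k * prod k ip) * (pochhammer a k * f ^ k * ((pochhammer (b * p) k * (1# - b)) * ib k))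
      ≈⟨ *-cong (prod-inverse k ip-inv) (*-congˡ (*-congʳ (pochhammer-ratio k))) ⟩
    1# * (pochhammer a k * f ^ k * ((pochhammer b k * factor b k) * ib k))
      ≈⟨ solve 5 (λ A F B g i → :1 :* (A :* F :* ((B :* g) :* i)) := A :* B :* F :* (g :* i)) refl _ _ _ _ _ ⟩
    pochhammer a k * pochhammer b k * f ^ k * (factor b k * ib k)
      ≈⟨ trans (*-congˡ (ib-inv k)) (*-identityʳ _) ⟩
    pochhammer a k * pochhammer b k * f ^ k
      ≈⟨ *-cong (*-cong (sym (ι-poch 2 k a≈)) (sym (ι-poch 1 k refl))) (power≈ (2 ℕ.* d₁) k refl) ⟩
    ι (poch (qpow 2) (qpow (2 ℕ.* d)) k) * ι (poch (qpow 1) (qpow (2 ℕ.* d)) k) * qᵏ (2 ℕ.* d₁ ℕ.* k)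
      ≈⟨ trans (ι-⊗ (poch (qpow 2) (qpow (2 ℕ.* d)) k ⊗ poch (qpow 1) (qpow (2 ℕ.* d)) k) _)
           (*-congʳ (ι-⊗ (poch (qpow 2) (qpow (2 ℕ.* d)) k) _)) ⟨
    ι (poch (qpow 2) (qpow (2 ℕ.* d)) k ⊗ poch (qpow 1) (qpow (2 ℕ.* d)) k ⊗ qpow (2 ℕ.* d₁ ℕ.* k)) ∎)
    where
    bp≈ : b * p ≈ qᵏ (2 ℕ.* d ℕ.+ 1)
    bp≈ = begin
      b * p                 ≈⟨ *-congˡ p≈ ⟩
      b * qᵏ (2 ℕ.* d)      ≈⟨ qᵏ-+ 1 (2 ℕ.* d) ⟨
      qᵏ (1 ℕ.+ 2 ℕ.* d)    ≡⟨ ≡.cong qᵏ (ℕₚ.+-comm 1 (2 ℕ.* d)) ⟩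
      qᵏ (2 ℕ.* d ℕ.+ 1)    ∎

  qint2-geometric : ∀ k → (1# - a) * ι (qint2 k) ≈ 1# - qᵏ (2 ℕ.* k)
  qint2-geometric zero = begin
    (1# - a) * ι []   ≈⟨ trans (*-congˡ ι-[]) (zeroʳ _) ⟩
    0#                ≈⟨ -‿inverseʳ 1# ⟨
    1# - 1#           ≈⟨ +-congˡ (-‿cong ι-one) ⟨
    1# - qᵏ 0         ∎
  qint2-geometric (suc k) = begin
    (1# - a) * ι (qint2 k ⊕ qpow (2 ℕ.* k))
      ≈⟨ trans (*-congˡ (ι-⊕ (qint2 k) _)) (distribˡ _ _ _) ⟩
    (1# - a) * ι (qint2 k) + (1# - a) * qᵏ (2 ℕ.* k)
      ≈⟨ +-congʳ (qint2-geometric k) ⟩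
    (1# - qᵏ (2 ℕ.* k)) + (1# - a) * qᵏ (2 ℕ.* k)
      ≈⟨ solve 2 (λ a y → (:1 :- y) :+ (:1 :- a) :* y := :1 :- a :* y) refl a _ ⟩
    1# - a * qᵏ (2 ℕ.* k)
      ≈⟨ +-congˡ (-‿cong (trans (*-congʳ a≈) (sym (qᵏ-+ 2 (2 ℕ.* k))))) ⟩
    1# - qᵏ (2 ℕ.+ 2 ℕ.* k)
      ≡⟨ ≡.cong (λ j → 1# - qᵏ j) (ℕₚ.*-suc 2 k) ⟨
    1# - qᵏ (2 ℕ.* suc k) ∎

  scale-factor : Carrier
  scale-factor = ι (qint2 n) * ((- a) ^ m * p^tri m)

  -- Here [n] in base q² arises: 1 - x = (1 - a)[n], and (1 - a)/(1 + b) = 1 - b supplies the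
  -- numerator of `inner`.
  limit≈inner : ∀ j → limit j ≈ scale-factor * inner j
  limit≈inner j = begin
    iβ * ((1# - x) * ib j) * ((- a) ^ m * p^tri m * (f ^ j * (pochhammer a j * prod j ip)))
      ≈⟨ *-congʳ (*-congˡ (*-congʳ (trans (+-congˡ (-‿cong x≈)) (sym (qint2-geometric n))))) ⟩
    iβ * ((1# - b * b) * ι (qint2 n) * ib j) * ((- a) ^ m * p^tri m * (f ^ j * (pochhammer a j * prod j ip)))
      ≈⟨ solve 6 (λ i b N j C F → i :* ((:1 :- b :* b) :* N :* j) :* (C :* F) :=
           ((:1 :+ b) :* i) :* ((N :* C) :* (F :* ((:1 :- b) :* j)))) refl iβ b _ _ _ _ ⟩
    ((1# + b) * iβ) * (scale-factor * inner j)   ≈⟨ trans (*-congʳ β-inv) (*-identityˡ _) ⟩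
    scale-factor * inner j                       ∎

  sum-limit : sum (suc m) limit ≈ scale-factor * sum (suc m) inner
  sum-limit = go (suc m)
    where
    go : ∀ k → sum k limit ≈ scale-factor * sum k inner
    go zero    = sym (zeroʳ _)
    go (suc k) = trans (+-cong (go k) (limit≈inner k)) (sym (distribˡ _ _ _))

  -- The exponent is 2k + dk(k-1) = k(2 + (k-1)d), and the bracket is n + 1 - d for n = kd + 1. At k
  -- = 0 the outer factor hides the truncated subtraction.
  tri-power : ∀ k → a ^ k * p^tri k ≈ qᵏ (k ℕ.* (suc (k ℕ.* d) ℕ.+ 1 ∸ d))
  tri-power zero = trans (*-identityˡ 1#) (sym ι-one)
  tri-power (suc k) = begin
    a ^ suc k * p^tri (suc k)              ≈⟨ go k ⟩
    qᵏ (suc k ℕ.* (2 ℕ.+ k ℕ.* d))         ≡⟨ ≡.cong (λ j → qᵏ (suc k ℕ.* j)) exponent ⟨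
    qᵏ (suc k ℕ.* (suc (suc k ℕ.* d) ℕ.+ 1 ∸ d)) ∎
    where
    exponent : suc (suc k ℕ.* d) ℕ.+ 1 ∸ d ≡ 2 ℕ.+ k ℕ.* d
    exponent = ≡.trans (≡.cong (_∸ d) (Exponents.tri-base d k))
      (ℕₚ.m+n∸n≡m (2 ℕ.+ k ℕ.* d) d)
    go : ∀ k → a ^ suc k * p^tri (suc k) ≈ qᵏ (suc k ℕ.* (2 ℕ.+ k ℕ.* d))
    go zero = trans (solve 1 (λ a → a :* :1 :* (:1 :* :1) := a) refl a) a≈
    go (suc k) = begin
      (a * a ^ suc k) * (p^tri (suc k) * p ^ suc k)
        ≈⟨ solve 4 (λ a A t y → (a :* A) :* (t :* y) := (A :* t) :* (a :* y)) refl _ _ _ _ ⟩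
      (a ^ suc k * p^tri (suc k)) * (a * p ^ suc k)
        ≈⟨ *-cong (go k) (shifted≈ 2 (suc k) a≈) ⟩
      qᵏ (suc k ℕ.* (2 ℕ.+ k ℕ.* d)) * qᵏ (2 ℕ.+ 2 ℕ.* d ℕ.* suc k)
        ≈⟨ qᵏ-+ (suc k ℕ.* (2 ℕ.+ k ℕ.* d)) (2 ℕ.+ 2 ℕ.* d ℕ.* suc k) ⟨
      qᵏ (suc k ℕ.* (2 ℕ.+ k ℕ.* d) ℕ.+ (2 ℕ.+ 2 ℕ.* d ℕ.* suc k))
        ≡⟨ ≡.cong qᵏ (Exponents.tri-suc d k) ⟩
      qᵏ (suc (suc k) ℕ.* (2 ℕ.+ suc k ℕ.* d)) ∎

  prefactor-represents :
    (sgn (3 ℕ.* m) ⊗ pow (qint2 n) 3 ⊗ qpow (3 ℕ.* m ℕ.* (n ℕ.+ 1 ∸ d)) , one)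
      represents scale-factor * scale-factor * scale-factor
  prefactor-represents = represent ≡.refl (begin
    ι one * (scale-factor * scale-factor * scale-factor)
      ≈⟨ trans (*-congʳ ι-one) (*-identityˡ _) ⟩
    scale-factor * scale-factor * scale-factor
      ≈⟨ *-cong (*-cong split split) split ⟩
    (N * (σ * y)) * (N * (σ * y)) * (N * (σ * y))
      ≈⟨ solve 3 (λ N s y → (N :* (s :* y)) :* (N :* (s :* y)) :* (N :* (s :* y)) :=
           (s :* (s :* (s :* :1))) :* (N :* (N :* (N :* :1))) :* (y :* (y :* y))) refl N σ y ⟩
    (σ * (σ * (σ * 1#))) * (N * (N * (N * 1#))) * (y * (y * y))
      ≈⟨ *-cong (*-cong (sym sign³) (sym (ι-pow (qint2 n) 3))) (sym power³) ⟩
    ι (sgn (3 ℕ.* m)) * ι (pow (qint2 n) 3) * qᵏ (3 ℕ.* m ℕ.* (n ℕ.+ 1 ∸ d))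
      ≈⟨ trans (ι-⊗ (sgn (3 ℕ.* m) ⊗ pow (qint2 n) 3) _) (*-congʳ (ι-⊗ (sgn (3 ℕ.* m)) _)) ⟨
    ι (sgn (3 ℕ.* m) ⊗ pow (qint2 n) 3 ⊗ qpow (3 ℕ.* m ℕ.* (n ℕ.+ 1 ∸ d))) ∎)
    where
    E : ℕ
    E = m ℕ.* (n ℕ.+ 1 ∸ d)
    N σ y : Carrier
    N = ι (qint2 n)
    σ = sign m
    y = qᵏ E
    neg-power : ∀ k → (- a) ^ k ≈ sign k * a ^ k
    neg-power zero    = sym (*-identityˡ 1#)
    neg-power (suc k) = trans (*-congˡ (neg-power k))
      (solve 3 (λ a s A → (:- a) :* (s :* A) := (:- :1 :* s) :* (a :* A)) refl _ _ _)
    split : scale-factor ≈ N * (σ * y)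
    split = *-congˡ (trans (*-congʳ (neg-power m)) (trans (*-assoc _ _ _) (*-congˡ (tri-power m))))
    sign³ : ι (sgn (3 ℕ.* m)) ≈ σ * (σ * (σ * 1#))
    sign³ = trans (ι-sgn (3 ℕ.* m)) (trans (sign-+ m (m ℕ.+ (m ℕ.+ 0)))
      (*-congˡ (trans (sign-+ m (m ℕ.+ 0)) (*-congˡ (sign-+ m 0)))))
    power³ : qᵏ (3 ℕ.* m ℕ.* (n ℕ.+ 1 ∸ d)) ≈ y * (y * y)
    power³ = trans (reflexive (≡.cong qᵏ (Exponents.cube m (n ℕ.+ 1 ∸ d))))
      (trans (qᵏ-+ E (E ℕ.+ E)) (*-congˡ (qᵏ-+ E E)))

  rhs-represents : rhs n d m represents sum (suc m) limit * sum (suc m) limit * sum (suc m) limit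
  rhs-represents = represents-resp (begin
      scale-factor * scale-factor * scale-factor * (Y * Y * Y)
        ≈⟨ solve 2 (λ C Y → C :* C :* C :* (Y :* Y :* Y) := (C :* Y) :* (C :* Y) :* (C :* Y)) refl _ _ ⟩
      (scale-factor * Y) * (scale-factor * Y) * (scale-factor * Y)
        ≈⟨ *-cong (*-cong sum-limit sum-limit) sum-limit ⟨
      sum (suc m) limit * sum (suc m) limit * sum (suc m) limit ∎)
    (represents-*F {ψ = innerSum d m *F innerSum d m *F innerSum d m} prefactor-represents
      (represents-*F {innerSum d m *F innerSum d m} (represents-*F {innerSum d m} innerSum-represents innerSum-represents)
        innerSum-represents))
    where
    Y : Carrier
    Y = sum (suc m) inner

-- The case n = 1, and integrality of the inverses for n > 1.

module Conclusion {c ℓ} (K : CommutativeRing c ℓ) (emb : RegularEmbedding K) (d₁ m : ℕ) where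
  open CommutativeRing K
  open Evaluation K emb d₁ m
  open import Relation.Binary.Reasoning.Setoid setoid
  open IntegerCoefficients K
  open Solver
  open Sums K
  open Pochhammer K p

  module Trivial (m≡0 : m ≡ 0) where

    -- For m = 0 every series consists of its term 0, which is 1 on both sides; on the right this
    -- uses 1 - x = (1 + b)(1 - b).
    exact : tripleSum n summand ≈ sum (suc m) limit * sum (suc m) limit * sum (suc m) limit
    exact = go m≡0
      where
      go : m ≡ 0 → tripleSum n summand ≈ sum (suc m) limit * sum (suc m) limit * sum (suc m) limit
      go ≡.refl = begin
        0# + (0# + (0# + summand 0 * summand 0 * summand 0))
          ≈⟨ +-congˡ (+-congˡ (+-congˡ (*-cong (*-cong summand≈1 summand≈1) summand≈1))) ⟩
        0# + (0# + (0# + 1# * 1# * 1#))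
          ≈⟨ solve 0 (:0 :+ (:0 :+ (:0 :+ :1 :* :1 :* :1)) :=
               (:0 :+ :1) :* (:0 :+ :1) :* (:0 :+ :1)) refl ⟩
        (0# + 1#) * (0# + 1#) * (0# + 1#)
          ≈⟨ *-cong (*-cong (+-congˡ limit≈1) (+-congˡ limit≈1)) (+-congˡ limit≈1) ⟨
        (0# + limit 0) * (0# + limit 0) * (0# + limit 0) ∎
        where
        summand≈1 : summand 0 ≈ 1#
        summand≈1 = trans
          (solve 2 (λ b i → (:1 :+ b :* :1) :* i :* (:1 :* :1 :* :1 :* (:1 :* :1) :* (:1 :* :1)) := (:1 :+ b) :* i) refl b iβ)
          β-inv
        limit≈1 : limit 0 ≈ 1#
        limit≈1 = begin
          limit 0
            ≈⟨ solve 3 (λ b i j → i :* ((:1 :- b :* b :* :1) :* j) :* (:1 :* :1 :* (:1 :* (:1 :* :1))) :=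
                 ((:1 :+ b) :* i) :* ((:1 :- b :* :1) :* j)) refl b iβ (ib 0) ⟩
          ((1# + b) * iβ) * (factor b 0 * ib 0)  ≈⟨ *-cong β-inv (ib-inv 0) ⟩
          1# * 1#                                ≈⟨ *-identityˡ 1# ⟩
          1#                                     ∎

    congruence : CongMod (modulus n) (lhs n d) (rhs n d m)
    congruence = represents⇒CongMod {modulus n} {modulus n} {lhs n d} {rhs n d m} {z = ι []}
      lhs-represents rhs-represents (RegularPolynomials.∣-refl {modulus n}) (Loc-ι (modulus n) []) (begin
        tripleSum n summand - sum (suc m) limit * sum (suc m) limit * sum (suc m) limit
          ≈⟨ +-congʳ exact ⟩
        sum (suc m) limit * sum (suc m) limit * sum (suc m) limit - sum (suc m) limit * sum (suc m) limit * sum (suc m) limit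
          ≈⟨ -‿inverseʳ _ ⟩
        0#                      ≈⟨ trans (*-congˡ ι-[]) (zeroʳ _) ⟨
        ι (modulus n) * ι []    ∎)

  module Nontrivial (3≤d : 3 ℕ.≤ d) (0<m : 0 ℕ.< m) (k : ℕ) (n-odd : n ≡ suc (2 ℕ.* k)) where
    open RegularPolynomials using (coprime-∣ˡ)

    P : Poly
    P = modulus n

    S : Subring K _
    S = localSubring P

    open Subring S using (Loc; Loc-resp; Loc-1#; Loc-+; Loc-*; Loc-neg)

    modulus∣ : P ∣ Q-1 (2 ℕ.* n) ⊗ Q-1 (2 ℕ.* n)
    modulus∣ = ≡.subst (λ n → modulus n ∣ Q-1 (2 ℕ.* n) ⊗ Q-1 (2 ℕ.* n)) (≡.sym n-odd) (RegularPolynomials.Odd.modulus∣ k)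

    Q-1-coprime : ∀ j → ¬ (n ℕ∣.∣ j) → Coprime (Q-1 j) P
    Q-1-coprime j = ≡.subst (λ n → ¬ (n ℕ∣.∣ j) → Coprime (Q-1 j) (modulus n)) (≡.sym n-odd)
      (RegularPolynomials.Odd.Q-1-coprime-modulus k j)

    halve : ∀ {j} → n ℕ∣.∣ 2 ℕ.* j → n ℕ∣.∣ j
    halve {j} = ≡.subst (λ n → n ℕ∣.∣ 2 ℕ.* j → n ℕ∣.∣ j) (≡.sym n-odd) (RegularPolynomials.Odd.odd-divides-double k {j})

    n-coprime-d : ∀ {j} → n ℕ∣.∣ d ℕ.* j → n ℕ∣.∣ j
    n-coprime-d {j} = Coprimality.coprime-divisor {n} {d} {j} λ { {x} (x∣n , x∣d) → ℕ∣.∣1⇒≡1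
      (ℕ∣.∣m+n∣m⇒∣n {x} {m ℕ.* d} {1} (≡.subst (x ℕ∣.∣_) (ℕₚ.+-comm 1 (m ℕ.* d)) x∣n) (ℕ∣.∣n⇒∣m*n m x∣d)) }

    d*<n : ∀ {i} → i ℕ.≤ m → d ℕ.* i ℕ.< n
    d*<n {i} i≤m = s≤s (ℕₚ.≤-trans (ℕₚ.*-monoʳ-≤ d i≤m) (ℕₚ.≤-reflexive (ℕₚ.*-comm d m)))

    m<n : m ℕ.< n
    m<n = s≤s (ℕₚ.m≤m*n m d)

    3m<n : m ℕ.+ m ℕ.+ m ℕ.< n
    3m<n = s≤s (ℕₚ.≤-trans
      (ℕₚ.≤-reflexive (Exponents.triple m)) (ℕₚ.*-monoʳ-≤ m 3≤d))

    Loc-1/1-q : ∀ j → ¬ (n ℕ∣.∣ j) → Loc (1/1-q j)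
    Loc-1/1-q zero    n∤0 = contradiction (n ℕ∣.∣0) n∤0
    Loc-1/1-q (suc j) n∤j = Loc-inverse P (one ⊖ qpow (suc j)) ≡.refl
      (coprime-∣ˡ {one ⊖ qpow (suc j)} {Q-1 (suc j)} {P}
        (divides (neg one) (RingIdentities.reversed-difference Polynomials.polyRing (qpow (suc j))))
        (Q-1-coprime (suc j) n∤j))

    Loc-1/1-q-even : ∀ j l → j ≡ 2 ℕ.* l → ¬ (n ℕ∣.∣ l) → Loc (1/1-q j)
    Loc-1/1-q-even j l ≡.refl n∤l = Loc-1/1-q j (λ n∣2l → n∤l (halve n∣2l))

    -- 1 + q divides q² - 1, and n, being odd and greater than 1, does not divide 2.
    Loc-iβ : Loc iβ
    Loc-iβ = Loc-inverse P (one ⊕ qpow 1) ≡.refl (coprime-∣ˡ {one ⊕ qpow 1} {Q-1 2} {P}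
      (divides (Q-1 1) (CommutativeRing.refl Polynomials.polyRing))
      (Q-1-coprime 2 (λ n∣2 → ℕ∣.>⇒∤ (s≤s (ℕₚ.*-mono-≤ 0<m (s≤s z≤n))) (halve {1} n∣2))))


    Loc-ip : ∀ i → suc i ℕ.< n → Loc (ip i)
    Loc-ip i i<n = Loc-1/1-q-even _ (d ℕ.* suc i)
      (Exponents.ip-exponent d i)
      (λ n∣di → ℕ∣.>⇒∤ i<n (n-coprime-d n∣di))

    Loc-ia : ∀ i → i ℕ.< m → Loc (ia i)
    Loc-ia i i<m = Loc-1/1-q-even _ (suc (d ℕ.* i))
      (Exponents.ia-exponent d i)
      (ℕ∣.>⇒∤ (s≤s (ℕₚ.<-≤-trans (ℕₚ.*-monoʳ-< d i<m) (ℕₚ.≤-reflexive (ℕₚ.*-comm d m)))))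

    -- Half the exponent is n + d(i + 1). If n divided it, then n, being prime to d, would divide i
    -- + 1 ≤ m < n.
    Loc-ia-beyond : ∀ i → i ℕ.< m → Loc (ia (m ℕ.+ suc i))
    Loc-ia-beyond i i<m = Loc-1/1-q-even _ (n ℕ.+ d ℕ.* suc i)
      (Exponents.ia-beyond-exponent d m i)
      (λ n∣ → ℕ∣.>⇒∤ (ℕₚ.≤-<-trans i<m m<n) (n-coprime-d (ℕ∣.∣m+n∣m⇒∣n {n} {n} {d ℕ.* suc i} n∣ ℕ∣.∣-refl)))

    -- Half the exponent is 2 + di, and d ≥ 3 gives 2 + di < d(i + 1) ≤ dm < n.
    Loc-ia² : ∀ i → i ℕ.< m → Loc (ia² i)
    Loc-ia² i i<m = Loc-1/1-q-even _ (2 ℕ.+ d ℕ.* i)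
      (Exponents.ia²-exponent d i)
      (ℕ∣.>⇒∤ (s≤s (ℕₚ.≤-trans (ℕₚ.≤-trans (ℕₚ.≤-trans (ℕₚ.n≤1+n _) (ℕₚ.+-monoˡ-≤ (d ℕ.* i) 3≤d))
        (ℕₚ.≤-reflexive (≡.sym (ℕₚ.*-suc d i)))) (ℕₚ.≤-pred (d*<n i<m)))))

    Loc-1-x : Loc (1# - x)
    Loc-1-x = Loc-resp (+-congˡ (-‿cong (sym x≈))) (Loc-+ Loc-1# (Loc-neg (Loc-ι P (qpow (2 ℕ.* n)))))

    -- The only denominator 1 - b pʲ = 1 - q¹⁺²ᵈʲ divisible by Φ_n(q) is 1 - qⁿ, which divides 1 - x.
    Loc-ib : ∀ j → j ℕ.≤ m → Loc ((1# - x) * ib j)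
    Loc-ib j j≤m with n ℕ∣.∣? (1 ℕ.+ 2 ℕ.* d ℕ.* j)
    ... | no n∤ = Loc-* Loc-1-x (Loc-1/1-q (1 ℕ.+ 2 ℕ.* d ℕ.* j) n∤)
    ... | yes (ℕ∣.divides 0 ())
    -- From dj < n follows 1 + 2dj = 2(dj + 1) - 1 < 2n, so the quotient cannot reach 2.
    ... | yes (ℕ∣.divides (suc (suc r)) e) = contradiction e (ℕₚ.<⇒≢ (ℕₚ.≤-trans
      (ℕₚ.≤-reflexive (Exponents.ib-exponent d j))
      (ℕₚ.≤-trans (ℕₚ.+-mono-≤ (d*<n j≤m) (d*<n j≤m))
        (ℕₚ.≤-trans (ℕₚ.≤-reflexive (≡.cong (ℕ._+_ n) (≡.sym (ℕₚ.+-identityʳ n)))) (ℕₚ.*-monoˡ-≤ n (s≤s (s≤s (z≤n {r}))))))))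
    -- Now 1 + 2dj = n, and x = y² for y = qⁿ, so (1 - x)/(1 - y) is the polynomial 1 + y.
    ... | yes (ℕ∣.divides 1 e) = Loc-resp (begin
        1# + y                  ≈⟨ trans (*-congˡ inverse-y) (*-identityʳ _) ⟨
        (1# + y) * ((1# - y) * ib j)
          ≈⟨ solve 2 (λ y i → (:1 :+ y) :* ((:1 :- y) :* i) := (:1 :- y :* y) :* i) refl y (ib j) ⟩
        (1# - y * y) * ib j     ≈⟨ *-congʳ (+-congˡ (-‿cong (sym x≈y²))) ⟩
        (1# - x) * ib j         ∎) (Loc-+ Loc-1# (Loc-ι P (qpow n)))
      where
      y : Carrier
      y = qᵏ n
      x≈y² : x ≈ y * y
      x≈y² = trans x≈ (trans (reflexive (≡.cong (λ j → qᵏ (n ℕ.+ j)) (ℕₚ.+-identityʳ n))) (qᵏ-+ n n))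
      inverse-y : (1# - y) * ib j ≈ 1#
      inverse-y = trans (*-congʳ (+-congˡ (-‿cong (sym (trans (shifted≈ 1 j refl)
        (reflexive (≡.cong qᵏ (≡.trans e (ℕₚ.*-identityˡ n))))))))) (ib-inv j)

    private
      X Δ : Carrier
      X = sum (suc m) limit * sum (suc m) limit * sum (suc m) limit
      Δ = tripleSum n summand - X

    triple-sum : ∃ λ z → Loc z × Δ ≈ (1# - x) * (1# - x) * z
    triple-sum = Supercongruence.triple-sum K S b e f iβ ip ia ib ia² af≈p ip-inv ia-inv ib-inv ia²-inv m n m<n
        (Loc-ι P (qpow 1)) (Loc-ι P (qpow (2 ℕ.* d ∸ 1))) (Loc-ι P (qpow (2 ℕ.* d₁))) Loc-iβ
        Loc-ip Loc-ia Loc-ia-beyond Loc-ia² Loc-ib 3m<n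

    modulus≈ : ∀ N → x ≈ qᵏ N → (1# - x) * (1# - x) ≈ ι (Q-1 N ⊗ Q-1 N)
    modulus≈ N x≈qᴺ = begin
      (1# - x) * (1# - x)
        ≈⟨ solve 1 (λ x → (:1 :- x) :* (:1 :- x) := (x :- :1) :* (x :- :1)) refl x ⟩
      (x - 1#) * (x - 1#)    ≈⟨ *-cong x-1 x-1 ⟩
      ι (Q-1 N) * ι (Q-1 N)  ≈⟨ ι-⊗ (Q-1 N) (Q-1 N) ⟨
      ι (Q-1 N ⊗ Q-1 N)      ∎
      where
      x-1 : x - 1# ≈ ι (Q-1 N)
      x-1 = trans (+-cong x≈qᴺ (-‿cong (sym ι-one))) (sym (ι-⊖ (qpow N) one))

    congruence : CongMod P (lhs n d) (rhs n d m)
    congruence = represents⇒CongMod {P} {Q-1 (2 ℕ.* n) ⊗ Q-1 (2 ℕ.* n)} {lhs n d} {rhs n d m}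
      {tripleSum n summand} {X} {proj₁ triple-sum} lhs-represents rhs-represents modulus∣ (proj₁ (proj₂ triple-sum))
      (trans (proj₂ (proj₂ triple-sum)) (*-congʳ (modulus≈ (2 ℕ.* n) x≈)))

-- The localisation of ℤ[q] at the polynomials with constant term 1, and the theorem.

module RationalFunctions where
  open RegularPolynomials
  open CommutativeRing polyRing using (sym; trans; *-identityʳ)

  open Localization polyRing Regular ≡.refl (λ {g} {h} → regular-⊗ {g} {h})
    (λ {g} {f} rg → ⊗-regular {g} {f} (λ g₀≡0 → contradiction (≡.trans (≡.sym rg) g₀≡0) λ ())) public

  embedding : RegularEmbedding localization
  embedding = record
    { ι           = ι
    ; ι-cong      = ι-cong
    ; ι-injective = λ {f} {g} e → trans (sym (*-identityʳ f)) (trans (uncross e) (*-identityʳ g))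
    ; ι-⊕         = ι-+
    ; ι-⊗         = ι-*
    ; ι-neg       = ι-neg
    ; ι-one       = CommutativeRing.refl localization
    ; inverse     = recip
    ; ι-inverse   = ι-recip
    }

open import Data.Nat using (ℕ; _≤_; _+_; _*_; _%_)
open import Relation.Binary.PropositionalEquality using (_≡_)

theorem5p2 : (n d m : ℕ) → n % 2 ≡ 1 → 3 ≤ d → n ≡ 1 + m * d →
    CongMod (modulus n) (lhs n d) (rhs n d m)
theorem5p2 n (suc d₁) zero n-odd 3≤d ≡.refl =
  Conclusion.Trivial.congruence RationalFunctions.localization RationalFunctions.embedding d₁ 0 ≡.refl
theorem5p2 n@.(1 + suc m * suc d₁) (suc d₁) (suc m) n-odd 3≤d ≡.refl =
  Conclusion.Nontrivial.congruence RationalFunctions.localization RationalFunctions.embedding d₁ (suc m) 3≤d (s≤s z≤n)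
    (n DivMod./ 2) (≡.trans (DivMod.m≡m%n+[m/n]*n n 2) (≡.cong₂ _+_ n-odd (ℕₚ.*-comm (n DivMod./ 2) 2)))
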